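{- There exists $C >1$ satisfying the following. Let $G$ be a graph with $\kappa(G) \geq Ct(\log t)^{1/4}$, and let $r \geq \sqrt{\log t}/2$ be an integer. If there exist pairwise vertex-disjoint subgraphs $H_1,H_2,\ldots,H_{r}$ of $G$ such that $\mathrm{d}(H_i) \geq Ct(\log t)^{1/4}$ for every $i \in [r]$, then $G$ has a $K_t$ minor.
   Context: All graphs are finite and simple; logarithms are natural. $\kappa(G)$ is the vertex connectivity of $G$, and $\mathrm{d}(H)=|E(H)|/|V(H)|$ is the density of a non-null graph $H$. $[r]=\{1,\dots,r\}$. -}

module Defs where

open import Data.Nat using (ℕ; zero; suc; _+_; _*_; _^_; _≤_; _<_; _<?_; _!)
open import Data.Bool using (Bool; true; false; not; _∧_; if_then_else_)
open import Data.Fin using (Fin; toℕ)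
open import Data.List using (List; map; allFin)
open import Data.Nat.ListAction using (sum)
open import Data.Product using (Σ; _×_; ∃; ∃-syntax)
open import Relation.Nullary using (does; ¬_)
open import Relation.Binary.PropositionalEquality using (_≡_)

record Graph (n : ℕ) : Set where
  field
    adj    : Fin n → Fin n → Bool
    sym    : ∀ i j → adj i j ≡ adj j i
    irrefl : ∀ i → adj i i ≡ false
open Graph public

VSet : ℕ → Set
VSet n = Fin n → Bool

card : ∀ {n} → VSet n → ℕ
card {n} S = sum (map (λ i → if S i then 1 else 0) (allFin n))

edgeCount : ∀ {n} → (Fin n → Fin n → Bool) → ℕ
edgeCount {n} F =
  sum (map (λ i → sum (map (λ j → if does (toℕ j <? toℕ i) ∧ F i j then 1 else 0)
                           (allFin n)))
           (allFin n))

∣E∣ : ∀ {n} → Graph n → ℕ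
∣E∣ G = edgeCount (adj G)

data Walk {n} (G : Graph n) (S : VSet n) : Fin n → Fin n → Set where
  here : ∀ {u} → S u ≡ true → Walk G S u u
  step : ∀ {u v w} → S u ≡ true → adj G u v ≡ true → Walk G S v w → Walk G S u w

ConnectedIn : ∀ {n} → Graph n → VSet n → Set
ConnectedIn G S = ∀ u v → S u ≡ true → S v ≡ true → Walk G S u v

-- G is k-connected: |V(G)| > k and G - X is connected whenever |X| < k.
-- κ(G) is the largest k such that G is k-connected.
KConnected : ∀ {n} → Graph n → ℕ → Set
KConnected {n} G k = k < n × (∀ (X : VSet n) → card X < k → ConnectedIn G (λ v → not (X v)))

record Subgraph {n} (G : Graph n) : Set where
  field
    vs     : VSet n
    es     : Fin n → Fin n → Bool
    es-sym : ∀ i j → es i j ≡ es j i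
    es-adj : ∀ i j → es i j ≡ true → adj G i j ≡ true
    es-vs  : ∀ i j → es i j ≡ true → vs i ≡ true
open Subgraph public

∣V∣ₛ : ∀ {n} {G : Graph n} → Subgraph G → ℕ
∣V∣ₛ H = card (vs H)

∣E∣ₛ : ∀ {n} {G : Graph n} → Subgraph G → ℕ
∣E∣ₛ H = edgeCount (es H)

HasKMinor : ∀ {n} → Graph n → ℕ → Set
HasKMinor {n} G t =
  Σ (Fin t → VSet n) λ B →
    (∀ i → ∃[ v ] B i v ≡ true) ×
    (∀ i j → ¬ i ≡ j → ∀ v → B i v ≡ true → B j v ≡ false) ×
    (∀ i → ConnectedIn G (B i)) ×
    (∀ i j → ¬ i ≡ j → ∃[ u ] ∃[ v ] (B i u ≡ true × B j v ≡ true × adj G u v ≡ true))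

-- Comparisons with e^a, exactly, in ℕ.
-- expSum a N = N! * Σ_{k=0}^{N} a^k / k!   (a natural number)
expSum : ℕ → ℕ → ℕ
expSum a zero    = 1
expSum a (suc N) = suc N * expSum a N + a ^ suc N

-- m ≤exp a  means  m ≤ e^a  (real e^a).  Indeed partial sums of the
-- exponential series increase to e^a, and e^a is never an integer for a ≥ 1
-- (while for a = 0 the N = 0 partial sum already equals e^0 = 1).
_≤exp_ : ℕ → ℕ → Set
m ≤exp a = ∃[ N ] (m * N ! ≤ expSum a N)

-- For t ≥ 1, q ≥ 1:  GeCtLog C t p q  means  p / q ≥ C · t · (log t)^{1/4}.
-- (p/q ≥ C t (log t)^{1/4}  ⇔  C⁴ t⁴ q⁴ · log t ≤ p⁴  ⇔  t^(C⁴t⁴q⁴) ≤ e^(p⁴).)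
GeCtLog : ℕ → ℕ → ℕ → ℕ → Set
GeCtLog C t p q = (t ^ (C ^ 4 * t ^ 4 * q ^ 4)) ≤exp (p ^ 4)

-- For t ≥ 1:  GeHalfSqrtLog r t  means  r ≥ √(log t) / 2
-- (⇔ log t ≤ 4 r² ⇔ t ≤ e^(4r²)).
GeHalfSqrtLog : ℕ → ℕ → Set
GeHalfSqrtLog r t = t ≤exp (4 * r * r)

{-# OPTIONS --safe #-}
-- Let m ≈ (log t)^{1/4}. Split the t branch sets into m groups of about t/m and assign a dense subgraph to every pair of
-- groups; it only has to make the ≈ 2t/m branch sets of its pair adjacent, and the pieces are joined through G.
--
-- Each dense subgraph contains a highly connected subgraph V (Mader). Such a graph has, by contractions, a minor D on
-- ≈ C t m vertices in which any two vertices have many common neighbours. Any O(t m) prescribed vertices can be rooted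
-- in D: they start twice as many disjoint paths to distinct branch sets of D, and if these are chosen shortest, all other
-- branch sets are untouched. A separator in the graph obtained by contracting the untouched branch sets spoils at most two
-- of the paths per vertex, so Menger's theorem there links the prescribed vertices to intact branch sets.
--
-- Inside D, greedily chosen sets of O(m²) vertices miss only a fraction 2^(-Ω(m²)) of the vertices, so O(m²) further
-- vertices suffice to touch 2^(Ω(m⁴)) ≥ t earlier sets; all sets are then made connected through common neighbours.
--
-- To join the pieces, make every V complete and connect terminals in the resulting supergraph of G by routes that meet
-- each V in at most two vertices; the clique edges are finally replaced by the connected sets found inside V, with those
-- two vertices among the prescribed ones.

module Submission where

open import Defs renaming (sym to adj-sym)
open import Data.Bool using (Bool; true; false; not; _∧_; if_then_else_) renaming (_≟_ to _≟ᵇ_)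
open import Data.Empty using (⊥; ⊥-elim)
open import Data.Fin using (Fin; zero; suc; toℕ; fromℕ<; inject≤; splitAt; _↑ˡ_; _↑ʳ_; combine; remQuot)
open import Data.Fin.Properties using (_≟_; any?; all?; splitAt-↑ˡ; splitAt-↑ʳ; splitAt⁻¹-↑ˡ; splitAt⁻¹-↑ʳ; remQuot-combine; combine-remQuot; inject≤-injective) renaming (suc-injective to Fin-suc-injective)
open import Data.Fin.Subset.Properties using (anySubset?)
open import Data.List using ([]; _∷_; map; allFin) renaming (tabulate to tabulateᴸ)
open import Data.List.Properties using (map-tabulate)
open import Data.Nat using (ℕ; zero; suc; _+_; _*_; _^_; _!; _/_; _%_; _≤_; _<_; z≤n; s≤s; s≤s⁻¹; _≤?_; _<?_; NonZero; >-nonZero)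
open import Data.Nat.DivMod using (m≡m%n+[m/n]*n; m%n<n)
open import Data.Nat.ListAction using (sum)
open import Data.Nat.Properties hiding (_≟_; suc-injective)
open import Data.Nat.Tactic.RingSolver using (solve)
open import Data.Product using (Σ; ∃; _×_; _,_; proj₁; proj₂)
open import Data.Sum using (_⊎_; inj₁; inj₂; [_,_]′)
open import Data.Vec using (lookup; tabulate)
open import Data.Vec.Properties using (lookup∘tabulate)
open import Function using (_∘_; id)
open import Relation.Binary.PropositionalEquality using (_≡_; _≢_; refl; sym; trans; cong; cong₂; subst; subst₂)
open import Relation.Nullary using (¬_; Dec; yes; no; does; contradiction)
open import Relation.Nullary.Decidable using (_×-dec_; _⊎-dec_; ¬?; map′; dec-true; dec-false; decidable-stable)

-- Density `d` yields a complete minor of order about `d / √(log d)`. With `d = C t m` and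
-- `m⁴ ≈ log t` one piece therefore handles only about `t / m` branch sets, so all pairs of `m`
-- groups call for `m²` pieces, and `m² ≈ √(log t)` is what `r` provides.
--
-- Within a piece two demands share `O(t m)` vertices. The sets to be made adjacent number
-- `2 g ≈ 2 t / m` and have `O(m²)` vertices each. The routes enter as prescribed vertices: a branch
-- set has to reach `2 m` pieces, hence consists of `2 m` tracks, and about `t` branch sets with two
-- vertices per track and piece again leave `O(t m)`. An unthinned route could exhaust a piece,
-- which is why the pieces are made complete first.
--
-- A route may cross a piece that does not serve its group. Each piece therefore roots every branch
-- set that passes through it, but makes adjacent only those of its own pair of groups.
--
-- Real logarithms never occur: `log t` enters only through `2^(m⁴) ≤ t ≤ 2^(272 m⁴)`.

private variable
  n k m J : ℕ

-- Linear arithmetic by certificate: add up the hypotheses to l ≤ r and leave an identity to the ring solver.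
linear : ∀ {l r x y} (slack : ℕ) → l ≤ r → x + r + slack ≡ y + l → x ≤ y
linear {l} {r} {x} {y} s l≤r eq = +-cancelʳ-≤ r x y (begin
  x + r      ≤⟨ m≤m+n (x + r) s ⟩
  x + r + s  ≡⟨ eq ⟩
  y + l      ≤⟨ +-monoʳ-≤ y l≤r ⟩
  y + r      ∎)
  where open ≤-Reasoning

infixl 6 _⊕_
_⊕_ : ∀ {a b c d} → a ≤ b → c ≤ d → a + c ≤ b + d
_⊕_ = +-mono-≤

infixr 7 _⊗_
_⊗_ : ∀ c {a b} → a ≤ b → c * a ≤ c * b
c ⊗ h = *-monoʳ-≤ c h

-- Finite sums

opaque
  ∑ : (Fin n → ℕ) → ℕ
  ∑ {zero}  f = 0
  ∑ {suc n} f = f zero + ∑ (f ∘ suc)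

  ∑-mono : {f g : Fin n → ℕ} → (∀ i → f i ≤ g i) → ∑ f ≤ ∑ g
  ∑-mono {zero}  h = z≤n
  ∑-mono {suc n} h = +-mono-≤ (h zero) (∑-mono (h ∘ suc))

  ∑-cong : {f g : Fin n → ℕ} → (∀ i → f i ≡ g i) → ∑ f ≡ ∑ g
  ∑-cong {zero}  h = refl
  ∑-cong {suc n} h = cong₂ _+_ (h zero) (∑-cong (h ∘ suc))

  ∑-+ : (f g : Fin n → ℕ) → ∑ (λ i → f i + g i) ≡ ∑ f + ∑ g
  ∑-+ {zero}  f g = refl
  ∑-+ {suc n} f g rewrite ∑-+ (f ∘ suc) (g ∘ suc) = lemma (f zero) (g zero) (∑ (f ∘ suc)) (∑ (g ∘ suc))
    where
    lemma : ∀ a b c d → a + b + (c + d) ≡ a + c + (b + d)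
    lemma a b c d = solve (a ∷ b ∷ c ∷ d ∷ [])

  ∑-const : ∀ c → ∑ {n} (λ _ → c) ≡ n * c
  ∑-const {zero}  c = refl
  ∑-const {suc n} c = cong (c +_) (∑-const {n} c)

  ∑-* : ∀ c (f : Fin n → ℕ) → ∑ (λ i → c * f i) ≡ c * ∑ f
  ∑-* {zero}  c f = sym (*-zeroʳ c)
  ∑-* {suc n} c f = trans (cong (c * f zero +_) (∑-* c (f ∘ suc))) (sym (*-distribˡ-+ c (f zero) _))

  ∑-swap : ∀ {m} (f : Fin n → Fin m → ℕ) → ∑ (λ i → ∑ (f i)) ≡ ∑ (λ j → ∑ (λ i → f i j))
  ∑-swap {zero}  {m} f = sym (trans (∑-const {m} 0) (*-zeroʳ m))
  ∑-swap {suc n} {m} f = trans (cong (∑ (f zero) +_) (∑-swap (f ∘ suc))) (sym (∑-+ (f zero) (λ j → ∑ (λ i → f (suc i) j))))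

  f≤∑ : (f : Fin n → ℕ) → ∀ i → f i ≤ ∑ f
  f≤∑ f zero    = m≤m+n _ _
  f≤∑ f (suc i) = ≤-trans (f≤∑ (f ∘ suc) i) (m≤n+m _ (f zero))

  ∑-positive : (f : Fin n → ℕ) → 0 < ∑ f → ∃ λ i → 0 < f i
  ∑-positive {suc n} f p with f zero in eq
  ... | suc m = zero , subst (0 <_) (sym eq) (s≤s z≤n)
  ... | zero with ∑-positive (f ∘ suc) p
  ...   | i , q = suc i , q

  ∑-mono-< : {f g : Fin n → ℕ} → (∀ i → f i ≤ g i) → (i : Fin n) → f i < g i → ∑ f < ∑ g
  ∑-mono-< h zero    lt = +-mono-≤ lt (∑-mono (h ∘ suc))
  ∑-mono-< h (suc i) lt = ≤-trans (≤-reflexive (sym (+-suc _ _))) (+-mono-≤ (h zero) (∑-mono-< (h ∘ suc) i lt))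

  sum-map-allFin : (f : Fin n → ℕ) → sum (map f (allFin n)) ≡ ∑ f
  sum-map-allFin {n} f = trans (cong sum (map-tabulate id f)) (go f)
    where
    go : ∀ {n} (f : Fin n → ℕ) → sum (tabulateᴸ f) ≡ ∑ f
    go {zero}  f = refl
    go {suc n} f = cong (f zero +_) (go (f ∘ suc))

-- Vertex sets

infix 4 _∈_ _∉_ _⊆_ _∈?_

-- A record, not the bare equation `S v ≡ true`, so that unification can read off `v` and `S` from a
-- membership.
record _∈_ {n} (v : Fin n) (S : VSet n) : Set where
  constructor mem
  field mem⁻ : S v ≡ true
open _∈_ public

_∉_ : Fin n → VSet n → Set
v ∉ S = ¬ v ∈ S

_∈?_ : (v : Fin n) (S : VSet n) → Dec (v ∈ S)
v ∈? S = map′ mem mem⁻ (S v ≟ᵇ true)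

∈-stable : {v : Fin n} {S : VSet n} → ¬ v ∉ S → v ∈ S
∈-stable {v = v} {S} = decidable-stable (v ∈? S)

_⊆_ : VSet n → VSet n → Set
A ⊆ B = ∀ {v} → v ∈ A → v ∈ B

opaque
  ⟦_⟧ : {P : Fin n → Set} → (∀ v → Dec (P v)) → VSet n
  ⟦ P? ⟧ v = does (P? v)

  ∈⁺ : {P : Fin n → Set} {P? : ∀ v → Dec (P v)} {v : Fin n} → P v → v ∈ ⟦ P? ⟧
  ∈⁺ {P? = P?} {v} p = mem (dec-true (P? v) p)

  ∈⁻ : {P : Fin n → Set} {P? : ∀ v → Dec (P v)} {v : Fin n} → v ∈ ⟦ P? ⟧ → P v
  ∈⁻ {P? = P?} {v} (mem e) with P? v
  ... | yes p = p
  ... | no _ with () ← e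

infixr 7 _∩_
infixr 6 _∪_ _∖_

_∩_ _∪_ _∖_ : VSet n → VSet n → VSet n
A ∩ B = ⟦ (λ v → (v ∈? A) ×-dec (v ∈? B)) ⟧
A ∪ B = ⟦ (λ v → (v ∈? A) ⊎-dec (v ∈? B)) ⟧
A ∖ B = ⟦ (λ v → (v ∈? A) ×-dec ¬? (v ∈? B)) ⟧

⁅_⁆ : Fin n → VSet n
⁅ u ⁆ = ⟦ (λ v → v ≟ u) ⟧

∅ full : VSet n
∅ _ = false
full _ = true

⋃ : (Fin k → VSet n) → VSet n
⋃ F = ⟦ (λ v → any? (λ i → v ∈? F i)) ⟧

-- Cardinalities

[_] : Bool → ℕ
[ b ] = if b then 1 else 0

opaque
  ⟪_⟫ : VSet n → ℕ
  ⟪ S ⟫ = ∑ (λ v → [ S v ])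

  ∣∣≡card : (S : VSet n) → ⟪ S ⟫ ≡ card S
  ∣∣≡card S = sym (sum-map-allFin (λ v → [ S v ]))

  ∣∣-∑ : (S : VSet n) → ⟪ S ⟫ ≡ ∑ (λ v → [ S v ])
  ∣∣-∑ S = refl

∈-[] : {S : VSet n} {v : Fin n} → v ∈ S → [ S v ] ≡ 1
∈-[] (mem e) = cong [_] e

∉-[] : {S : VSet n} {v : Fin n} → v ∉ S → [ S v ] ≡ 0
∉-[] {S = S} {v} h with S v in eq
... | true  = ⊥-elim (h (mem eq))
... | false = refl

[]-mono : ∀ {m} {S : VSet n} {T : VSet m} {v : Fin n} {w : Fin m} → (v ∈ S → w ∈ T) → [ S v ] ≤ [ T w ]
[]-mono {S = S} {T} {v} {w} h with v ∈? S
... | yes p = ≤-reflexive (trans (∈-[] p) (sym (∈-[] (h p))))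
... | no ¬p rewrite ∉-[] ¬p = z≤n

[]-∪ : ∀ {S A B : VSet n} {v : Fin n} → (v ∈ S → v ∈ A ⊎ v ∈ B) → [ S v ] ≤ [ A v ] + [ B v ]
[]-∪ {S = S} {A} {B} {v} h with v ∈? S
... | no ¬p rewrite ∉-[] ¬p = z≤n
... | yes p with h p
...   | inj₁ a rewrite ∈-[] p | ∈-[] a = s≤s z≤n
...   | inj₂ b rewrite ∈-[] p | ∈-[] b = m≤n+m 1 _

[]-disj : ∀ {S A B : VSet n} {v : Fin n} → (v ∈ A → v ∈ S) → (v ∈ B → v ∈ S) → (v ∈ A → v ∈ B → ⊥) → [ A v ] + [ B v ] ≤ [ S v ]
[]-disj {S = S} {A} {B} {v} hA hB d with v ∈? A | v ∈? B
... | yes a | yes b = ⊥-elim (d a b)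
... | yes a | no ¬b rewrite ∈-[] a | ∉-[] ¬b | ∈-[] (hA a) = ≤-refl
... | no ¬a | yes b rewrite ∉-[] ¬a | ∈-[] b | ∈-[] (hB b) = ≤-refl
... | no ¬a | no ¬b rewrite ∉-[] ¬a | ∉-[] ¬b = z≤n

opaque
  unfolding ∑

  ∑[]≤1 : (S : VSet n) → (∀ {u v} → u ∈ S → v ∈ S → u ≡ v) → ∑ (λ v → [ S v ]) ≤ 1
  ∑[]≤1 {zero}  S h = z≤n
  ∑[]≤1 {suc n} S h with zero ∈? S
  ... | no ¬p rewrite ∉-[] ¬p = ∑[]≤1 (S ∘ suc) λ { (mem p) (mem q) → Fin-suc-injective (h (mem p) (mem q)) }
  ... | yes p = subst (λ x → x + ∑ {n} (λ v → [ S (suc v) ]) ≤ 1) (sym (∈-[] p))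
        (s≤s (≤-reflexive (trans (∑-cong (λ v → ∉-[] {S = S} {v = suc v} (λ q → contradiction (h p q) λ ()))) (trans (∑-const {n} 0) (*-zeroʳ n)))))

opaque
  unfolding ⟪_⟫

  -- Count the related pairs both ways.
  ∣∣-injective : (I : VSet k) (S : VSet n) (R : Fin k → VSet n) →
    (∀ {i} → i ∈ I → ∃ λ s → s ∈ S × s ∈ R i) →
    (∀ {i j s} → i ∈ I → j ∈ I → s ∈ R i → s ∈ R j → i ≡ j) → ⟪ I ⟫ ≤ ⟪ S ⟫
  ∣∣-injective {k} {n} I S R total inj = begin
    ∑ (λ i → [ I i ])                  ≤⟨ ∑-mono row ⟩
    ∑ (λ i → ∑ (λ s → [ Q s i ]))      ≡⟨ ∑-swap (λ i s → [ Q s i ]) ⟩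
    ∑ (λ s → ∑ (λ i → [ Q s i ]))      ≤⟨ ∑-mono col ⟩
    ∑ (λ s → [ S s ])                  ∎
    where
    open ≤-Reasoning
    Q : Fin n → VSet k
    Q s = ⟦ (λ i → (i ∈? I) ×-dec (s ∈? S) ×-dec (s ∈? R i)) ⟧
    row : ∀ i → [ I i ] ≤ ∑ (λ s → [ Q s i ])
    row i with i ∈? I
    ... | no ¬p rewrite ∉-[] ¬p = z≤n
    ... | yes p with total p
    ...   | s , s∈S , s∈R = ≤-trans ([]-mono {S = I} {T = Q s} (λ _ → ∈⁺ (p , s∈S , s∈R))) (f≤∑ (λ s → [ Q s i ]) s)
    col : ∀ s → ∑ (λ i → [ Q s i ]) ≤ [ S s ]
    col s = case (s ∈? S)
      where
      case : Dec (s ∈ S) → ∑ (λ i → [ Q s i ]) ≤ [ S s ]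
      case (yes p) = subst (∑ (λ i → [ Q s i ]) ≤_) (sym (∈-[] p)) (∑[]≤1 (Q s) λ u v → inj (proj₁ (∈⁻ u)) (proj₁ (∈⁻ v)) (proj₂ (proj₂ (∈⁻ u))) (proj₂ (proj₂ (∈⁻ v))))
      case (no ¬p) = ≤-trans (≤-reflexive (trans (∑-cong {g = λ _ → 0} (λ i → ∉-[] {S = Q s} λ q → ¬p (proj₁ (proj₂ (∈⁻ q))))) (trans (∑-const 0) (*-zeroʳ k)))) z≤n

  ∣∣-mono : {A B : VSet n} → A ⊆ B → ⟪ A ⟫ ≤ ⟪ B ⟫
  ∣∣-mono h = ∑-mono λ v → []-mono h

  ∣∣-∪ : (S A B : VSet n) → (∀ {v} → v ∈ S → v ∈ A ⊎ v ∈ B) → ⟪ S ⟫ ≤ ⟪ A ⟫ + ⟪ B ⟫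
  ∣∣-∪ S A B h = ≤-trans (∑-mono λ v → []-∪ {S = S} {A} {B} h) (≤-reflexive (∑-+ _ _))

  ∣∣-disj : (S A B : VSet n) → A ⊆ S → B ⊆ S → (∀ {v} → v ∈ A → v ∈ B → ⊥) → ⟪ A ⟫ + ⟪ B ⟫ ≤ ⟪ S ⟫
  ∣∣-disj S A B hA hB d = ≤-trans (≤-reflexive (sym (∑-+ _ _))) (∑-mono λ v → []-disj {S = S} {A} {B} hA hB d)

  ∣⁅⁆∣ : (u : Fin n) → ⟪ ⁅ u ⁆ ⟫ ≤ 1
  ∣⁅⁆∣ u = ∑[]≤1 ⁅ u ⁆ λ p q → trans (∈⁻ p) (sym (∈⁻ q))

  ∣∣>0⇒∃ : (S : VSet n) → 0 < ⟪ S ⟫ → ∃ λ v → v ∈ S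
  ∣∣>0⇒∃ S p with ∑-positive _ p
  ... | v , q with v ∈? S
  ...   | yes r = v , r
  ...   | no ¬r = ⊥-elim (<⇒≱ q (≤-reflexive (∉-[] ¬r)))

  ∃⇒∣∣>0 : {S : VSet n} {v : Fin n} → v ∈ S → 0 < ⟪ S ⟫
  ∃⇒∣∣>0 {S = S} {v} p = ≤-trans (≤-reflexive (sym (∈-[] p))) (f≤∑ (λ v → [ S v ]) v)

  ∣full∣ : ⟪ full {n} ⟫ ≡ n
  ∣full∣ {n} = trans (∑-const {n} 1) (trans (*-comm n 1) (+-identityʳ n))

  ∣⋃∣ : (S : VSet n) (F : Fin k → VSet n) → (∀ {v} → v ∈ S → ∃ λ i → v ∈ F i) → ⟪ S ⟫ ≤ ∑ (λ i → ⟪ F i ⟫)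
  ∣⋃∣ S F h = ≤-trans (∑-mono row) (≤-reflexive (∑-swap (λ v i → [ F i v ])))
    where
    row : ∀ v → [ S v ] ≤ ∑ (λ i → [ F i v ])
    row v with v ∈? S
    ... | no ¬p rewrite ∉-[] ¬p = z≤n
    ... | yes p with h p
    ...   | i , q = ≤-trans ([]-mono {S = S} {T = F i} (λ _ → q)) (f≤∑ (λ i → [ F i v ]) i)

∣∣-mono-< : ∀ {q} {A B : VSet n} → A ⊆ B → ⟪ B ⟫ < q → ⟪ A ⟫ < q
∣∣-mono-< h lt = ≤-trans (s≤s (∣∣-mono h)) lt

∣∣≡0⇒∉ : {S : VSet n} {v : Fin n} → ⟪ S ⟫ ≤ 0 → v ∉ S
∣∣≡0⇒∉ h p = <⇒≱ (∃⇒∣∣>0 p) h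

∣∣-image : (S : VSet n) (f : Fin k → Fin n) → (∀ {v} → v ∈ S → ∃ λ i → v ≡ f i) → ⟪ S ⟫ ≤ k
∣∣-image {k = k} S f h = ≤-trans (∣∣-injective S full (λ v → ⟦ (λ i → v ≟ f i) ⟧)
  (λ p → let (i , e) = h p in i , mem refl , ∈⁺ e) (λ _ _ p q → trans (∈⁻ p) (sym (∈⁻ q)))) (≤-reflexive ∣full∣)

∣∣-injection : (S : VSet n) (f : Fin k → Fin n) → (∀ i → f i ∈ S) → (∀ {i j} → f i ≡ f j → i ≡ j) → k ≤ ⟪ S ⟫
∣∣-injection S f h inj = ≤-trans (≤-reflexive (sym ∣full∣)) (∣∣-injective full S (λ i → ⁅ f i ⁆)
  (λ {i} _ → f i , h i , ∈⁺ refl) (λ _ _ p q → inj (trans (sym (∈⁻ p)) (∈⁻ q))))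

∣∖∣ : (A B : VSet n) → ⟪ A ⟫ ≤ ⟪ A ∖ B ⟫ + ⟪ B ⟫
∣∖∣ A B = ∣∣-∪ A (A ∖ B) B λ {v} p → case v p (v ∈? B)
  where
  case : ∀ v → v ∈ A → Dec (v ∈ B) → v ∈ A ∖ B ⊎ v ∈ B
  case v p (yes q) = inj₂ q
  case v p (no q)  = inj₁ (∈⁺ (p , q))

∣∣-remove : (S : VSet n) (v : Fin n) → v ∈ S → suc ⟪ S ∖ ⁅ v ⁆ ⟫ ≤ ⟪ S ⟫
∣∣-remove S v p = ≤-trans (+-monoˡ-≤ ⟪ S ∖ ⁅ v ⁆ ⟫ (∃⇒∣∣>0 {S = ⁅ v ⁆} (∈⁺ refl)))
  (∣∣-disj S ⁅ v ⁆ (S ∖ ⁅ v ⁆) (λ q → subst (_∈ S) (sym (∈⁻ q)) p) (λ q → proj₁ (∈⁻ q)) (λ a b → proj₂ (∈⁻ b) a))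

∣∖⁅⁆∣ : (S : VSet n) (v : Fin n) → ⟪ S ⟫ ≤ suc ⟪ S ∖ ⁅ v ⁆ ⟫
∣∖⁅⁆∣ S v = ≤-trans (∣∖∣ S ⁅ v ⁆) (≤-trans (+-monoʳ-≤ _ (∣⁅⁆∣ v)) (≤-reflexive (+-comm _ 1)))

∣∣-∪-∩ : (S A B : VSet n) → A ⊆ S → B ⊆ S → ⟪ A ⟫ + ⟪ B ⟫ ≤ ⟪ S ⟫ + ⟪ A ∩ B ⟫
∣∣-∪-∩ S A B hA hB = ≤-trans (+-monoʳ-≤ _ (∣∣-∪ B (B ∖ A) (A ∩ B) λ {v} p → case v p (v ∈? A)))
  (≤-trans (≤-reflexive (sym (+-assoc ⟪ A ⟫ _ _))) (+-monoˡ-≤ _ (∣∣-disj S A (B ∖ A) hA (λ p → hB (proj₁ (∈⁻ p))) (λ a b → proj₂ (∈⁻ b) a))))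
  where
  case : ∀ v → v ∈ B → Dec (v ∈ A) → v ∈ B ∖ A ⊎ v ∈ A ∩ B
  case v p (yes q) = inj₂ (∈⁺ (q , p))
  case v p (no q)  = inj₁ (∈⁺ (p , q))

injection-onto : (S : VSet n) (f : Fin k → Fin n) → (∀ i → f i ∈ S) → (∀ {i j} → f i ≡ f j → i ≡ j) →
  ⟪ S ⟫ ≤ k → ∀ {v} → v ∈ S → ∃ λ i → f i ≡ v
injection-onto S f h inj le {v} p with any? (λ i → f i ≟ v)
... | yes q = q
... | no ¬q = ⊥-elim (<⇒≱ (∣∣-remove S v p) (≤-trans le (∣∣-injection (S ∖ ⁅ v ⁆) f (λ i → ∈⁺ (h i , λ e → ¬q (i , ∈⁻ e))) inj)))

-- Distinct representatives

record Choice {n k} (N : Fin k → VSet n) (F : VSet n) : Set where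
  field
    pick   : Fin k → Fin n
    pick∈  : ∀ i → pick i ∈ N i
    pick∉  : ∀ i → pick i ∉ F
    pick-injective : ∀ {i j} → pick i ≡ pick j → i ≡ j
open Choice public

-- Greedy: each choice forbids one more vertex and leaves one request fewer, so `k + ⟪ F ⟫` stays
-- the same.
choose : (N : Fin k → VSet n) (F : VSet n) → (∀ i → k + ⟪ F ⟫ ≤ ⟪ N i ⟫) → Choice N F
choose {zero}  N F h = record { pick = λ () ; pick∈ = λ () ; pick∉ = λ () ; pick-injective = λ { {()} } }
choose {suc k} N F h = record { pick = p ; pick∈ = p∈ ; pick∉ = p∉ ; pick-injective = λ {i} {j} → inj i j }
  where
  first : ∃ λ v → v ∈ N zero ∖ F
  first = ∣∣>0⇒∃ _ (+-cancelʳ-≤ ⟪ F ⟫ _ _ (≤-trans (+-monoˡ-≤ ⟪ F ⟫ (s≤s z≤n)) (≤-trans (h zero) (∣∖∣ (N zero) F))))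
  v₀ = proj₁ first
  F′ = F ∪ ⁅ v₀ ⁆
  rest : Choice (N ∘ suc) F′
  rest = choose (N ∘ suc) F′ λ i → ≤-trans (+-monoʳ-≤ k (≤-trans (∣∣-∪ F′ F ⁅ v₀ ⁆ ∈⁻) (+-monoʳ-≤ _ (∣⁅⁆∣ v₀))))
    (≤-trans (≤-reflexive (trans (cong (k +_) (+-comm _ 1)) (trans (sym (+-assoc k 1 _)) (cong (_+ ⟪ F ⟫) (+-comm k 1))))) (h (suc i)))
  p : Fin (suc k) → Fin _
  p zero    = v₀
  p (suc i) = pick rest i
  p∈ : ∀ i → p i ∈ N i
  p∈ zero    = proj₁ (∈⁻ (proj₂ first))
  p∈ (suc i) = pick∈ rest i
  p∉ : ∀ i → p i ∉ F
  p∉ zero    = proj₂ (∈⁻ (proj₂ first))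
  p∉ (suc i) q = pick∉ rest i (∈⁺ (inj₁ q))
  inj : ∀ i j → p i ≡ p j → i ≡ j
  inj zero    zero    _ = refl
  inj zero    (suc j) e = ⊥-elim (pick∉ rest j (∈⁺ (inj₂ (∈⁺ (sym e)))))
  inj (suc i) zero    e = ⊥-elim (pick∉ rest i (∈⁺ (inj₂ (∈⁺ e))))
  inj (suc i) (suc j) e = cong suc (pick-injective rest e)

opaque
  unfolding ⟪_⟫

  ∣∅∣ : ⟪ ∅ {n} ⟫ ≡ 0
  ∣∅∣ {n} = trans (∑-const {n} 0) (*-zeroʳ n)

choose-distinct : (N : Fin k → VSet n) → (∀ i → k ≤ ⟪ N i ⟫) → Choice N ∅
choose-distinct {k = k} N h = choose N ∅ λ i → ≤-trans (≤-reflexive (trans (cong (k +_) ∣∅∣) (+-identityʳ k))) (h i)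

enumerate : (S : VSet n) → k ≤ ⟪ S ⟫ → Choice {k = k} (λ _ → S) ∅
enumerate S h = choose-distinct (λ _ → S) (λ _ → h)

-- Edges, graphs from decidable relations, neighbourhoods

record Edge (Γ : Graph n) (u v : Fin n) : Set where
  constructor edge
  field edge⁻ : adj Γ u v ≡ true
open Edge public

edge? : (Γ : Graph n) (u v : Fin n) → Dec (Edge Γ u v)
edge? Γ u v = map′ edge edge⁻ (adj Γ u v ≟ᵇ true)

edge-sym : {Γ : Graph n} {u v : Fin n} → Edge Γ u v → Edge Γ v u
edge-sym {Γ = Γ} {u} {v} (edge e) = edge (trans (adj-sym Γ v u) e)

edge-≢ : {Γ : Graph n} {u v : Fin n} → Edge Γ u v → u ≢ v
edge-≢ {Γ = Γ} {u} (edge e) refl with () ← trans (sym e) (irrefl Γ u)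

opaque
  graph : {R : Fin n → Fin n → Set} → (∀ u v → Dec (R u v)) → (∀ {u v} → R u v → R v u) → (∀ {u} → ¬ R u u) → Graph n
  graph R? s ir = record
    { adj = λ u v → does (R? u v)
    ; sym = λ u v → bool (R? u v) (R? v u) s s
    ; irrefl = λ u → dec-false (R? u u) ir }
    where
    bool : ∀ {P Q : Set} (p : Dec P) (q : Dec Q) → (P → Q) → (Q → P) → does p ≡ does q
    bool (yes p) q f g = sym (dec-true q (f p))
    bool (no ¬p) q f g = sym (dec-false q (¬p ∘ g))

  graph⁺ : {R : Fin n → Fin n → Set} {R? : ∀ u v → Dec (R u v)} {s : ∀ {u v} → R u v → R v u} {ir : ∀ {u} → ¬ R u u} {u v : Fin n} → R u v → Edge (graph R? s ir) u v
  graph⁺ {R? = R?} {u = u} {v} r = edge (dec-true (R? u v) r)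

  graph⁻ : {R : Fin n → Fin n → Set} {R? : ∀ u v → Dec (R u v)} {s : ∀ {u v} → R u v → R v u} {ir : ∀ {u} → ¬ R u u} {u v : Fin n} → Edge (graph R? s ir) u v → R u v
  graph⁻ {R? = R?} {u = u} {v} (edge e) with R? u v
  ... | yes r = r
  ... | no _ with () ← e

N : Graph n → Fin n → VSet n
N Γ v = ⟦ edge? Γ v ⟧

deg : Graph n → VSet n → Fin n → ℕ
deg Γ U v = ⟪ N Γ v ∩ U ⟫

-- Connected sets

data Path {n} (Γ : Graph n) (S : VSet n) : Fin n → Fin n → Set where
  [_]ₚ : ∀ {u} → u ∈ S → Path Γ S u u
  cons : ∀ {u v w} → u ∈ S → Edge Γ u v → Path Γ S v w → Path Γ S u w

Conn : Graph n → VSet n → Set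
Conn Γ S = ∀ {u v} → u ∈ S → v ∈ S → Path Γ S u v

_⊑_ : Graph n → Graph n → Set
Γ ⊑ Δ = ∀ {u v} → Edge Γ u v → Edge Δ u v

module _ where
  private variable
    Γ Δ : Graph n
    S T : VSet n
    u v w : Fin n

  path-start : Path Γ S u v → u ∈ S
  path-start [ p ]ₚ       = p
  path-start (cons p _ _) = p

  path-end : Path Γ S u v → v ∈ S
  path-end [ p ]ₚ       = p
  path-end (cons _ _ p) = path-end p

  path-mono : Γ ⊑ Δ → S ⊆ T → Path Γ S u v → Path Δ T u v
  path-mono f g [ p ]ₚ       = [ g p ]ₚ
  path-mono f g (cons p e q) = cons (g p) (f e) (path-mono f g q)

  path-++ : Path Γ S u v → Path Γ S v w → Path Γ S u w
  path-++ [ p ]ₚ       r = r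
  path-++ (cons p e q) r = cons p e (path-++ q r)

  path-sym : Path Γ S u v → Path Γ S v u
  path-sym [ p ]ₚ       = [ p ]ₚ
  path-sym (cons p e q) = path-++ (path-sym q) (cons (path-start q) (edge-sym e) [ p ]ₚ)

  path-invariant : (P : Fin n → Set) → (∀ {x y} → x ∈ S → y ∈ S → Edge Γ x y → P x → P y) → Path Γ S u v → P u → P v
  path-invariant P h [ p ]ₚ       a = a
  path-invariant P h (cons p e q) a = path-invariant P h q (h p (path-start q) e a)

  conn-hub : (∀ {v} → v ∈ S → Path Γ S v u) → Conn Γ S
  conn-hub h p q = path-++ (h p) (path-sym (h q))

  walk : Path Γ S u v → Walk Γ S u v
  walk [ mem p ]ₚ                = here p
  walk (cons (mem p) (edge e) q) = step p e (walk q)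

  conn-⁅⁆ : {u : Fin n} → Conn Γ ⁅ u ⁆
  conn-⁅⁆ {u = u} = conn-hub λ p → subst (λ x → Path _ ⁅ u ⁆ x u) (sym (∈⁻ p)) [ ∈⁺ refl ]ₚ

  conn-∪ : {A B : VSet n} {a b : Fin n} → Conn Γ A → Conn Γ B → a ∈ A → b ∈ B → a ≡ b ⊎ Edge Γ a b → Conn Γ (A ∪ B)
  conn-∪ {Γ = Γ} {A = A} {B} {a} {b} cA cB pa pb j = conn-hub λ p → [ fromA , fromB ]′ (∈⁻ p)
    where
    inA : A ⊆ (A ∪ B)
    inA x = ∈⁺ (inj₁ x)
    inB : B ⊆ (A ∪ B)
    inB x = ∈⁺ (inj₂ x)
    link : a ≡ b ⊎ Edge Γ a b → Path Γ (A ∪ B) a b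
    link (inj₁ refl) = [ inA pa ]ₚ
    link (inj₂ e)    = cons (inA pa) e [ inB pb ]ₚ
    fromA : ∀ {v} → v ∈ A → Path Γ (A ∪ B) v b
    fromA p = path-++ (path-mono (λ e → e) inA (cA p pa)) (link j)
    fromB : ∀ {v} → v ∈ B → Path Γ (A ∪ B) v b
    fromB p = path-mono (λ e → e) inB (cB p pb)

-- Counting ordered pairs

Rel : ℕ → Set
Rel n = Fin n → VSet n

‖_‖ : Rel n → ℕ
‖ R ‖ = ∑ (λ i → ⟪ R i ⟫)

‖‖-∪ : (R A B : Rel n) → (∀ {i j} → j ∈ R i → j ∈ A i ⊎ j ∈ B i) → ‖ R ‖ ≤ ‖ A ‖ + ‖ B ‖
‖‖-∪ R A B h = ≤-trans (∑-mono λ i → ∣∣-∪ (R i) (A i) (B i) h) (≤-reflexive (∑-+ _ _))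

‖‖-disj : (R A B : Rel n) → (∀ {i j} → j ∈ A i → j ∈ R i) → (∀ {i j} → j ∈ B i → j ∈ R i) → (∀ {i j} → j ∈ A i → j ∈ B i → ⊥) →
  ‖ A ‖ + ‖ B ‖ ≤ ‖ R ‖
‖‖-disj R A B hA hB d = ≤-trans (≤-reflexive (sym (∑-+ _ _))) (∑-mono λ i → ∣∣-disj (R i) (A i) (B i) hA hB d)

_⊎ᴿ_ : Rel n → Rel n → Rel n
(A ⊎ᴿ B) i = A i ∪ B i

-- The ordered pairs at one vertex form a row and a column; the effect of removing or merging a
-- vertex on `e₂` is measured by these.
row col : Fin n → VSet n → Rel n
row v B i = ⟦ (λ j → (i ≟ v) ×-dec (j ∈? B)) ⟧
col v B i = ⟦ (λ j → (j ≟ v) ×-dec (i ∈? B)) ⟧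

‖row‖≥ : (v : Fin n) (B : VSet n) → ⟪ B ⟫ ≤ ‖ row v B ‖
‖row‖≥ v B = ≤-trans (∣∣-mono (λ p → ∈⁺ (refl , p))) (f≤∑ (λ i → ⟪ row v B i ⟫) v)

∣col∣ : (v : Fin n) (B : VSet n) → ∀ i → ⟪ col v B i ⟫ ≡ [ B i ]
∣col∣ v B i with i ∈? B
... | yes p = trans (≤-antisym (≤-trans (∣∣-mono (λ q → ∈⁺ (proj₁ (∈⁻ q)))) (∣⁅⁆∣ v)) (∃⇒∣∣>0 {v = v} (∈⁺ (refl , p)))) (sym (∈-[] p))
... | no ¬p = trans (n≤0⇒n≡0 (≮⇒≥ λ h → let (j , q) = ∣∣>0⇒∃ _ h in ¬p (proj₂ (∈⁻ q)))) (sym (∉-[] ¬p))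

‖col‖ : (v : Fin n) (B : VSet n) → ‖ col v B ‖ ≡ ⟪ B ⟫
‖col‖ v B = trans (∑-cong (∣col∣ v B)) (sym (∣∣-∑ B))

‖row‖≤ : (v : Fin n) (B : VSet n) → ‖ row v B ‖ ≤ ⟪ B ⟫
‖row‖≤ {n} v B = begin
  ∑ (λ i → ⟪ row v B i ⟫)                ≡⟨ ∑-cong (λ i → ∣∣-∑ (row v B i)) ⟩
  ∑ (λ i → ∑ (λ j → [ row v B i j ]))    ≤⟨ ∑-mono (λ i → ∑-mono λ j → []-mono {S = row v B i} {T = col v B j} (λ p → ∈⁺ (∈⁻ p))) ⟩
  ∑ (λ i → ∑ (λ j → [ col v B j i ]))    ≡⟨ ∑-swap (λ i j → [ col v B j i ]) ⟩
  ∑ (λ j → ∑ (λ i → [ col v B j i ]))    ≡⟨ ∑-cong (λ j → sym (∣∣-∑ (col v B j))) ⟩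
  ‖ col v B ‖                            ≡⟨ ‖col‖ v B ⟩
  ⟪ B ⟫                                  ∎
  where open ≤-Reasoning

E : Graph n → VSet n → Rel n
E Γ U i = ⟦ (λ j → (i ∈? U) ×-dec (j ∈? U) ×-dec edge? Γ i j) ⟧

-- Twice the number of edges of Γ[U].
e₂ : Graph n → VSet n → ℕ
e₂ Γ U = ‖ E Γ U ‖

∣E∣≤ : (Γ : Graph n) (U : VSet n) (i : Fin n) → ⟪ E Γ U i ⟫ ≤ ⟪ U ⟫ * [ U i ]
∣E∣≤ Γ U i = case (i ∈? U)
  where
  case : Dec (i ∈ U) → ⟪ E Γ U i ⟫ ≤ ⟪ U ⟫ * [ U i ]
  case (yes p) = ≤-trans (∣∣-mono (λ q → proj₁ (proj₂ (∈⁻ q)))) (≤-reflexive (sym (trans (cong (⟪ U ⟫ *_) (∈-[] p)) (*-identityʳ _))))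
  case (no ¬p) = ≤-trans (≮⇒≥ {0} λ h → let (j , q) = ∣∣>0⇒∃ _ h in ¬p (proj₁ (∈⁻ q))) z≤n

e₂≤square : (Γ : Graph n) (U : VSet n) → e₂ Γ U ≤ ⟪ U ⟫ * ⟪ U ⟫
e₂≤square Γ U = ≤-trans (∑-mono (∣E∣≤ Γ U)) (≤-reflexive (trans (∑-* ⟪ U ⟫ _) (cong (⟪ U ⟫ *_) (sym (∣∣-∑ U)))))

e₂≥ : (Γ : Graph n) (U : VSet n) (d : ℕ) → (∀ {v} → v ∈ U → d ≤ deg Γ U v) → d * ⟪ U ⟫ ≤ e₂ Γ U
e₂≥ Γ U d h = ≤-trans (≤-reflexive (trans (cong (d *_) (∣∣-∑ U)) (sym (∑-* d _)))) (∑-mono λ i → case i (i ∈? U))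
  where
  case : ∀ i → Dec (i ∈ U) → d * [ U i ] ≤ ⟪ E Γ U i ⟫
  case i (yes p) = ≤-trans (≤-reflexive (trans (cong (d *_) (∈-[] p)) (*-identityʳ d)))
    (≤-trans (h p) (∣∣-mono λ q → ∈⁺ (p , proj₂ (∈⁻ q) , ∈⁻ (proj₁ (∈⁻ q)))))
  case i (no ¬p) = ≤-trans (≤-reflexive (trans (cong (d *_) (∉-[] ¬p)) (*-zeroʳ d))) z≤n

low-degree : (Γ : Graph n) (U : VSet n) (d : ℕ) → e₂ Γ U < d * ⟪ U ⟫ → ∃ λ v → v ∈ U × deg Γ U v < d
low-degree Γ U d h with any? (λ v → (v ∈? U) ×-dec (deg Γ U v <? d))
... | yes p = p
... | no ¬p = ⊥-elim (<⇒≱ h (e₂≥ Γ U d λ {v} q → ≮⇒≥ λ lt → ¬p (v , q , lt)))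

e₂-remove : (Γ : Graph n) (U : VSet n) (v : Fin n) → e₂ Γ U ≤ e₂ Γ (U ∖ ⁅ v ⁆) + 2 * deg Γ U v
e₂-remove Γ U v = begin
  e₂ Γ U                                           ≤⟨ ‖‖-∪ _ (E Γ (U ∖ ⁅ v ⁆)) (row v A ⊎ᴿ col v A) (λ {i} {j} p → case i j p (i ≟ v) (j ≟ v)) ⟩
  e₂ Γ (U ∖ ⁅ v ⁆) + ‖ row v A ⊎ᴿ col v A ‖        ≤⟨ +-monoʳ-≤ (e₂ Γ (U ∖ ⁅ v ⁆)) (‖‖-∪ _ (row v A) (col v A) ∈⁻) ⟩
  e₂ Γ (U ∖ ⁅ v ⁆) + (‖ row v A ‖ + ‖ col v A ‖)   ≤⟨ +-monoʳ-≤ (e₂ Γ (U ∖ ⁅ v ⁆)) (‖row‖≤ v A ⊕ ≤-reflexive (trans (‖col‖ v A) (sym (+-identityʳ _)))) ⟩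
  e₂ Γ (U ∖ ⁅ v ⁆) + 2 * ⟪ A ⟫                     ∎
  where
  open ≤-Reasoning
  A = N Γ v ∩ U
  case : ∀ i j → j ∈ E Γ U i → Dec (i ≡ v) → Dec (j ≡ v) → j ∈ E Γ (U ∖ ⁅ v ⁆) i ⊎ j ∈ (row v A ⊎ᴿ col v A) i
  case i j p (yes refl) _ = let (a , b , e) = ∈⁻ p in inj₂ (∈⁺ (inj₁ (∈⁺ (refl , ∈⁺ (∈⁺ e , b)))))
  case i j p (no _) (yes refl) = let (a , b , e) = ∈⁻ p in inj₂ (∈⁺ (inj₂ (∈⁺ (refl , ∈⁺ (∈⁺ (edge-sym e) , a)))))
  case i j p (no x) (no y) = let (a , b , e) = ∈⁻ p in inj₁ (∈⁺ (∈⁺ (a , λ q → x (∈⁻ q)) , ∈⁺ (b , λ q → y (∈⁻ q)) , e))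

-- Highly connected subgraphs

∂ : Graph n → VSet n → VSet n → VSet n
∂ Γ U A = ⟦ (λ u → (u ∈? U) ×-dec ¬? (u ∈? A) ×-dec any? (λ a → (a ∈? A) ×-dec edge? Γ a u)) ⟧

∂-mono : (Γ : Graph n) (U : VSet n) {A B : VSet n} → A ⊆ B → B ⊆ A → ∂ Γ U A ⊆ ∂ Γ U B
∂-mono Γ U f g p = let (u , ¬a , a , a∈ , e) = ∈⁻ p in ∈⁺ (u , (λ b → ¬a (g b)) , a , f a∈ , e)

-- Separators appear as boundaries: `∂ Γ U A` separates `A` from any `b` beyond it. This form needs
-- no paths, can be tested by a search over `A`, and passes to supergraphs.
record Connectivity (Γ : Graph n) (U : VSet n) (K : ℕ) : Set where
  field
    large    : K < ⟪ U ⟫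
    boundary : ∀ {A a b} → A ⊆ U → a ∈ A → b ∈ U → b ∉ A → b ∉ ∂ Γ U A → K ≤ ⟪ ∂ Γ U A ⟫
open Connectivity public

Cut : Graph n → VSet n → ℕ → VSet n → Set
Cut Γ U K A = (∀ v → ¬ (v ∈ A × v ∉ U)) × (∃ λ a → a ∈ A) × (∃ λ b → b ∈ U × b ∉ A × b ∉ ∂ Γ U A) × ⟪ ∂ Γ U A ⟫ < K

cut? : (Γ : Graph n) (U : VSet n) (K : ℕ) (A : VSet n) → Dec (Cut Γ U K A)
cut? Γ U K A = all? (λ v → ¬? ((v ∈? A) ×-dec ¬? (v ∈? U))) ×-dec any? (λ a → a ∈? A)
  ×-dec any? (λ b → (b ∈? U) ×-dec ¬? (b ∈? A) ×-dec ¬? (b ∈? ∂ Γ U A)) ×-dec (⟪ ∂ Γ U A ⟫ <? K)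

-- The search runs over Boolean vectors; a set and its tabulation agree only pointwise, so `∂-mono`
-- carries the boundary across.
cut-or-connected : (Γ : Graph n) (U : VSet n) (K : ℕ) → K < ⟪ U ⟫ → (∃ λ A → Cut Γ U K A) ⊎ Connectivity Γ U K
cut-or-connected Γ U K lg with anySubset? (λ s → cut? Γ U K (lookup s))
... | yes (s , c) = inj₁ (lookup s , c)
... | no ¬c = inj₂ record { large = lg ; boundary = λ {A} {a} {b} A⊆U a∈ b∈ b∉ b∉∂ → ≮⇒≥ λ lt → ¬c (tabulate A ,
        (λ v (p , q) → q (A⊆U (from A p))) , (a , to A a∈) ,
        (b , b∈ , (λ p → b∉ (from A p)) , λ p → b∉∂ (∂-mono Γ U (from A) (to A) p)) ,
        ≤-<-trans (∣∣-mono (∂-mono Γ U (from A) (to A))) lt) }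
  where
  to : ∀ A {v} → v ∈ A → v ∈ lookup (tabulate A)
  to A {v} (mem e) = mem (trans (lookup∘tabulate A v) e)
  from : ∀ A {v} → v ∈ lookup (tabulate A) → v ∈ A
  from A {v} (mem e) = mem (trans (sym (lookup∘tabulate A v)) e)

-- Mader: a vertex-minimal U among those with more than 2K(∣U∣ - K) edges and at least 2K vertices is K-connected,
-- since a small cut would split the edges between two smaller sets.
module _ (Γ : Graph n) (K : ℕ) where

  private
    Rich : VSet n → Set
    Rich U = 2 * K ≤ ⟪ U ⟫ × 4 * K * ⟪ U ⟫ < e₂ Γ U + 4 * K * K

    -- At `∣U∣ = 2K` the edge bound would ask for `e₂ > 4K²`, while `e₂ ≤ ∣U∣² = 4K²`.
    rich-large : ∀ U → Rich U → 2 * K < ⟪ U ⟫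
    rich-large U (lo , rich) = ≤∧≢⇒< lo λ eq → <⇒≱ rich (≤-trans (+-monoˡ-≤ (4 * K * K) (e₂≤square Γ U))
      (≤-reflexive (subst (λ x → x * x + 4 * K * K ≡ 4 * K * x) eq (solve (K ∷ [])))))

    -- Degree at most `2K` costs at most `4K` in `e₂`, exactly what one vertex less releases in
    -- `4K∣U∣`.
    rich-remove : ∀ U v → v ∈ U → Rich U → deg Γ U v ≤ 2 * K → Rich (U ∖ ⁅ v ⁆)
    rich-remove U v p r low = s≤s⁻¹ (≤-trans (rich-large U r) (∣∖⁅⁆∣ U v)) ,
      arith (4 * K * K) ⟪ U ⟫ ⟪ U ∖ ⁅ v ⁆ ⟫ (e₂ Γ U) (e₂ Γ (U ∖ ⁅ v ⁆)) (deg Γ U v) (∣∣-remove U v p) (proj₂ r) (e₂-remove Γ U v) low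
      where
      arith : ∀ kk u u′ e e′ d → suc u′ ≤ u → 4 * K * u < e + kk → e ≤ e′ + 2 * d → d ≤ 2 * K → 4 * K * u′ < e′ + kk
      arith kk u u′ e e′ d a b c f = linear 0 ((4 * K) ⊗ a ⊕ b ⊕ c ⊕ 2 ⊗ f)
        (solve (K ∷ kk ∷ u ∷ u′ ∷ e ∷ e′ ∷ d ∷ []))

    module _ (U A : VSet n) (cut : Cut Γ U K A) (rich : Rich U) (δ : ∀ {v} → v ∈ U → 2 * K < deg Γ U v) where
      private
        S = ∂ Γ U A
        a = proj₁ (proj₁ (proj₂ cut))
        b = proj₁ (proj₁ (proj₂ (proj₂ cut)))
        a∈A = proj₂ (proj₁ (proj₂ cut))
        b∈U = proj₁ (proj₂ (proj₁ (proj₂ (proj₂ cut))))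
        b∉A = proj₁ (proj₂ (proj₂ (proj₁ (proj₂ (proj₂ cut)))))
        b∉S = proj₂ (proj₂ (proj₂ (proj₁ (proj₂ (proj₂ cut)))))
        ∣S∣<K = proj₂ (proj₂ (proj₂ cut))

        A⊆U : A ⊆ U
        A⊆U {v} p with v ∈? U
        ... | yes q = q
        ... | no ¬q = ⊥-elim (proj₁ cut v (p , ¬q))

      U₁ U₂ : VSet n
      U₁ = A ∪ S
      U₂ = U ∖ A

      U₁⊆U : U₁ ⊆ U
      U₁⊆U p = [ A⊆U , (λ q → proj₁ (∈⁻ q)) ]′ (∈⁻ p)

      U₂⊆U : U₂ ⊆ U
      U₂⊆U p = proj₁ (∈⁻ p)

      private
        into₁ : ∀ {i j} → i ∈ A → j ∈ U → Edge Γ i j → j ∈ U₁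
        into₁ {i} {j} p q e with j ∈? A
        ... | yes r = ∈⁺ (inj₁ r)
        ... | no ¬r = ∈⁺ (inj₂ (∈⁺ (q , ¬r , i , p , e)))

        split : e₂ Γ U ≤ e₂ Γ U₁ + e₂ Γ U₂
        split = ‖‖-∪ _ (E Γ U₁) (E Γ U₂) λ {i} {j} p → let (x , y , e) = ∈⁻ p in case i j x y e (i ∈? A) (j ∈? A)
          where
          case : ∀ i j → i ∈ U → j ∈ U → Edge Γ i j → Dec (i ∈ A) → Dec (j ∈ A) → j ∈ E Γ U₁ i ⊎ j ∈ E Γ U₂ i
          case i j x y e (yes p) _ = inj₁ (∈⁺ (∈⁺ (inj₁ p) , into₁ p y e , e))
          case i j x y e _ (yes q) = inj₁ (∈⁺ (into₁ q x (edge-sym e) , ∈⁺ (inj₁ q) , e))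
          case i j x y e (no p) (no q) = inj₂ (∈⁺ (∈⁺ (x , p) , ∈⁺ (y , q) , e))

        sizes : ⟪ U₁ ⟫ + ⟪ U₂ ⟫ ≤ ⟪ U ⟫ + ⟪ S ⟫
        sizes = linear 0 (∣∣-∪ U₁ A S ∈⁻ ⊕ ∣∣-disj U A U₂ A⊆U U₂⊆U (λ p q → proj₂ (∈⁻ q) p))
          (arith ⟪ U₁ ⟫ ⟪ U₂ ⟫ ⟪ U ⟫ ⟪ S ⟫ ⟪ A ⟫)
          where
          arith : ∀ u₁ u₂ u s a → u₁ + u₂ + (a + s + u) + 0 ≡ u + s + (u₁ + (a + u₂))
          arith u₁ u₂ u s a = solve (u₁ ∷ u₂ ∷ u ∷ s ∷ a ∷ [])

        -- No neighbour of a vertex of `A` leaves `U₁`, and no neighbour of a vertex beyond the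
        -- boundary lies in `A`. Degrees above `2K` thus keep both halves large.
        big₁ : 2 * K ≤ ⟪ U₁ ⟫
        big₁ = ≤-trans (<⇒≤ (δ (A⊆U a∈A))) (∣∣-mono λ p → into₁ a∈A (proj₂ (∈⁻ p)) (∈⁻ (proj₁ (∈⁻ p))))

        big₂ : 2 * K ≤ ⟪ U₂ ⟫
        big₂ = ≤-trans (<⇒≤ (δ b∈U)) (∣∣-mono λ {v} p → ∈⁺ (proj₂ (∈⁻ p) ,
          λ q → b∉S (∈⁺ (b∈U , b∉A , v , q , edge-sym (∈⁻ (proj₁ (∈⁻ p)))))))

      small₁ : ⟪ U₁ ⟫ < ⟪ U ⟫
      small₁ = ≤-trans (s≤s (∣∣-mono λ {v} p → ∈⁺ (U₁⊆U p , λ q → [ b∉A , b∉S ]′ (∈⁻ (subst (_∈ U₁) (∈⁻ q) p))))) (∣∣-remove U b b∈U)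

      small₂ : ⟪ U₂ ⟫ < ⟪ U ⟫
      small₂ = ≤-trans (s≤s (∣∣-mono λ {v} p → ∈⁺ (U₂⊆U p , λ q → proj₂ (∈⁻ (subst (_∈ U₂) (∈⁻ q) p)) a∈A))) (∣∣-remove U a (A⊆U a∈A))

      -- If both failed, then `e₂ ≤ 4K(∣U₁∣ + ∣U₂∣) - 8K² ≤ 4K(∣U∣ + ∣S∣) - 8K² ≤ 4K∣U∣ -
      -- 4K²`, because `∣S∣ ≤ K`.
      rich-half : Rich U₁ ⊎ Rich U₂
      rich-half with (4 * K * ⟪ U₁ ⟫) <? (e₂ Γ U₁ + 4 * K * K) | (4 * K * ⟪ U₂ ⟫) <? (e₂ Γ U₂ + 4 * K * K)
      ... | yes r | _ = inj₁ (big₁ , r)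
      ... | no _ | yes r = inj₂ (big₂ , r)
      ... | no r₁ | no r₂ = ⊥-elim (<⇒≱ (proj₂ rich) (arith ⟪ U ⟫ ⟪ U₁ ⟫ ⟪ U₂ ⟫ ⟪ S ⟫ (e₂ Γ U) (e₂ Γ U₁) (e₂ Γ U₂)
              (≮⇒≥ r₁) (≮⇒≥ r₂) split sizes (<⇒≤ ∣S∣<K)))
        where
        arith : ∀ u u₁ u₂ s e e₁ e₂ → e₁ + 4 * K * K ≤ 4 * K * u₁ → e₂ + 4 * K * K ≤ 4 * K * u₂ → e ≤ e₁ + e₂ →
          u₁ + u₂ ≤ u + s → s ≤ K → e + 4 * K * K ≤ 4 * K * u
        arith u u₁ u₂ s e e₁ e₂ a b c f g = linear 0 (a ⊕ b ⊕ c ⊕ (4 * K) ⊗ f ⊕ (4 * K) ⊗ g)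
          (solve (K ∷ u ∷ u₁ ∷ u₂ ∷ s ∷ e ∷ e₁ ∷ e₂ ∷ []))

    search : ∀ f U → ⟪ U ⟫ ≤ f → Rich U → ∃ λ V → V ⊆ U × Connectivity Γ V K
    search f U le rich with any? (λ v → (v ∈? U) ×-dec (deg Γ U v ≤? 2 * K))
    search zero U le rich | yes (v , p , low) = ⊥-elim (<⇒≱ (∃⇒∣∣>0 p) le)
    search (suc f) U le rich | yes (v , p , low) =
      let (V , V⊆ , c) = search f (U ∖ ⁅ v ⁆) (s≤s⁻¹ (≤-trans (∣∣-remove U v p) le)) (rich-remove U v p rich low)
      in V , (λ q → proj₁ (∈⁻ (V⊆ q))) , c
    search f U le rich | no high with cut-or-connected Γ U K (≤-<-trans (m≤m+n K _) (rich-large U rich))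
    ... | inj₂ c = U , (λ q → q) , c
    search zero U le rich | no high | inj₁ (A , cut) = ⊥-elim (<⇒≱ (<-≤-trans (≤-<-trans z≤n (rich-large U rich)) le) z≤n)
    search (suc f) U le rich | no high | inj₁ (A , cut) with rich-half U A cut rich (λ {v} p → ≰⇒> λ q → high (v , p , q))
    ... | inj₁ r = let (V , V⊆ , c) = search f _ (s≤s⁻¹ (≤-trans (small₁ U A cut rich δ) le)) r in V , (λ q → U₁⊆U U A cut rich δ (V⊆ q)) , c
      where
      δ : ∀ {v} → v ∈ U → 2 * K < deg Γ U v
      δ {v} p = ≰⇒> λ q → high (v , p , q)
    ... | inj₂ r = let (V , V⊆ , c) = search f _ (s≤s⁻¹ (≤-trans (small₂ U A cut rich δ) le)) r in V , (λ q → U₂⊆U U A cut rich δ (V⊆ q)) , c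
      where
      δ : ∀ {v} → v ∈ U → 2 * K < deg Γ U v
      δ {v} p = ≰⇒> λ q → high (v , p , q)

  -- From `4K∣W∣ ≤ e₂ ≤ ∣W∣²` follows `∣W∣ ≥ 4K`; the positive term `4K²` makes the edge bound
  -- strict.
  mader : (W : VSet n) → 0 < K → 0 < ⟪ W ⟫ → 4 * K * ⟪ W ⟫ ≤ e₂ Γ W → ∃ λ V → V ⊆ W × Connectivity Γ V K
  mader W 0<K 0<W le = search ⟪ W ⟫ W ≤-refl (≤-trans 2K≤4K 4K≤W , ≤-<-trans le (m<m+n _ (*-mono-≤ {1} {4 * K} {1} {K} (≤-trans 0<K (m≤m+n K _)) 0<K)))
    where
    4K≤W : 4 * K ≤ ⟪ W ⟫
    4K≤W = *-cancelʳ-≤ (4 * K) ⟪ W ⟫ ⟪ W ⟫ {{>-nonZero 0<W}} (≤-trans le (e₂≤square Γ W))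
    2K≤4K : 2 * K ≤ 4 * K
    2K≤4K = *-monoˡ-≤ K {2} {4} (s≤s (s≤s z≤n))

-- Menger's theorem

-- Disjoint connected sets stand in for paths, so that gluing is a union. `tgt-only` guarantees that
-- linkages glued along a separator do not meet elsewhere.
record Linkage (Γ : Graph n) (U X T : VSet n) (q : ℕ) : Set where
  field
    Z        : Fin q → VSet n
    Z⊆       : ∀ i → Z i ⊆ U
    Z-conn   : ∀ i → Conn Γ (Z i)
    Z-disj   : ∀ {i j v} → v ∈ Z i → v ∈ Z j → i ≡ j
    src tgt  : Fin q → Fin n
    src∈X    : ∀ i → src i ∈ X
    src∈Z    : ∀ i → src i ∈ Z i
    tgt∈T    : ∀ i → tgt i ∈ T
    tgt∈Z    : ∀ i → tgt i ∈ Z i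
    tgt-only : ∀ {i v} → v ∈ Z i → v ∈ T → v ≡ tgt i

record Separation (Γ : Graph n) (U X T : VSet n) (q : ℕ) : Set where
  field
    P Q     : VSet n
    P⊆      : P ⊆ U
    Q⊆      : Q ⊆ U
    cover   : ∀ {v} → v ∈ U → v ∈ P ⊎ v ∈ Q
    X⊆P     : X ⊆ P
    T⊆Q     : T ⊆ Q
    no-edge : ∀ {a b} → a ∈ P → a ∉ Q → b ∈ Q → b ∉ P → ¬ Edge Γ a b
    small   : ⟪ P ∩ Q ⟫ < q

module _ {Γ : Graph n} {U X T : VSet n} {q : ℕ} (L : Linkage Γ U X T q) where
  open Linkage L

  src-injective : ∀ {i j} → src i ≡ src j → i ≡ j
  src-injective {i} {j} e = Z-disj (src∈Z i) (subst (_∈ Z j) (sym e) (src∈Z j))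

  tgt-injective : ∀ {i j} → tgt i ≡ tgt j → i ≡ j
  tgt-injective {i} {j} e = Z-disj (tgt∈Z i) (subst (_∈ Z j) (sym e) (tgt∈Z j))

  src-onto : ⟪ X ⟫ ≤ q → ∀ {v} → v ∈ X → ∃ λ i → src i ≡ v
  src-onto = injection-onto X src src∈X src-injective

-- The step of Göring's proof of Menger's theorem: Γ′ is Γ without the edge xy, and (P , Q) separates in Γ′ but not in Γ.
module Splice (Γ Γ′ : Graph n) (U X T : VSet n) (q : ℕ) (x y : Fin n)
  (Γ′⊑Γ : Γ′ ⊑ Γ) (xy : Edge Γ x y)
  (lost : ∀ {u v} → Edge Γ u v → Edge Γ′ u v ⊎ (u ≡ x × v ≡ y) ⊎ (u ≡ y × v ≡ x))
  (sep : Separation Γ′ U X T q) where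
  open Separation sep

  S Sx Sy : VSet n
  S  = P ∩ Q
  Sx = S ∪ ⁅ x ⁆
  Sy = S ∪ ⁅ y ⁆

  module _ (x∈P : x ∈ P) (x∉Q : x ∉ Q) (y∈Q : y ∈ Q) (y∉P : y ∉ P) where

    Sx⊆P : Sx ⊆ P
    Sx⊆P p = [ (λ s → proj₁ (∈⁻ s)) , (λ e → subst (_∈ P) (sym (∈⁻ e)) x∈P) ]′ (∈⁻ p)

    Sy⊆Q : Sy ⊆ Q
    Sy⊆Q p = [ (λ s → proj₂ (∈⁻ s)) , (λ e → subst (_∈ Q) (sym (∈⁻ e)) y∈Q) ]′ (∈⁻ p)

    -- Once `x` lies on both sides, the edge `xy` no longer crosses, and the order is that of `Sx`.
    enlarge : ⟪ Sx ⟫ < q → Separation Γ U X T q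
    enlarge lt = record
      { P = P ; Q = Q ∪ ⁅ x ⁆ ; P⊆ = P⊆
      ; Q⊆ = λ p → [ Q⊆ , (λ e → subst (_∈ U) (sym (∈⁻ e)) (P⊆ x∈P)) ]′ (∈⁻ p)
      ; cover = λ p → [ inj₁ , (λ q → inj₂ (∈⁺ (inj₁ q))) ]′ (cover p)
      ; X⊆P = X⊆P ; T⊆Q = λ p → ∈⁺ (inj₁ (T⊆Q p))
      ; no-edge = λ a∈ a∉ b∈ b∉ e → crossing a∈ a∉ (∈⁻ b∈) b∉ (lost e)
      ; small = ∣∣-mono-< {A = P ∩ (Q ∪ ⁅ x ⁆)} (λ p → let (a , b) = ∈⁻ p in ∈⁺ ([ (λ q → inj₁ (∈⁺ (a , q))) , inj₂ ]′ (∈⁻ b))) lt }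
      where
      crossing : ∀ {a b} → a ∈ P → a ∉ Q ∪ ⁅ x ⁆ → b ∈ Q ⊎ b ∈ ⁅ x ⁆ → b ∉ P → Edge Γ′ a b ⊎ (a ≡ x × b ≡ y) ⊎ (a ≡ y × b ≡ x) → ⊥
      crossing a∈ a∉ (inj₂ b=x) b∉ _ = b∉ (subst (_∈ P) (sym (∈⁻ b=x)) x∈P)
      crossing a∈ a∉ (inj₁ b∈) b∉ (inj₁ e) = no-edge a∈ (λ q → a∉ (∈⁺ (inj₁ q))) b∈ b∉ e
      crossing a∈ a∉ (inj₁ b∈) b∉ (inj₂ (inj₁ (a=x , _))) = a∉ (∈⁺ (inj₂ (∈⁺ a=x)))
      crossing a∈ a∉ (inj₁ b∈) b∉ (inj₂ (inj₂ (_ , b=x))) = b∉ (subst (_∈ P) (sym b=x) x∈P)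

    -- All of `Q` joins the far side. This adds nothing to the common part, since `P₁ ∩ Q ⊆ S ⊆ Q₁`;
    -- and `x ∈ Q₁` prevents `xy` from crossing. `right` is the mirror image.
    left : Separation Γ′ P X Sx q → Separation Γ U X T q
    left s₁ = record
      { P = P₁ ; Q = Q₁ ∪ Q ; P⊆ = λ p → P⊆ (P₁⊆ p)
      ; Q⊆ = λ p → [ (λ q → P⊆ (Q₁⊆ q)) , Q⊆ ]′ (∈⁻ p)
      ; cover = λ p → [ (λ q → [ inj₁ , (λ r → inj₂ (∈⁺ (inj₁ r))) ]′ (cover₁ q)) , (λ q → inj₂ (∈⁺ (inj₂ q))) ]′ (cover p)
      ; X⊆P = X⊆P₁ ; T⊆Q = λ p → ∈⁺ (inj₂ (T⊆Q p))
      ; no-edge = λ a∈ a∉ b∈ b∉ e → crossing a∈ (λ r → a∉ (∈⁺ (inj₁ r))) (λ r → a∉ (∈⁺ (inj₂ r))) (∈⁻ b∈) b∉ (lost e)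
      ; small = ∣∣-mono-< {A = P₁ ∩ (Q₁ ∪ Q)} (λ p → let (a , b) = ∈⁻ p in ∈⁺ (a , [ (λ q → q) , (λ q → Sx⊆Q₁ (∈⁺ (inj₁ (∈⁺ (P₁⊆ a , q))))) ]′ (∈⁻ b))) small₁ }
      where
      open Separation s₁ renaming (P to P₁; Q to Q₁; P⊆ to P₁⊆; Q⊆ to Q₁⊆; cover to cover₁; X⊆P to X⊆P₁; T⊆Q to Sx⊆Q₁; no-edge to no-edge₁; small to small₁)
      x∈Q₁ = Sx⊆Q₁ (∈⁺ (inj₂ (∈⁺ refl)))
      crossing : ∀ {a b} → a ∈ P₁ → a ∉ Q₁ → a ∉ Q → b ∈ Q₁ ⊎ b ∈ Q → b ∉ P₁ → Edge Γ′ a b ⊎ (a ≡ x × b ≡ y) ⊎ (a ≡ y × b ≡ x) → ⊥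
      crossing a∈ a∉ a∉Q b∈ b∉ (inj₂ (inj₁ (refl , _))) = a∉ x∈Q₁
      crossing a∈ a∉ a∉Q b∈ b∉ (inj₂ (inj₂ (refl , _))) = y∉P (P₁⊆ a∈)
      crossing a∈ a∉ a∉Q (inj₁ b∈) b∉ (inj₁ e) = no-edge₁ a∈ a∉ b∈ b∉ e
      crossing {b = b} a∈ a∉ a∉Q (inj₂ b∈) b∉ (inj₁ e) with b ∈? P
      ... | yes p = no-edge₁ a∈ a∉ (Sx⊆Q₁ (∈⁺ (inj₁ (∈⁺ (p , b∈))))) b∉ e
      ... | no ¬p = no-edge (P₁⊆ a∈) a∉Q b∈ ¬p e

    right : Separation Γ′ Q Sy T q → Separation Γ U X T q
    right s₂ = record
      { P = P ∪ P₂ ; Q = Q₂ ; Q⊆ = λ p → Q⊆ (Q₂⊆ p)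
      ; P⊆ = λ p → [ P⊆ , (λ q → Q⊆ (P₂⊆ q)) ]′ (∈⁻ p)
      ; cover = λ p → [ (λ q → inj₁ (∈⁺ (inj₁ q))) , (λ q → [ (λ r → inj₁ (∈⁺ (inj₂ r))) , inj₂ ]′ (cover₂ q)) ]′ (cover p)
      ; X⊆P = λ p → ∈⁺ (inj₁ (X⊆P p)) ; T⊆Q = T⊆Q₂
      ; no-edge = λ a∈ a∉ b∈ b∉ e → crossing (∈⁻ a∈) a∉ b∈ (λ r → b∉ (∈⁺ (inj₁ r))) (λ r → b∉ (∈⁺ (inj₂ r))) (lost e)
      ; small = ∣∣-mono-< {A = (P ∪ P₂) ∩ Q₂} (λ p → let (a , b) = ∈⁻ p in ∈⁺ ([ (λ q → Sy⊆P₂ (∈⁺ (inj₁ (∈⁺ (q , Q₂⊆ b))))) , (λ q → q) ]′ (∈⁻ a) , b)) small₂ }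
      where
      open Separation s₂ renaming (P to P₂; Q to Q₂; P⊆ to P₂⊆; Q⊆ to Q₂⊆; cover to cover₂; X⊆P to Sy⊆P₂; T⊆Q to T⊆Q₂; no-edge to no-edge₂; small to small₂)
      crossing : ∀ {a b} → a ∈ P ⊎ a ∈ P₂ → a ∉ Q₂ → b ∈ Q₂ → b ∉ P → b ∉ P₂ → Edge Γ′ a b ⊎ (a ≡ x × b ≡ y) ⊎ (a ≡ y × b ≡ x) → ⊥
      crossing a∈ a∉ b∈ b∉P b∉ (inj₂ (inj₁ (_ , refl))) = b∉ (Sy⊆P₂ (∈⁺ (inj₂ (∈⁺ refl))))
      crossing a∈ a∉ b∈ b∉P b∉ (inj₂ (inj₂ (_ , refl))) = b∉P x∈P
      crossing (inj₂ a∈) a∉ b∈ b∉P b∉ (inj₁ e) = no-edge₂ a∈ a∉ b∈ b∉ e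
      crossing {a = a} (inj₁ a∈) a∉ b∈ b∉P b∉ (inj₁ e) with a ∈? Q
      ... | yes p = no-edge₂ (Sy⊆P₂ (∈⁺ (inj₁ (∈⁺ (a∈ , p))))) a∉ b∈ b∉ e
      ... | no ¬p = no-edge a∈ ¬p (Q₂⊆ b∈) b∉P e

    module _ (L₁ : Linkage Γ′ P X Sx q) (L₂ : Linkage Γ′ Q Sy T q) where
      private
        module L₁ = Linkage L₁
        module L₂ = Linkage L₂

        -- Since `∣S∣ < q`, the `q` distinct starts of `L₂` exhaust `Sy`, so every end of `L₁` finds
        -- a continuation.
        ∣Sy∣≤q : ⟪ Sy ⟫ ≤ q
        ∣Sy∣≤q = ≤-trans (∣∣-∪ Sy S ⁅ y ⁆ ∈⁻) (≤-trans (+-monoʳ-≤ _ (∣⁅⁆∣ y)) (≤-trans (≤-reflexive (+-comm _ 1)) small))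

        -- An end in `S` continues from itself; the end `x` continues from `y`, across the deleted
        -- edge.
        Match : Fin q → Fin n → Set
        Match i w = w ∈ Sy × ((L₁.tgt i ∈ S × w ≡ L₁.tgt i) ⊎ (L₁.tgt i ≡ x × w ≡ y))

        match : ∀ i → ∃ (Match i)
        match i = [ (λ s → L₁.tgt i , ∈⁺ (inj₁ s) , inj₁ (s , refl)) , (λ e → y , ∈⁺ (inj₂ (∈⁺ refl)) , inj₂ (∈⁻ e , refl)) ]′ (∈⁻ (L₁.tgt∈T i))

        y∉S : y ∉ S
        y∉S p = y∉P (proj₁ (∈⁻ p))

        match-inj : ∀ {i j w} → Match i w → Match j w → i ≡ j
        match-inj (_ , inj₁ (s , e)) (_ , inj₁ (s′ , e′)) = tgt-injective L₁ (trans (sym e) e′)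
        match-inj (_ , inj₁ (s , e)) (_ , inj₂ (_ , e′)) = ⊥-elim (y∉S (subst (_∈ S) (trans (sym e) e′) s))
        match-inj (_ , inj₂ (_ , e)) (_ , inj₁ (s , e′)) = ⊥-elim (y∉S (subst (_∈ S) (trans (sym e′) e) s))
        match-inj (_ , inj₂ (e , _)) (_ , inj₂ (e′ , _)) = tgt-injective L₁ (trans e (sym e′))

        partner : ∀ i → ∃ λ j → L₂.src j ≡ proj₁ (match i)
        partner i = src-onto L₂ ∣Sy∣≤q (proj₁ (proj₂ (match i)))

        σ : Fin q → Fin q
        σ i = proj₁ (partner i)

        σ-match : ∀ i → Match i (L₂.src (σ i))
        σ-match i = subst (Match i) (sym (proj₂ (partner i))) (proj₂ (match i))

        -- A vertex of Z₁ i lying in Q is the end of Z₁ i, hence the start of its partner.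
        meet : ∀ {i v} → v ∈ L₁.Z i → v ∈ Q → v ∈ S × v ≡ L₁.tgt i × v ≡ L₂.src (σ i)
        meet {i} {v} p q = s , e , lemma (proj₂ (σ-match i))
          where
          s : v ∈ S
          s = ∈⁺ (L₁.Z⊆ i p , q)
          e : v ≡ L₁.tgt i
          e = L₁.tgt-only p (∈⁺ (inj₁ s))
          lemma : (L₁.tgt i ∈ S × L₂.src (σ i) ≡ L₁.tgt i) ⊎ (L₁.tgt i ≡ x × L₂.src (σ i) ≡ y) → v ≡ L₂.src (σ i)
          lemma (inj₁ (_ , e′)) = trans e (sym e′)
          lemma (inj₂ (e′ , _)) = ⊥-elim (x∉Q (subst (_∈ Q) (trans e e′) q))

        σ-inj : ∀ {i j} → σ i ≡ σ j → i ≡ j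
        σ-inj {i} {j} e = match-inj (σ-match i) (subst (λ k → Match j (L₂.src k)) (sym e) (σ-match j))

        mixed : ∀ {i j v} → v ∈ L₁.Z i → v ∈ L₂.Z (σ j) → i ≡ j
        mixed {i} {j} p q = let (_ , _ , e) = meet p (L₂.Z⊆ (σ j) q) in
          σ-inj (L₂.Z-disj (subst (_∈ L₂.Z (σ i)) (sym e) (L₂.src∈Z (σ i))) q)

        disj : ∀ {i j v} → v ∈ L₁.Z i ⊎ v ∈ L₂.Z (σ i) → v ∈ L₁.Z j ⊎ v ∈ L₂.Z (σ j) → i ≡ j
        disj (inj₁ p) (inj₁ q) = L₁.Z-disj p q
        disj (inj₁ p) (inj₂ q) = mixed p q
        disj (inj₂ p) (inj₁ q) = sym (mixed q p)
        disj (inj₂ p) (inj₂ q) = σ-inj (L₂.Z-disj p q)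

        joint : ∀ i → L₁.tgt i ≡ L₂.src (σ i) ⊎ Edge Γ (L₁.tgt i) (L₂.src (σ i))
        joint i = [ (λ (_ , e) → inj₁ (sym e)) , (λ (e , e′) → inj₂ (subst (λ a → Edge Γ a (L₂.src (σ i))) (sym e) (subst (Edge Γ x) (sym e′) xy))) ]′ (proj₂ (σ-match i))

        only : ∀ {i v} → v ∈ L₁.Z i ⊎ v ∈ L₂.Z (σ i) → v ∈ T → v ≡ L₂.tgt (σ i)
        only (inj₂ p) t = L₂.tgt-only p t
        only {i} (inj₁ p) t = let (_ , _ , e) = meet p (T⊆Q t) in L₂.tgt-only (subst (_∈ L₂.Z (σ i)) (sym e) (L₂.src∈Z (σ i))) t

      splice : Linkage Γ U X T q
      splice = record
        { Z = λ i → L₁.Z i ∪ L₂.Z (σ i)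
        ; Z⊆ = λ i p → [ (λ q → P⊆ (L₁.Z⊆ i q)) , (λ q → Q⊆ (L₂.Z⊆ (σ i) q)) ]′ (∈⁻ p)
        ; Z-conn = λ i → conn-∪ (λ p q → path-mono Γ′⊑Γ (λ r → r) (L₁.Z-conn i p q)) (λ p q → path-mono Γ′⊑Γ (λ r → r) (L₂.Z-conn (σ i) p q))
            (L₁.tgt∈Z i) (L₂.src∈Z (σ i)) (joint i)
        ; Z-disj = λ p q → disj (∈⁻ p) (∈⁻ q)
        ; src = L₁.src ; tgt = λ i → L₂.tgt (σ i)
        ; src∈X = L₁.src∈X ; src∈Z = λ i → ∈⁺ (inj₁ (L₁.src∈Z i))
        ; tgt∈T = λ i → L₂.tgt∈T (σ i) ; tgt∈Z = λ i → ∈⁺ (inj₂ (L₂.tgt∈Z (σ i)))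
        ; tgt-only = λ p t → only (∈⁻ p) t }

module _ (Γ : Graph n) (x y : Fin n) where
  private
    Cut-edge : Fin n → Fin n → Set
    Cut-edge u v = (u ≡ x × v ≡ y) ⊎ (u ≡ y × v ≡ x)

    cut-edge? : ∀ u v → Dec (Cut-edge u v)
    cut-edge? u v = ((u ≟ x) ×-dec (v ≟ y)) ⊎-dec ((u ≟ y) ×-dec (v ≟ x))

    cut-sym : ∀ {u v} → Cut-edge u v → Cut-edge v u
    cut-sym (inj₁ (a , b)) = inj₂ (b , a)
    cut-sym (inj₂ (a , b)) = inj₁ (b , a)

  delete : Graph n
  delete = graph (λ u v → edge? Γ u v ×-dec ¬? (cut-edge? u v)) (λ (e , c) → edge-sym e , (λ d → c (cut-sym d))) (λ (e , _) → edge-≢ e refl)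

  delete⊑ : delete ⊑ Γ
  delete⊑ e = proj₁ (graph⁻ e)

  deleted : ∀ {u v} → Edge Γ u v → Edge delete u v ⊎ (u ≡ x × v ≡ y) ⊎ (u ≡ y × v ≡ x)
  deleted {u} {v} e with cut-edge? u v
  ... | yes c = inj₂ c
  ... | no ¬c = inj₁ (graph⁺ (e , ¬c))

  delete-e₂ : (U : VSet n) → x ∈ U → y ∈ U → Edge Γ x y → e₂ delete U < e₂ Γ U
  delete-e₂ U x∈ y∈ e = ≤-trans (≤-trans (≤-reflexive (+-comm 1 _)) (+-monoʳ-≤ _ (≤-trans (∃⇒∣∣>0 {S = ⁅ y ⁆} (∈⁺ refl)) (‖row‖≥ x ⁅ y ⁆))))
    (‖‖-disj (E Γ U) (E delete U) (row x ⁅ y ⁆)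
      (λ p → let (a , b , f) = ∈⁻ p in ∈⁺ (a , b , delete⊑ f))
      (λ {i} {j} p → let (a , b) = ∈⁻ p in sub i j a (∈⁻ b))
      (λ {i} {j} p q → let (_ , _ , f) = ∈⁻ p ; (a , b) = ∈⁻ q in proj₂ (graph⁻ f) (inj₁ (a , ∈⁻ b))))
    where
    sub : ∀ i j → i ≡ x → j ≡ y → j ∈ E Γ U i
    sub i j refl refl = ∈⁺ (x∈ , y∈ , e)

e₂-mono : (Γ : Graph n) {A B : VSet n} → A ⊆ B → e₂ Γ A ≤ e₂ Γ B
e₂-mono Γ h = ∑-mono λ i → ∣∣-mono λ p → let (a , b , e) = ∈⁻ p in ∈⁺ (h a , h b , e)

-- Without edges a path is a single vertex of `X ∩ T`. If there are too few of these, `X` and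
-- `(U ∖ X) ∪ T` form the separation, with common part `X ∩ T`.
menger-edgeless : (Γ : Graph n) (U X T : VSet n) (q : ℕ) → X ⊆ U → T ⊆ U → (∀ {a b} → a ∈ U → b ∈ U → ¬ Edge Γ a b) →
  Linkage Γ U X T q ⊎ Separation Γ U X T q
menger-edgeless {n} Γ U X T q X⊆U T⊆U none with q ≤? ⟪ X ∩ T ⟫
... | yes le = inj₁ record
        { Z = λ i → ⁅ x i ⁆ ; Z⊆ = λ i p → subst (_∈ U) (sym (∈⁻ p)) (X⊆U (proj₁ (x∈ i)))
        ; Z-conn = λ i → conn-⁅⁆ ; Z-disj = λ p q → pick-injective c (trans (sym (∈⁻ p)) (∈⁻ q))
        ; src = x ; tgt = x ; src∈X = λ i → proj₁ (x∈ i) ; src∈Z = λ i → ∈⁺ refl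
        ; tgt∈T = λ i → proj₂ (x∈ i) ; tgt∈Z = λ i → ∈⁺ refl ; tgt-only = λ p _ → ∈⁻ p }
  where
  c = enumerate (X ∩ T) le
  x = pick c
  x∈ : ∀ i → x i ∈ X × x i ∈ T
  x∈ i = ∈⁻ (pick∈ c i)
... | no gt = inj₂ record
        { P = X ; Q = Q ; P⊆ = X⊆U ; Q⊆ = λ p → proj₁ (∈⁻ p) ; cover = λ {v} p → cov p (v ∈? X)
        ; X⊆P = λ p → p ; T⊆Q = λ p → ∈⁺ (T⊆U p , inj₂ p)
        ; no-edge = λ a _ b _ → none (X⊆U a) (proj₁ (∈⁻ b))
        ; small = ∣∣-mono-< {A = X ∩ Q} (λ p → let (a , b) = ∈⁻ p in ∈⁺ (a , [ (λ ¬x → ⊥-elim (¬x a)) , (λ t → t) ]′ (proj₂ (∈⁻ b)))) (≰⇒> gt) }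
  where
  Q : VSet n
  Q = ⟦ (λ v → (v ∈? U) ×-dec (¬? (v ∈? X) ⊎-dec (v ∈? T))) ⟧
  cov : ∀ {v} → v ∈ U → Dec (v ∈ X) → v ∈ X ⊎ v ∈ Q
  cov p (yes x) = inj₁ x
  cov p (no ¬x) = inj₂ (∈⁺ (p , inj₁ ¬x))

linkage-⊑ : {Γ Δ : Graph n} {U X T : VSet n} {q : ℕ} → Γ ⊑ Δ → Linkage Γ U X T q → Linkage Δ U X T q
linkage-⊑ h L = record { Linkage L hiding (Z-conn) ; Z-conn = λ i p q → path-mono h (λ r → r) (Linkage.Z-conn L i p q) }

-- Induction on the number of edges: one edge is deleted. A separation that the restored edge
-- crosses is examined inside `P` and inside `Q`, still without that edge; a failure on either side
-- yields a separation of the whole.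
menger′ : ∀ f (Γ : Graph n) (U X T : VSet n) (q : ℕ) → e₂ Γ U ≤ f → X ⊆ U → T ⊆ U → Linkage Γ U X T q ⊎ Separation Γ U X T q
menger′ {n} f Γ U X T q le X⊆U T⊆U with any? (λ x → any? (λ y → (x ∈? U) ×-dec (y ∈? U) ×-dec edge? Γ x y))
... | no none = menger-edgeless Γ U X T q X⊆U T⊆U λ {a} {b} p r e → none (a , b , p , r , e)
menger′ zero Γ U X T q le X⊆U T⊆U | yes (x , y , x∈ , y∈ , e) = ⊥-elim (<⇒≱ (≤-<-trans z≤n (delete-e₂ Γ x y U x∈ y∈ e)) le)
menger′ {n} (suc f) Γ U X T q le X⊆U T⊆U | yes (x , y , x∈ , y∈ , e) = [ (λ L → inj₁ (linkage-⊑ (delete⊑ Γ x y) L)) , split ]′ (menger′ f Γ′ U X T q le′ X⊆U T⊆U)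
  where
  Γ′ = delete Γ x y
  le′ : e₂ Γ′ U ≤ f
  le′ = s≤s⁻¹ (≤-trans (delete-e₂ Γ x y U x∈ y∈ e) le)

  module _ (sep : Separation Γ′ U X T q) where
    open Separation sep

    across : ∀ a b → Edge Γ a b → (∀ {u v} → Edge Γ u v → Edge Γ′ u v ⊎ (u ≡ a × v ≡ b) ⊎ (u ≡ b × v ≡ a)) →
      a ∈ P → a ∉ Q → b ∈ Q → b ∉ P → Linkage Γ U X T q ⊎ Separation Γ U X T q
    across a b ab lost a∈ a∉ b∈ b∉ with ⟪ M.Sx ⟫ <? q
      where module M = Splice Γ Γ′ U X T q a b (delete⊑ Γ x y) ab lost sep
    ... | yes lt = inj₂ (Splice.enlarge Γ Γ′ U X T q a b (delete⊑ Γ x y) ab lost sep a∈ a∉ b∈ b∉ lt)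
    ... | no _ = [ (λ L₁ → [ (λ L₂ → inj₁ (M.splice a∈ a∉ b∈ b∉ L₁ L₂)) , (λ s → inj₂ (M.right a∈ a∉ b∈ b∉ s)) ]′
                    (menger′ f Γ′ Q M.Sy T q (≤-trans (e₂-mono Γ′ Q⊆) le′) (M.Sy⊆Q a∈ a∉ b∈ b∉) T⊆Q))
                 , (λ s → inj₂ (M.left a∈ a∉ b∈ b∉ s)) ]′
                 (menger′ f Γ′ P X M.Sx q (≤-trans (e₂-mono Γ′ P⊆) le′) X⊆P (M.Sx⊆P a∈ a∉ b∈ b∉))
      where module M = Splice Γ Γ′ U X T q a b (delete⊑ Γ x y) ab lost sep

    swap : ∀ {u v} → Edge Γ u v → Edge Γ′ u v ⊎ (u ≡ y × v ≡ x) ⊎ (u ≡ x × v ≡ y)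
    swap d = [ inj₁ , (λ c → inj₂ ([ inj₂ , inj₁ ]′ c)) ]′ (deleted Γ x y d)

    split : Linkage Γ U X T q ⊎ Separation Γ U X T q
    split with (x ∈? P) ×-dec ¬? (x ∈? Q) ×-dec (y ∈? Q) ×-dec ¬? (y ∈? P) | (y ∈? P) ×-dec ¬? (y ∈? Q) ×-dec (x ∈? Q) ×-dec ¬? (x ∈? P)
    ... | yes (a , b , c , d) | _ = across x y e (deleted Γ x y) a b c d
    ... | no _ | yes (a , b , c , d) = across y x (edge-sym e) swap a b c d
    ... | no ¬1 | no ¬2 = inj₂ record { Separation sep hiding (no-edge) ; no-edge = λ a∈ a∉ b∈ b∉ d → crossing a∈ a∉ b∈ b∉ (deleted Γ x y d) }
      where
      crossing : ∀ {a b} → a ∈ P → a ∉ Q → b ∈ Q → b ∉ P → Edge Γ′ a b ⊎ (a ≡ x × b ≡ y) ⊎ (a ≡ y × b ≡ x) → ⊥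
      crossing a∈ a∉ b∈ b∉ (inj₁ d) = no-edge a∈ a∉ b∈ b∉ d
      crossing a∈ a∉ b∈ b∉ (inj₂ (inj₁ (refl , refl))) = ¬1 (a∈ , a∉ , b∈ , b∉)
      crossing a∈ a∉ b∈ b∉ (inj₂ (inj₂ (refl , refl))) = ¬2 (a∈ , a∉ , b∈ , b∉)

menger : (Γ : Graph n) (U X T : VSet n) (q : ℕ) → X ⊆ U → T ⊆ U → Linkage Γ U X T q ⊎ Separation Γ U X T q
menger Γ U X T q = menger′ (e₂ Γ U) Γ U X T q ≤-refl

-- Dense minors

-- A minor of Γ[U] whose vertices are named by representatives: the branch set of v contains v.
record Minor (Γ : Graph n) (U : VSet n) : Set where
  field
    alive    : VSet n
    M        : Graph n
    bag      : Fin n → VSet n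
    bag⊆     : ∀ {v} → v ∈ alive → bag v ⊆ U
    self     : ∀ {v} → v ∈ alive → v ∈ bag v
    bag-conn : ∀ {v} → v ∈ alive → Conn Γ (bag v)
    bag-disj : ∀ {u v w} → u ∈ alive → v ∈ alive → w ∈ bag u → w ∈ bag v → u ≡ v
    M-edge   : ∀ {u v} → u ∈ alive → v ∈ alive → Edge M u v → ∃ λ a → ∃ λ b → a ∈ bag u × b ∈ bag v × Edge Γ a b

module _ {Γ : Graph n} {U : VSet n} (μ : Minor Γ U) where
  open Minor μ

  restrict : (A : VSet n) → A ⊆ alive → Minor Γ U
  restrict A h = record
    { alive = A ; M = M ; bag = bag ; bag⊆ = λ p → bag⊆ (h p) ; self = λ p → self (h p) ; bag-conn = λ p → bag-conn (h p)
    ; bag-disj = λ p q → bag-disj (h p) (h q) ; M-edge = λ p q → M-edge (h p) (h q) }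

  weaken : (M′ : Graph n) → M′ ⊑ M → Minor Γ U
  weaken M′ h = record { Minor μ hiding (M; M-edge) ; M = M′ ; M-edge = λ p q e → M-edge p q (h e) }

  lift : VSet n → VSet n
  lift Q = ⟦ (λ w → any? (λ v → (v ∈? Q) ×-dec (w ∈? bag v))) ⟧

  lift-path : ∀ {Q u v a b} → Q ⊆ alive → Path M Q u v → a ∈ bag u → b ∈ bag v → Path Γ (lift Q) a b
  lift-path {u = u} h [ p ]ₚ a∈ b∈ = path-mono (λ e → e) (λ q → ∈⁺ (u , p , q)) (bag-conn (h p) a∈ b∈)
  lift-path {u = u} h (cons p e q) a∈ b∈ =
    let (c , d , c∈ , d∈ , f) = M-edge (h p) (h (path-start q)) e
    in path-++ (path-mono (λ e → e) (λ q → ∈⁺ (u , p , q)) (bag-conn (h p) a∈ c∈)) (cons (∈⁺ (u , p , c∈)) f (lift-path h q d∈ b∈))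

  lift-conn : ∀ {Q} → Q ⊆ alive → Conn M Q → Conn Γ (lift Q)
  lift-conn h c p q = let (u , u∈ , a∈) = ∈⁻ p ; (v , v∈ , b∈) = ∈⁻ q in lift-path h (c u∈ v∈) a∈ b∈

trivial-minor : (Γ : Graph n) (U : VSet n) → Minor Γ U
trivial-minor Γ U = record
  { alive = U ; M = Γ ; bag = ⁅_⁆ ; bag⊆ = λ p q → subst (_∈ U) (sym (∈⁻ q)) p ; self = λ _ → ∈⁺ refl ; bag-conn = λ _ → conn-⁅⁆
  ; bag-disj = λ _ _ p q → trans (sym (∈⁻ p)) (∈⁻ q) ; M-edge = λ {u} {v} _ _ e → u , v , ∈⁺ refl , ∈⁺ refl , e }

codeg : Graph n → VSet n → Fin n → Fin n → ℕ
codeg Γ A u v = deg Γ (N Γ v ∩ A) u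

-- The merged vertex keeps the name `u`, and `v` ceases to be alive; the vertex type never changes.
module Contract {Γ : Graph n} {U : VSet n} (μ : Minor Γ U) (u v : Fin n)
  (u∈ : u ∈ Minor.alive μ) (v∈ : v ∈ Minor.alive μ) (uv : Edge (Minor.M μ) u v) where
  open Minor μ

  private
    A′ : VSet n
    A′ = alive ∖ ⁅ v ⁆

    Adj : Fin n → Fin n → Set
    Adj a b = a ≢ b × (Edge M a b ⊎ (a ≡ u × Edge M v b) ⊎ (b ≡ u × Edge M v a))

    adj? : ∀ a b → Dec (Adj a b)
    adj? a b = ¬? (a ≟ b) ×-dec (edge? M a b ⊎-dec ((a ≟ u) ×-dec edge? M v b) ⊎-dec ((b ≟ u) ×-dec edge? M v a))

    adj-symmetric : ∀ {a b} → Adj a b → Adj b a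
    adj-symmetric (ne , inj₁ e)        = (λ e → ne (sym e)) , inj₁ (edge-sym e)
    adj-symmetric (ne , inj₂ (inj₁ e)) = (λ e → ne (sym e)) , inj₂ (inj₂ e)
    adj-symmetric (ne , inj₂ (inj₂ e)) = (λ e → ne (sym e)) , inj₂ (inj₁ e)

    M′ : Graph n
    M′ = graph adj? adj-symmetric (λ (ne , _) → ne refl)

    bag′ : Fin n → VSet n
    bag′ w = ⟦ (λ x → (x ∈? bag w) ⊎-dec ((w ≟ u) ×-dec (x ∈? bag v))) ⟧

    old : ∀ {w} → w ∈ A′ → w ∈ alive
    old p = proj₁ (∈⁻ p)

    conn′ : ∀ {w} → w ∈ A′ → Conn Γ (bag′ w)
    conn′ {w} p = case (w ≟ u)
      where
      case : Dec (w ≡ u) → Conn Γ (bag′ w)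
      case (no ¬e) x y = path-mono (λ e → e) (λ q → ∈⁺ (inj₁ q)) (bag-conn (old p) (only x) (only y))
        where
        only : ∀ {x} → x ∈ bag′ w → x ∈ bag w
        only x = [ (λ q → q) , (λ (e , _) → ⊥-elim (¬e e)) ]′ (∈⁻ x)
      case (yes refl) x y = let (a , b , a∈ , b∈ , e) = M-edge u∈ v∈ uv in
        path-mono (λ e → e) (λ q → ∈⁺ ([ inj₁ , (λ r → inj₂ (refl , r)) ]′ (∈⁻ q)))
          (conn-∪ (bag-conn u∈) (bag-conn v∈) a∈ b∈ (inj₂ e) (both x) (both y))
        where
        both : ∀ {x} → x ∈ bag′ w → x ∈ bag w ∪ bag v
        both x = ∈⁺ ([ inj₁ , (λ (_ , q) → inj₂ q) ]′ (∈⁻ x))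

    ≢v : ∀ {w} → w ∈ A′ → w ≢ v
    ≢v p e = proj₂ (∈⁻ p) (∈⁺ e)

    disj′ : ∀ {a b w} → a ∈ A′ → b ∈ A′ → w ∈ bag a ⊎ (a ≡ u × w ∈ bag v) → w ∈ bag b ⊎ (b ≡ u × w ∈ bag v) → a ≡ b
    disj′ p q (inj₁ x) (inj₁ y) = bag-disj (old p) (old q) x y
    disj′ p q (inj₁ x) (inj₂ (_ , y)) = ⊥-elim (≢v p (bag-disj (old p) v∈ x y))
    disj′ p q (inj₂ (_ , x)) (inj₁ y) = ⊥-elim (≢v q (bag-disj (old q) v∈ y x))
    disj′ p q (inj₂ (e , x)) (inj₂ (e′ , y)) = trans e (sym e′)

    edge′ : ∀ {a b} → a ∈ A′ → b ∈ A′ → Adj a b → ∃ λ x → ∃ λ y → x ∈ bag′ a × y ∈ bag′ b × Edge Γ x y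
    edge′ p q (_ , inj₁ e) = let (x , y , x∈ , y∈ , f) = M-edge (old p) (old q) e in x , y , ∈⁺ (inj₁ x∈) , ∈⁺ (inj₁ y∈) , f
    edge′ p q (_ , inj₂ (inj₁ (a=u , e))) = let (x , y , x∈ , y∈ , f) = M-edge v∈ (old q) e in x , y , ∈⁺ (inj₂ (a=u , x∈)) , ∈⁺ (inj₁ y∈) , f
    edge′ p q (_ , inj₂ (inj₂ (b=u , e))) = let (x , y , x∈ , y∈ , f) = M-edge v∈ (old p) e in y , x , ∈⁺ (inj₁ y∈) , ∈⁺ (inj₂ (b=u , x∈)) , edge-sym f

  contract : Minor Γ U
  contract = record
    { alive = A′ ; M = M′ ; bag = bag′
    ; bag⊆ = λ p x → [ bag⊆ (old p) , (λ (_ , q) → bag⊆ v∈ q) ]′ (∈⁻ x)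
    ; self = λ p → ∈⁺ (inj₁ (self (old p))) ; bag-conn = conn′
    ; bag-disj = λ p q x y → disj′ p q (∈⁻ x) (∈⁻ y) ; M-edge = λ p q e → edge′ p q (graph⁻ e) }

  private
    Nw : VSet n
    Nw = ⟦ (λ x → (x ∈? A′) ×-dec ¬? (x ≟ u) ×-dec edge? M v x ×-dec ¬? (edge? M u x)) ⟧

    gained : e₂ M A′ + 2 * ⟪ Nw ⟫ ≤ e₂ M′ A′
    gained = ≤-trans (+-monoʳ-≤ (e₂ M A′) (≤-trans (≤-reflexive (cong (⟪ Nw ⟫ +_) (+-identityʳ _)))
        (≤-trans (‖row‖≥ u Nw ⊕ ≤-reflexive (sym (‖col‖ u Nw)))
          (‖‖-disj (row u Nw ⊎ᴿ col u Nw) (row u Nw) (col u Nw) (λ p → ∈⁺ (inj₁ p)) (λ p → ∈⁺ (inj₂ p))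
            (λ p q → let (i=u , _) = ∈⁻ p ; (_ , i∈) = ∈⁻ q in proj₁ (proj₂ (∈⁻ i∈)) i=u)))))
      (‖‖-disj (E M′ A′) (E M A′) (row u Nw ⊎ᴿ col u Nw)
        (λ p → let (a , b , e) = ∈⁻ p in ∈⁺ (a , b , graph⁺ (edge-≢ e , inj₁ e)))
        (λ p → [ fromRow , fromCol ]′ (∈⁻ p))
        (λ p q → let (a , b , e) = ∈⁻ p in [ notRow e , notCol e ]′ (∈⁻ q)))
      where
      u∈A′ : u ∈ A′
      u∈A′ = ∈⁺ (u∈ , λ q → edge-≢ uv (∈⁻ q))
      fromRow : ∀ {i j} → j ∈ row u Nw i → j ∈ E M′ A′ i
      fromRow p with ∈⁻ p
      ... | refl , j∈ = let (a , ne , e , _) = ∈⁻ j∈ in ∈⁺ (u∈A′ , a , graph⁺ ((λ q → ne (sym q)) , inj₂ (inj₁ (refl , e))))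
      fromCol : ∀ {i j} → j ∈ col u Nw i → j ∈ E M′ A′ i
      fromCol p with ∈⁻ p
      ... | refl , i∈ = let (a , ne , e , _) = ∈⁻ i∈ in ∈⁺ (a , u∈A′ , graph⁺ (ne , inj₂ (inj₂ (refl , e))))
      notRow : ∀ {i j} → Edge M i j → j ∈ row u Nw i → ⊥
      notRow e p with ∈⁻ p
      ... | refl , j∈ = let (_ , _ , _ , ne) = ∈⁻ j∈ in ne e
      notCol : ∀ {i j} → Edge M i j → j ∈ col u Nw i → ⊥
      notCol e p with ∈⁻ p
      ... | refl , i∈ = let (_ , _ , _ , ne) = ∈⁻ i∈ in ne (edge-sym e)

    deg-v : deg M alive v ≤ ⟪ Nw ⟫ + suc (codeg M alive u v)
    deg-v = ≤-trans (∣∣-∪ (N M v ∩ alive) Nw (⁅ u ⁆ ∪ (N M u ∩ (N M v ∩ alive))) (λ {x} p → let (a , b) = ∈⁻ p in case x (∈⁻ a) b (x ≟ u) (edge? M u x)))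
      (+-monoʳ-≤ ⟪ Nw ⟫ (≤-trans (∣∣-∪ (⁅ u ⁆ ∪ (N M u ∩ (N M v ∩ alive))) ⁅ u ⁆ (N M u ∩ (N M v ∩ alive)) ∈⁻) (+-monoˡ-≤ _ (∣⁅⁆∣ u))))
      where
      case : ∀ x → Edge M v x → x ∈ alive → Dec (x ≡ u) → Dec (Edge M u x) → x ∈ Nw ⊎ x ∈ ⁅ u ⁆ ∪ (N M u ∩ (N M v ∩ alive))
      case x e a (yes p) _ = inj₂ (∈⁺ (inj₁ (∈⁺ p)))
      case x e a (no p) (yes f) = inj₂ (∈⁺ (inj₂ (∈⁺ (∈⁺ f , ∈⁺ (∈⁺ e , a)))))
      case x e a (no p) (no f) = inj₁ (∈⁺ (∈⁺ (a , λ q → edge-≢ e (sym (∈⁻ q))) , p , e , f))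

  -- Contraction loses the edge `uv` and one edge for each common neighbour; the other edges at `v`
  -- move to `u` as the pairs with `Nw`. Everything is doubled in `e₂`.
  contract-e₂ : e₂ M alive ≤ e₂ (Minor.M contract) (Minor.alive contract) + 2 * suc (codeg M alive u v)
  contract-e₂ = arith (e₂ M alive) (e₂ M A′) (e₂ M′ A′) (deg M alive v) ⟪ Nw ⟫ (codeg M alive u v) (e₂-remove M alive v) deg-v gained
    where
    arith : ∀ e e₁ e′ d w c → e ≤ e₁ + 2 * d → d ≤ w + suc c → e₁ + 2 * w ≤ e′ → e ≤ e′ + 2 * suc c
    arith e e₁ e′ d w c a b f = linear 0 (a ⊕ 2 ⊗ b ⊕ f) (solve (e ∷ e₁ ∷ e′ ∷ d ∷ w ∷ c ∷ []))

delete-e₂≥ : (Γ : Graph n) (U : VSet n) (x y : Fin n) → e₂ Γ U ≤ e₂ (delete Γ x y) U + 2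
delete-e₂≥ Γ U x y = ≤-trans (‖‖-∪ (E Γ U) (E (delete Γ x y) U) (row x ⁅ y ⁆ ⊎ᴿ row y ⁅ x ⁆) (λ p → let (a , b , e) = ∈⁻ p in
      [ (λ f → inj₁ (∈⁺ (a , b , f))) , (λ c → inj₂ (∈⁺ ([ (λ (i , j) → inj₁ (∈⁺ (i , ∈⁺ j))) , (λ (i , j) → inj₂ (∈⁺ (i , ∈⁺ j))) ]′ c))) ]′ (deleted Γ x y e)))
  (+-monoʳ-≤ (e₂ (delete Γ x y) U) (≤-trans (‖‖-∪ (row x ⁅ y ⁆ ⊎ᴿ row y ⁅ x ⁆) (row x ⁅ y ⁆) (row y ⁅ x ⁆) ∈⁻)
    (≤-trans (‖row‖≤ x ⁅ y ⁆) (∣⁅⁆∣ y) ⊕ ≤-trans (‖row‖≤ y ⁅ x ⁆) (∣⁅⁆∣ x))))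

-- What minimality under `2d∣alive∣ ≤ e₂ + k` leaves: an edge in fewer than `d` triangles could be
-- contracted, an isolated vertex removed, and an edge deleted if `sparse` failed.
record Locally (d k : ℕ) {Γ : Graph n} {U : VSet n} (μ : Minor Γ U) : Set where
  open Minor μ
  field
    triangles : ∀ {u v} → u ∈ alive → v ∈ alive → Edge M u v → d ≤ codeg M alive u v
    neighbour : ∀ {v} → v ∈ alive → ∃ λ u → u ∈ alive × Edge M v u
    sparse    : e₂ M alive + k < 2 * d * ⟪ alive ⟫ + 2

-- Mader's contraction argument. The gap inequality says that no graph on h vertices satisfies the edge bound,
-- so contractions starting above h vertices never reach h.
module Condense {Γ : Graph n} {U : VSet n} (d k h : ℕ) (gap : h * h + k < 2 * d * h) where
  open Minor

  private
    Bound : Minor Γ U → Set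
    Bound μ = 2 * d * ⟪ alive μ ⟫ ≤ e₂ (M μ) (alive μ) + k

    stay-above : ∀ μ → Bound μ → h ≤ ⟪ alive μ ⟫ → h < ⟪ alive μ ⟫
    stay-above μ b le = ≤∧≢⇒< le λ { refl → <⇒≱ gap (≤-trans b (+-monoˡ-≤ k (e₂≤square (M μ) (alive μ)))) }

    Result : Minor Γ U → Set
    Result μ = ∃ λ (ν : Minor Γ U) → ⟪ alive ν ⟫ ≤ ⟪ alive μ ⟫ × h < ⟪ alive ν ⟫ × Locally d k ν

    -- Lexicographic recursion: contraction and removal lower the number of vertices and reset `f₂`;
    -- deletion lowers `e₂` alone.
    loop : ∀ f₁ f₂ μ → ⟪ alive μ ⟫ ≤ f₁ → e₂ (M μ) (alive μ) ≤ f₂ → h < ⟪ alive μ ⟫ → Bound μ → Result μ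
    loop f₁ f₂ μ le₁ le₂ hi b
      with any? (λ u → any? (λ v → (u ∈? alive μ) ×-dec (v ∈? alive μ) ×-dec edge? (M μ) u v ×-dec (codeg (M μ) (alive μ) u v <? d)))
         | any? (λ v → (v ∈? alive μ) ×-dec ¬? (any? (λ u → (u ∈? alive μ) ×-dec edge? (M μ) v u)))
         | e₂ (M μ) (alive μ) + k <? 2 * d * ⟪ alive μ ⟫ + 2
    loop zero f₂ μ le₁ le₂ hi b | yes _ | _ | _ = ⊥-elim (<⇒≱ (≤-<-trans z≤n hi) le₁)
    loop zero f₂ μ le₁ le₂ hi b | no _ | yes _ | _ = ⊥-elim (<⇒≱ (≤-<-trans z≤n hi) le₁)
    loop (suc f₁) f₂ μ le₁ le₂ hi b | yes (u , v , u∈ , v∈ , e , low) | _ | _ =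
      let (ν , small , rest) = loop f₁ _ ν₀ (s≤s⁻¹ (≤-trans drop le₁)) ≤-refl (stay-above ν₀ b′ (s≤s⁻¹ (≤-trans hi (∣∖⁅⁆∣ (alive μ) v)))) b′
      in ν , ≤-trans small (<⇒≤ drop) , rest
      where
      open Contract μ u v u∈ v∈ e
      ν₀ = contract
      drop = ∣∣-remove (alive μ) v v∈
      -- With fewer than `d` common neighbours the loss `2 * suc c` is at most `2 * d`, the amount
      -- by which the requirement drops.
      arith : ∀ a a′ e e′ c → suc a′ ≤ a → 2 * d * a ≤ e + k → e ≤ e′ + 2 * suc c → c < d → 2 * d * a′ ≤ e′ + k
      arith a a′ e e′ c p q r s = linear 0 ((2 * d) ⊗ p ⊕ q ⊕ r ⊕ 2 ⊗ s) (solve (a ∷ a′ ∷ e ∷ e′ ∷ c ∷ d ∷ k ∷ []))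
      b′ : Bound ν₀
      b′ = arith ⟪ alive μ ⟫ ⟪ alive ν₀ ⟫ (e₂ (M μ) (alive μ)) (e₂ (M ν₀) (alive ν₀)) (codeg (M μ) (alive μ) u v) drop b contract-e₂ low
    loop (suc f₁) f₂ μ le₁ le₂ hi b | no _ | yes (v , v∈ , iso) | _ =
      let (ν , small , rest) = loop f₁ _ ν₀ (s≤s⁻¹ (≤-trans drop le₁)) ≤-refl (stay-above ν₀ b′ (s≤s⁻¹ (≤-trans hi (∣∖⁅⁆∣ (alive μ) v)))) b′
      in ν , ≤-trans small (<⇒≤ drop) , rest
      where
      ν₀ = restrict μ (alive μ ∖ ⁅ v ⁆) (λ p → proj₁ (∈⁻ p))
      drop = ∣∣-remove (alive μ) v v∈
      deg≡0 : deg (M μ) (alive μ) v ≤ 0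
      deg≡0 = ≮⇒≥ λ lt → let (u , p) = ∣∣>0⇒∃ (N (M μ) v ∩ alive μ) lt ; (e , u∈) = ∈⁻ p in iso (u , u∈ , ∈⁻ e)
      b′ : Bound ν₀
      b′ = ≤-trans ((2 * d) ⊗ ≤-trans (n≤1+n _) drop) (≤-trans b (+-monoˡ-≤ k (≤-trans (e₂-remove (M μ) (alive μ) v) (≤-trans (+-monoʳ-≤ (e₂ (M μ) (alive ν₀)) (2 ⊗ deg≡0)) (≤-reflexive (+-identityʳ _))))))
    loop f₁ f₂ μ le₁ le₂ hi b | no ¬low | no ¬iso | yes sp = μ , ≤-refl , hi , record
      { triangles = λ {u} {v} p q e → ≮⇒≥ λ lt → ¬low (u , v , p , q , e , lt)
      ; neighbour = neighbour ; sparse = sp }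
      where
      neighbour : ∀ {v} → v ∈ alive μ → ∃ λ u → u ∈ alive μ × Edge (M μ) v u
      neighbour {v} p with any? (λ u → (u ∈? alive μ) ×-dec edge? (M μ) v u)
      ... | yes q = q
      ... | no ¬q = ⊥-elim (¬iso (v , p , ¬q))
    loop f₁ f₂ μ le₁ le₂ hi b | no _ | no ¬iso | no dense with ∣∣>0⇒∃ (alive μ) (≤-<-trans z≤n hi)
    ... | (v , v∈) with any? (λ u → (u ∈? alive μ) ×-dec edge? (M μ) v u)
    ...   | no iso = ⊥-elim (¬iso (v , v∈ , iso))
    loop f₁ zero μ le₁ le₂ hi b | no _ | no ¬iso | no dense | (v , v∈) | yes (u , u∈ , e) = ⊥-elim (<⇒≱ (≤-<-trans z≤n (delete-e₂ (M μ) v u (alive μ) v∈ u∈ e)) le₂)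
    loop f₁ (suc f₂) μ le₁ le₂ hi b | no _ | no ¬iso | no dense | (v , v∈) | yes (u , u∈ , e) =
      loop f₁ f₂ (weaken μ (delete (M μ) v u) (delete⊑ (M μ) v u)) le₁ (s≤s⁻¹ (≤-trans (delete-e₂ (M μ) v u (alive μ) v∈ u∈ e) le₂)) hi
        (arith (2 * d * ⟪ alive μ ⟫) (e₂ (M μ) (alive μ)) (e₂ (delete (M μ) v u) (alive μ)) (≮⇒≥ dense) (delete-e₂≥ (M μ) (alive μ) v u))
      where
      arith : ∀ a e e′ → a + 2 ≤ e + k → e ≤ e′ + 2 → a ≤ e′ + k
      arith a e e′ p q = linear 0 (p ⊕ q) (solve (a ∷ e ∷ e′ ∷ k ∷ []))

  condense : ∀ μ → h < ⟪ alive μ ⟫ → 2 * d * ⟪ alive μ ⟫ ≤ e₂ (M μ) (alive μ) + k →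
    ∃ λ (ν : Minor Γ U) → ⟪ alive ν ⟫ ≤ ⟪ alive μ ⟫ × h < ⟪ alive ν ⟫ × Locally d k ν
  condense μ = loop _ _ μ ≤-refl ≤-refl

-- Some vertex has degree below the average bound `b`. Its neighbourhood is small, and each edge to
-- it lies in `d` triangles, which become degrees inside the neighbourhood.
neighbourhood : ∀ {d k} (b : ℕ) {Γ : Graph n} {U : VSet n} (μ : Minor Γ U) → Locally d k μ → e₂ (Minor.M μ) (Minor.alive μ) < b * ⟪ Minor.alive μ ⟫ →
  ∃ λ (ν : Minor Γ U) → ⟪ Minor.alive ν ⟫ < b × (∃ λ v → v ∈ Minor.alive ν) × (∀ {v} → v ∈ Minor.alive ν → d ≤ deg (Minor.M ν) (Minor.alive ν) v)
neighbourhood b μ loc lt with low-degree M alive b lt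
  where open Minor μ
... | v , v∈ , low = restrict μ (N M v ∩ alive) (λ p → proj₂ (∈⁻ p)) , low ,
        (let (u , u∈ , e) = neighbour v∈ in u , ∈⁺ (∈⁺ e , u∈)) , λ p → let (e , u∈) = ∈⁻ p in triangles u∈ v∈ (edge-sym (∈⁻ e))
  where
  open Minor μ
  open Locally loc

-- The margin `2 · 16c - 31c = c` is the number of common neighbours of any two vertices.
record Dense (c : ℕ) {Γ : Graph n} {U : VSet n} (μ : Minor Γ U) : Set where
  open Minor μ
  field
    size-≤ : ⟪ alive ⟫ ≤ 31 * c
    deg-≥  : ∀ {v} → v ∈ alive → 16 * c ≤ deg M alive v
    size-≥ : 16 * c ≤ ⟪ alive ⟫

private module Constants (c : ℕ) (1≤c : 1 ≤ c) where
  1≤cc : 1 ≤ c * c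
  1≤cc = *-mono-≤ 1≤c 1≤c

  gap₁ : 1 * 1 + 0 < 2 * (32 * c) * 1
  gap₁ = linear 62 (64 ⊗ 1≤c) (solve (c ∷ []))

  gap₂ : 16 * c * (16 * c) + 128 * (c * c) < 2 * (16 * c) * (16 * c)
  gap₂ = linear 127 (128 ⊗ 1≤cc) (solve (c ∷ []))

  degree₁ : ∀ a e → 1 < a → e + 0 < 2 * (32 * c) * a + 2 → e < (64 * c + 1) * a
  degree₁ a e p q = linear 0 (p ⊕ q) (solve (a ∷ e ∷ c ∷ []))

  -- As `c a ≤ 64c²`, the surplus `128c²` pulls the average degree from `32c` below `31c + 1`.
  degree₂ : ∀ a e → a ≤ 64 * c → e + 128 * (c * c) < 2 * (16 * c) * a + 2 → e < (31 * c + 1) * a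
  degree₂ a e le lt = linear (a + 62) (lt ⊕ c ⊗ le ⊕ 64 ⊗ 1≤cc) (solve (a ∷ e ∷ c ∷ []))

  more : ∀ {a} → 32 * c ≤ a → 16 * c < a
  more {a} h = linear 15 (h ⊕ 16 ⊗ 1≤c) (solve (a ∷ c ∷ []))

  twice₁ : ∀ u → 2 * (32 * c) * u ≡ 64 * c * u
  twice₁ u = solve (c ∷ u ∷ [])

  twice₂ : ∀ u → 2 * (16 * c) * u ≡ 32 * c * u
  twice₂ u = solve (c ∷ u ∷ [])

-- One round gives order at most `64c` with degrees at least `32c`, only about half the order, too
-- little for common neighbours. The bounded order makes a second round with surplus `128c²`
-- possible, which gains the missing `c`.
dense-minor : (c : ℕ) → 1 ≤ c → (Γ : Graph n) (U : VSet n) → 1 < ⟪ U ⟫ → 64 * c * ⟪ U ⟫ ≤ e₂ Γ U → ∃ λ (μ : Minor Γ U) → Dense c μ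
dense-minor {n} c 1≤c Γ U 1<U rich = stage₁ (Condense.condense (32 * c) 0 1 gap₁ (trivial-minor Γ U) 1<U (≤-trans (≤-reflexive (twice₁ ⟪ U ⟫)) (≤-trans rich (m≤m+n _ 0))))
  where
  open Minor
  open Constants c 1≤c

  stage₂ : (μ : Minor Γ U) → ⟪ alive μ ⟫ ≤ 64 * c → (∃ λ (ν : Minor Γ U) → ⟪ alive ν ⟫ ≤ ⟪ alive μ ⟫ × 16 * c < ⟪ alive ν ⟫ × Locally (16 * c) (128 * (c * c)) ν) →
    ∃ λ (μ : Minor Γ U) → Dense c μ
  stage₂ μ le (ν , small , big , loc) =
    let (ρ , s , (v , v∈) , δ) = neighbourhood (31 * c + 1) ν loc (degree₂ ⟪ alive ν ⟫ (e₂ (M ν) (alive ν)) (≤-trans small le) (Locally.sparse loc))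
    in ρ , record { size-≤ = s≤s⁻¹ (≤-trans s (≤-reflexive (+-comm _ 1))) ; deg-≥ = δ ; size-≥ = ≤-trans (δ v∈) (∣∣-mono (λ p → proj₂ (∈⁻ p))) }

  stage₁ : (∃ λ (ν : Minor Γ U) → ⟪ alive ν ⟫ ≤ ⟪ U ⟫ × 1 < ⟪ alive ν ⟫ × Locally (32 * c) 0 ν) → ∃ λ (μ : Minor Γ U) → Dense c μ
  stage₁ (ν , _ , 1<ν , loc) =
    let (ρ , s , (v , v∈) , δ) = neighbourhood (64 * c + 1) ν loc (degree₁ ⟪ alive ν ⟫ (e₂ (M ν) (alive ν)) 1<ν (Locally.sparse loc))
    in stage₂ ρ (s≤s⁻¹ (≤-trans s (≤-reflexive (+-comm _ 1)))) (Condense.condense (16 * c) (128 * (c * c)) (16 * c) gap₂ ρ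
          (more (≤-trans (δ v∈) (∣∣-mono (λ p → proj₂ (∈⁻ p)))))
          (≤-trans (≤-reflexive (twice₂ ⟪ alive ρ ⟫)) (≤-trans (e₂≥ (M ρ) (alive ρ) (32 * c) δ) (m≤m+n _ _))))

-- Rooting a dense minor at prescribed vertices

-- The initial segment of a path up to its first vertex in `T`, kept as a connected set.
record Stub (Γ : Graph n) (Z T : VSet n) (u : Fin n) : Set where
  field
    stub : VSet n
    stub⊆ : stub ⊆ Z
    stub-conn : Conn Γ stub
    start∈ : u ∈ stub
    end : Fin n
    end∈ : end ∈ stub
    end∈T : end ∈ T
    end-only : ∀ {v} → v ∈ stub → v ∈ T → v ≡ end

truncate : {Γ : Graph n} {Z T : VSet n} {u v : Fin n} → Path Γ Z u v → v ∈ T → Stub Γ Z T u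
truncate {Γ = Γ} {Z} {T} {u} p t = case p (u ∈? T)
  where
  case : Path Γ Z u _ → Dec (u ∈ T) → Stub Γ Z T u
  case p (yes u∈T) = record { stub = ⁅ u ⁆ ; stub⊆ = λ q → subst (_∈ Z) (sym (∈⁻ q)) (path-start p) ; stub-conn = conn-⁅⁆
    ; start∈ = ∈⁺ refl ; end = u ; end∈ = ∈⁺ refl ; end∈T = u∈T ; end-only = λ q _ → ∈⁻ q }
  case [ _ ]ₚ (no u∉T) = ⊥-elim (u∉T t)
  case (cons u∈ e p) (no u∉T) = record { stub = ⁅ u ⁆ ∪ stub ; stub⊆ = λ q → [ (λ r → subst (_∈ Z) (sym (∈⁻ r)) u∈) , stub⊆ ]′ (∈⁻ q)
    ; stub-conn = conn-∪ conn-⁅⁆ stub-conn (∈⁺ refl) start∈ (inj₂ e) ; start∈ = ∈⁺ (inj₁ (∈⁺ refl)) ; end = end ; end∈ = ∈⁺ (inj₂ end∈)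
    ; end∈T = end∈T ; end-only = λ q r → [ (λ s → ⊥-elim (u∉T (subst (_∈ T) (∈⁻ s) r))) , (λ s → end-only s r) ]′ (∈⁻ q) }
    where open Stub (truncate p t)

_[_≔_] : ∀ {A : Set} {p} → (Fin p → A) → Fin p → A → Fin p → A
(f [ i ≔ a ]) j with j ≟ i
... | yes _ = a
... | no _  = f j

update-elim : ∀ {A : Set} {p} (f : Fin p → A) (i : Fin p) (a : A) (C : Fin p → A → Set) → C i a → (∀ j → j ≢ i → C j (f j)) → ∀ j → C j ((f [ i ≔ a ]) j)
update-elim f i a C ci cj j with j ≟ i
... | yes refl = ci
... | no ne    = cj j ne

record Fan (Γ : Graph n) (U D : VSet n) (bag : Fin n → VSet n) (p : ℕ) (src : Fin p → Fin n) : Set where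
  field
    Z      : Fin p → VSet n
    τ      : Fin p → Fin n
    Z⊆     : ∀ i → Z i ⊆ U
    Z-conn : ∀ i → Conn Γ (Z i)
    src∈   : ∀ i → src i ∈ Z i
    τ∈     : ∀ i → τ i ∈ D
    meets  : ∀ i → ∃ λ w → w ∈ Z i × w ∈ bag (τ i)
    Z-disj : ∀ i j {v} → v ∈ Z i → v ∈ Z j → i ≡ j
    τ-inj  : ∀ i j → τ i ≡ τ j → i ≡ j

module _ {Γ : Graph n} {U D : VSet n} {bag : Fin n → VSet n} {p : ℕ} {src : Fin p → Fin n}
  (bag-disj : ∀ {u v w} → u ∈ D → v ∈ D → w ∈ bag u → w ∈ bag v → u ≡ v) where

  private
    Fan′ = Fan Γ U D bag p src

    replace : (F : Fan′) (i : Fin p) (Z′ : VSet n) (t : Fin n) → Z′ ⊆ Fan.Z F i → Conn Γ Z′ → src i ∈ Z′ → t ∈ D →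
      (∃ λ w → w ∈ Z′ × w ∈ bag t) → (∀ j → j ≢ i → Fan.τ F j ≢ t) → Fan′
    replace F i Z′ t Z′⊆ conn s t∈ m fresh = record
      { Z = Z [ i ≔ Z′ ] ; τ = τ [ i ≔ t ]
      ; Z⊆ = update-elim Z i Z′ (λ _ A → A ⊆ U) (λ q → Z⊆ i (Z′⊆ q)) (λ j _ → Z⊆ j)
      ; Z-conn = update-elim Z i Z′ (λ _ A → Conn Γ A) conn (λ j _ → Z-conn j)
      ; src∈ = update-elim Z i Z′ (λ j A → src j ∈ A) s (λ j _ → src∈ j)
      ; τ∈ = update-elim τ i t (λ _ a → a ∈ D) t∈ (λ j _ → τ∈ j)
      ; meets = both
      ; Z-disj = λ j k v v′ → Z-disj j k (shrink j v) (shrink k v′)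
      ; τ-inj = τ-inj′ }
      where
      open Fan F
      shrink : ∀ j → (Z [ i ≔ Z′ ]) j ⊆ Z j
      shrink = update-elim Z i Z′ (λ j A → A ⊆ Z j) Z′⊆ (λ j _ q → q)
      both : ∀ j → ∃ λ w → w ∈ (Z [ i ≔ Z′ ]) j × w ∈ bag ((τ [ i ≔ t ]) j)
      both j with j ≟ i
      ... | yes refl = m
      ... | no _     = meets j
      τ-inj′ : ∀ j k → (τ [ i ≔ t ]) j ≡ (τ [ i ≔ t ]) k → j ≡ k
      τ-inj′ j k with j ≟ i | k ≟ i
      ... | yes a | yes b = λ _ → trans a (sym b)
      ... | yes a | no b  = λ e → ⊥-elim (fresh k b (sym e))
      ... | no a  | yes b = λ e → ⊥-elim (fresh j a e)
      ... | no a  | no b  = τ-inj j k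

    weight : Fan′ → ℕ
    weight F = ∑ (λ i → ⟪ Fan.Z F i ⟫)

    replace-weight : ∀ F i Z′ t (a : Z′ ⊆ Fan.Z F i) (b : Conn Γ Z′) c d e f {z} → z ∈ Fan.Z F i → z ∉ Z′ → weight (replace F i Z′ t a b c d e f) < weight F
    replace-weight F i Z′ t Z′⊆ b c d e f {z} z∈ z∉ = ∑-mono-< (update-elim Z i Z′ (λ j A → ⟪ A ⟫ ≤ ⟪ Z j ⟫) (<⇒≤ less) (λ j _ → ≤-refl))
      i (update-elim Z i Z′ (λ j A → j ≡ i → ⟪ A ⟫ < ⟪ Z j ⟫) (λ _ → less) (λ j ne e → ⊥-elim (ne e)) i refl)
      where
      open Fan F
      less : ⟪ Z′ ⟫ < ⟪ Z i ⟫
      less = ≤-trans (s≤s (∣∣-mono λ {v} q → ∈⁺ (Z′⊆ q , λ r → z∉ (subst (_∈ Z′) (∈⁻ r) q)))) (∣∣-remove (Z i) z z∈)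

    Touch : Fan′ → Set
    Touch F = ∃ λ i → ∃ λ w → w ∈ D × (¬ ∃ λ j → Fan.τ F j ≡ w) × ∃ λ z → z ∈ Fan.Z F i × z ∈ bag w

    -- A fan that touches an unused bag w can be cut short, ending in w or in its old bag.
    shorten : (F : Fan′) → Touch F → ∃ λ F′ → weight F′ < weight F
    shorten F (i , w , w∈ , free , z , z∈Z , z∈w) = case (∈⁻ end∈T)
      where
      open Fan F
      open Stub (truncate {T = bag (τ i) ∪ bag w} (Z-conn i (src∈ i) z∈Z) (∈⁺ (inj₂ z∈w)))
      case : end ∈ bag (τ i) ⊎ end ∈ bag w → ∃ λ F′ → weight F′ < weight F
      case (inj₁ e) = replace F i stub (τ i) stub⊆ stub-conn start∈ (τ∈ i) (end , end∈ , e) (λ j ne eq → ne (τ-inj j i eq)) ,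
        replace-weight F i stub (τ i) stub⊆ stub-conn start∈ (τ∈ i) (end , end∈ , e) (λ j ne eq → ne (τ-inj j i eq)) z∈Z
          (λ q → free (i , bag-disj (τ∈ i) w∈ (subst (_∈ bag (τ i)) (sym (end-only q (∈⁺ (inj₂ z∈w)))) e) z∈w))
      case (inj₂ e) = let (m , m∈Z , m∈τ) = meets i in
        replace F i stub w stub⊆ stub-conn start∈ w∈ (end , end∈ , e) (λ j _ eq → free (j , eq)) ,
        replace-weight F i stub w stub⊆ stub-conn start∈ w∈ (end , end∈ , e) (λ j _ eq → free (j , eq)) m∈Z
          (λ q → free (i , bag-disj (τ∈ i) w∈ (subst (_∈ bag (τ i)) (end-only q (∈⁺ (inj₁ m∈τ))) m∈τ) e))

    touch? : ∀ F → Dec (Touch F)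
    touch? F = any? λ i → any? λ w → (w ∈? D) ×-dec ¬? (any? λ j → Fan.τ F j ≟ w) ×-dec any? λ z → (z ∈? Fan.Z F i) ×-dec (z ∈? bag w)

    minimise : ∀ f F → weight F ≤ f → ∃ λ F′ → ¬ Touch F′
    minimise f F le with touch? F
    ... | no ¬t = F , ¬t
    minimise zero    F le | yes t = let (F′ , lt) = shorten F t in ⊥-elim (<⇒≱ lt (≤-trans le z≤n))
    minimise (suc f) F le | yes t = let (F′ , lt) = shorten F t in minimise f F′ (s≤s⁻¹ (≤-trans lt le))

  tight-fan : Fan′ → ∃ λ (F : Fan′) → ∀ {i w z} → w ∈ D → z ∈ Fan.Z F i → z ∈ bag w → ∃ λ j → Fan.τ F j ≡ w
  tight-fan F = let (F′ , ¬t) = minimise _ F ≤-refl in F′ , λ {i} {w} {z} w∈ z∈Z z∈w → case F′ ¬t w∈ z∈Z z∈w (any? λ j → Fan.τ F′ j ≟ w)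
    where
    case : ∀ F′ → ¬ Touch F′ → ∀ {i w z} → w ∈ D → z ∈ Fan.Z F′ i → z ∈ bag w → Dec (∃ λ j → Fan.τ F′ j ≡ w) → ∃ λ j → Fan.τ F′ j ≡ w
    case F′ ¬t w∈ z∈Z z∈w (yes q) = q
    case F′ ¬t {i} {w} {z} w∈ z∈Z z∈w (no ¬q) = ⊥-elim (¬t (i , w , w∈ , ¬q , z , z∈Z , z∈w))

-- Contracting the bags of R and keeping every other vertex of U.
module Quotient {Γ : Graph n} {U : VSet n} (μ : Minor Γ U) (R : VSet n) (R⊆ : R ⊆ Minor.alive μ) where
  open Minor μ

  plain : VSet n
  plain = ⟦ (λ v → (v ∈? U) ×-dec ¬? (any? λ r → (r ∈? R) ×-dec (v ∈? bag r))) ⟧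

  bag₂ : Fin n → VSet n
  bag₂ v = ⟦ (λ x → ((v ∈? R) ×-dec (x ∈? bag v)) ⊎-dec (¬? (v ∈? R) ×-dec (x ≟ v))) ⟧

  private
    Adj : Fin n → Fin n → Set
    Adj a b = a ≢ b × ∃ λ x → ∃ λ y → x ∈ bag₂ a × y ∈ bag₂ b × Edge Γ x y

    adj? : ∀ a b → Dec (Adj a b)
    adj? a b = ¬? (a ≟ b) ×-dec any? λ x → any? λ y → (x ∈? bag₂ a) ×-dec (y ∈? bag₂ b) ×-dec edge? Γ x y

  M₂ : Graph n
  M₂ = graph adj? (λ (ne , x , y , x∈ , y∈ , e) → (λ q → ne (sym q)) , y , x , y∈ , x∈ , edge-sym e) (λ (ne , _) → ne refl)

  plain∉R : ∀ {v} → v ∈ plain → v ∉ R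
  plain∉R {v} p r = proj₂ (∈⁻ p) (v , r , self (R⊆ r))

  bag₂-R : ∀ {v x} → v ∈ R → x ∈ bag v → x ∈ bag₂ v
  bag₂-R r x = ∈⁺ (inj₁ (r , x))

  bag₂-R⁻ : ∀ {v x} → v ∈ R → x ∈ bag₂ v → x ∈ bag v
  bag₂-R⁻ r x = [ proj₂ , (λ (¬r , _) → ⊥-elim (¬r r)) ]′ (∈⁻ x)

  bag₂-plain : ∀ {v} → v ∈ plain → v ∈ bag₂ v
  bag₂-plain p = ∈⁺ (inj₂ (plain∉R p , refl))

  bag₂-plain⁻ : ∀ {v x} → v ∈ plain → x ∈ bag₂ v → x ≡ v
  bag₂-plain⁻ p x = [ (λ (r , _) → ⊥-elim (plain∉R p r)) , proj₂ ]′ (∈⁻ x)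

  plain-edge : ∀ {a b} → a ∈ plain → b ∈ plain → Edge Γ a b → Edge M₂ a b
  plain-edge p q e = graph⁺ (edge-≢ e , _ , _ , bag₂-plain p , bag₂-plain q , e)

  mixed-edge : ∀ {a r b} → a ∈ plain → r ∈ R → b ∈ bag r → Edge Γ a b → Edge M₂ a r
  mixed-edge {a} p r b e = graph⁺ ((λ { refl → plain∉R p r }) , _ , _ , bag₂-plain p , bag₂-R r b , e)

  quotient : Minor Γ U
  quotient = record
    { alive = R ∪ plain ; M = M₂ ; bag = bag₂
    ; bag⊆ = λ p x → [ (λ r → bag⊆ (R⊆ r) (bag₂-R⁻ r x)) , (λ q → subst (_∈ U) (sym (bag₂-plain⁻ q x)) (proj₁ (∈⁻ q))) ]′ (∈⁻ p)
    ; self = λ p → [ (λ r → bag₂-R r (self (R⊆ r))) , bag₂-plain ]′ (∈⁻ p)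
    ; bag-conn = λ p → [ conn-R , conn-plain ]′ (∈⁻ p)
    ; bag-disj = λ p q x y → disj (∈⁻ p) (∈⁻ q) x y
    ; M-edge = λ _ _ e → proj₂ (graph⁻ e) }
    where
    conn-R : ∀ {v} → v ∈ R → Conn Γ (bag₂ v)
    conn-R r x y = path-mono (λ e → e) (bag₂-R r) (bag-conn (R⊆ r) (bag₂-R⁻ r x) (bag₂-R⁻ r y))
    conn-plain : ∀ {v} → v ∈ plain → Conn Γ (bag₂ v)
    conn-plain {v} p x y with refl ← bag₂-plain⁻ p x | refl ← bag₂-plain⁻ p y = [ x ]ₚ
    disj : ∀ {u v w} → u ∈ R ⊎ u ∈ plain → v ∈ R ⊎ v ∈ plain → w ∈ bag₂ u → w ∈ bag₂ v → u ≡ v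
    disj (inj₁ r) (inj₁ r′) x y = bag-disj (R⊆ r) (R⊆ r′) (bag₂-R⁻ r x) (bag₂-R⁻ r′ y)
    disj (inj₁ r) (inj₂ p) x y with refl ← bag₂-plain⁻ p y = ⊥-elim (proj₂ (∈⁻ p) (_ , r , bag₂-R⁻ r x))
    disj (inj₂ p) (inj₁ r) x y with refl ← bag₂-plain⁻ p x = ⊥-elim (proj₂ (∈⁻ p) (_ , r , bag₂-R⁻ r y))
    disj (inj₂ p) (inj₂ p′) x y = trans (sym (bag₂-plain⁻ p x)) (bag₂-plain⁻ p′ y)

  -- Since `Z i` meets `R` only in its end, the bag of that end can swallow all of `Z i`, including
  -- its start in `X`, and stay disjoint from the other bags.
  module Absorb (X : VSet n) (q : ℕ) (L : Linkage M₂ (R ∪ plain) X R q) where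
    open Linkage L

    bag₃ : Fin n → VSet n
    bag₃ r = ⟦ (λ y → (y ∈? bag r) ⊎-dec (any? λ i → (r ∈? Z i) ×-dec (y ∈? lift quotient (Z i)))) ⟧

    private
      conn₃ : ∀ {r} → r ∈ R → Conn Γ (bag₃ r)
      conn₃ {r} r∈ = case (any? λ i → r ∈? Z i)
        where
        case : Dec (∃ λ i → r ∈ Z i) → Conn Γ (bag₃ r)
        case (no ¬i) x y = path-mono (λ e → e) (λ w → ∈⁺ (inj₁ w)) (bag-conn (R⊆ r∈) (only x) (only y))
          where
          only : ∀ {x} → x ∈ bag₃ r → x ∈ bag r
          only x = [ (λ w → w) , (λ (i , p , _) → ⊥-elim (¬i (i , p))) ]′ (∈⁻ x)
        case (yes (i , p)) x y = path-mono (λ e → e) (λ w → ∈⁺ (inj₂ (i , p , w))) (lift-conn quotient (Z⊆ i) (Z-conn i) (up x) (up y))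
          where
          up : ∀ {x} → x ∈ bag₃ r → x ∈ lift quotient (Z i)
          up x = [ (λ w → ∈⁺ (r , p , bag₂-R r∈ w)) , (λ (j , p′ , w) → subst (λ k → _ ∈ lift quotient (Z k)) (Z-disj p′ p) w) ]′ (∈⁻ x)

      disj₃ : ∀ {r r′ y} → r ∈ R → r′ ∈ R → y ∈ bag r ⊎ (∃ λ i → r ∈ Z i × y ∈ lift quotient (Z i)) → y ∈ bag r′ ⊎ (∃ λ i → r′ ∈ Z i × y ∈ lift quotient (Z i)) → r ≡ r′
      disj₃ r∈ r′∈ (inj₁ a) (inj₁ b) = bag-disj (R⊆ r∈) (R⊆ r′∈) a b
      disj₃ r∈ r′∈ (inj₁ a) (inj₂ (i , p , b)) = let (v , v∈ , w) = ∈⁻ b in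
        trans (tgt-only (subst (_∈ Z i) (Minor.bag-disj quotient (Z⊆ i v∈) (∈⁺ (inj₁ r∈)) w (bag₂-R r∈ a)) v∈) r∈) (sym (tgt-only p r′∈))
      disj₃ r∈ r′∈ (inj₂ (i , p , b)) (inj₁ a) = let (v , v∈ , w) = ∈⁻ b in
        trans (tgt-only p r∈) (sym (tgt-only (subst (_∈ Z i) (Minor.bag-disj quotient (Z⊆ i v∈) (∈⁺ (inj₁ r′∈)) w (bag₂-R r′∈ a)) v∈) r′∈))
      disj₃ {r} r∈ r′∈ (inj₂ (i , p , b)) (inj₂ (j , p′ , b′)) =
        let (v , v∈ , w) = ∈⁻ b ; (v′ , v′∈ , w′) = ∈⁻ b′
            same = Minor.bag-disj quotient (Z⊆ i v∈) (Z⊆ j v′∈) w w′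
        in trans (tgt-only (subst (λ k → r ∈ Z k) (Z-disj (subst (_∈ Z i) same v∈) v′∈) p) r∈) (sym (tgt-only p′ r′∈))

    absorb : Minor Γ U
    absorb = record
      { alive = R ; M = M ; bag = bag₃
      ; bag⊆ = λ r∈ x → [ bag⊆ (R⊆ r∈) , (λ (i , _ , w) → let (v , v∈ , z) = ∈⁻ w in Minor.bag⊆ quotient (Z⊆ i v∈) z) ]′ (∈⁻ x)
      ; self = λ r∈ → ∈⁺ (inj₁ (self (R⊆ r∈))) ; bag-conn = conn₃ ; bag-disj = λ p q x y → disj₃ p q (∈⁻ x) (∈⁻ y)
      ; M-edge = λ p q e → let (a , b , a∈ , b∈ , f) = M-edge (R⊆ p) (R⊆ q) e in a , b , ∈⁺ (inj₁ a∈) , ∈⁺ (inj₁ b∈) , f }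

    absorbed : X ⊆ plain → ∀ i → src i ∈ bag₃ (tgt i)
    absorbed X⊆ i = ∈⁺ (inj₂ (i , tgt∈Z i , ∈⁺ (src i , src∈Z i , bag₂-plain (X⊆ (src∈X i)))))

-- The neighbours of `v` are the boundary of `⁅ v ⁆`. If nothing lies beyond them, `v` is adjacent
-- to all of `U`, which has more than `K` vertices.
min-degree : {Γ : Graph n} {U : VSet n} {K : ℕ} → Connectivity Γ U K → ∀ {v} → v ∈ U → K ≤ deg Γ U v
min-degree {Γ = Γ} {U} {K} conn {v} v∈ with any? (λ b → (b ∈? U) ×-dec ¬? (b ∈? ⁅ v ⁆) ×-dec ¬? (b ∈? ∂ Γ U ⁅ v ⁆))
... | yes (b , b∈ , b∉ , b∉∂) = ≤-trans (boundary conn (λ p → subst (_∈ U) (sym (∈⁻ p)) v∈) (∈⁺ refl) b∈ b∉ b∉∂) (∣∣-mono nbr)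
  where
  nbr : ∂ Γ U ⁅ v ⁆ ⊆ (N Γ v ∩ U)
  nbr p = let (u∈ , _ , a , a∈ , e) = ∈⁻ p in ∈⁺ (∈⁺ (subst (λ a → Edge Γ a _) (∈⁻ a∈) e) , u∈)
... | no none = s≤s⁻¹ (≤-trans (large conn) (≤-trans (∣∣-∪ U ⁅ v ⁆ (N Γ v ∩ U) (λ {b} b∈ → case b∈ (b ≟ v) (edge? Γ v b))) (+-monoˡ-≤ _ (∣⁅⁆∣ v))))
  where
  case : ∀ {b} → b ∈ U → Dec (b ≡ v) → Dec (Edge Γ v b) → b ∈ ⁅ v ⁆ ⊎ b ∈ N Γ v ∩ U
  case b∈ (yes e) _ = inj₁ (∈⁺ e)
  case b∈ _ (yes e) = inj₂ (∈⁺ (∈⁺ e , b∈))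
  case {b} b∈ (no ne) (no ¬e) = ⊥-elim (none (b , b∈ , (λ p → ne (∈⁻ p)) , λ p → let (_ , _ , a , a∈ , e) = ∈⁻ p in ¬e (subst (λ a → Edge Γ a b) (∈⁻ a∈) e)))

-- The boundary of `P ∖ Q` lies in `P ∩ Q`. If a side has no vertex of its own, then `X` or `T` lies
-- in `P ∩ Q` instead.
no-separation : {Γ : Graph n} {U X T : VSet n} {K q : ℕ} → Connectivity Γ U K → q ≤ K → q ≤ ⟪ X ⟫ → q ≤ ⟪ T ⟫ → ¬ Separation Γ U X T q
no-separation {Γ = Γ} {U} conn q≤K q≤X q≤T sep with any? (λ a → (a ∈? P) ×-dec ¬? (a ∈? Q)) | any? (λ b → (b ∈? Q) ×-dec ¬? (b ∈? P))
  where open Separation sep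
... | no ¬a | _ = <⇒≱ small (≤-trans q≤X (∣∣-mono λ p → ∈⁺ (X⊆P p , ∈-stable λ ¬q → ¬a (_ , X⊆P p , ¬q))))
  where
  open Separation sep
... | yes _ | no ¬b = <⇒≱ small (≤-trans q≤T (∣∣-mono λ p → ∈⁺ ((∈-stable λ ¬q → ¬b (_ , T⊆Q p , ¬q)) , T⊆Q p)))
  where
  open Separation sep
... | yes (a , a∈ , a∉) | yes (b , b∈ , b∉) = <⇒≱ small (≤-trans q≤K (≤-trans
      (boundary conn {P ∖ Q} (λ p → P⊆ (proj₁ (∈⁻ p))) (∈⁺ (a∈ , a∉)) (Q⊆ b∈) (λ p → b∉ (proj₁ (∈⁻ p))) (λ p → b∉ (proj₁ (∈⁻ (∂⊆ p))))) (∣∣-mono ∂⊆)))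
  where
  open Separation sep
  ∂⊆ : ∂ Γ U (P ∖ Q) ⊆ (P ∩ Q)
  ∂⊆ {v} p = let (v∈ , v∉ , a , a∈ , e) = ∈⁻ p in case v∈ v∉ (∈⁻ a∈) e (v ∈? P) (v ∈? Q)
    where
    case : ∀ {v a} → v ∈ U → v ∉ P ∖ Q → a ∈ P × a ∉ Q → Edge Γ a v → Dec (v ∈ P) → Dec (v ∈ Q) → v ∈ P ∩ Q
    case v∈ v∉ a e (yes p) (yes q) = ∈⁺ (p , q)
    case v∈ v∉ a e (yes p) (no q) = ⊥-elim (v∉ (∈⁺ (p , q)))
    case v∈ v∉ (a , a′) e (no p) (yes q) = ⊥-elim (no-edge a a′ q p e)
    case v∈ v∉ a e (no p) (no q) = ⊥-elim ([ p , q ]′ (cover v∈))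

record Rooted {Γ : Graph n} {U : VSet n} (X : VSet n) (μ : Minor Γ U) : Set where
  field
    ν         : Minor Γ U
    alive⊆    : Minor.alive ν ⊆ Minor.alive μ
    M⊑        : Minor.M μ ⊑ Minor.M ν
    many      : ⟪ Minor.alive μ ⟫ ≤ ⟪ Minor.alive ν ⟫ + 3 * ⟪ X ⟫
    term root : Fin ⟪ X ⟫ → Fin n
    root∈     : ∀ i → root i ∈ Minor.alive ν
    root-inj  : ∀ {i j} → root i ≡ root j → i ≡ j
    term∈X    : ∀ i → term i ∈ X
    term∈bag  : ∀ i → term i ∈ Minor.bag ν (root i)
    term-onto : ∀ {x} → x ∈ X → ∃ λ i → term i ≡ x

-- Every vertex of X starts two fans Z i ∪ B i ending next to most of R. A vertex of a separator meets at most two fans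
-- (the Z i are disjoint, and so are the B i together with the starting vertices), so some fan avoids it.
module Unblocked {n} (Γ M₂ : Graph n) (plain R X : VSet n) (p q : ℕ)
  (plain-edge : ∀ {a b} → a ∈ plain → b ∈ plain → Edge Γ a b → Edge M₂ a b) (X⊆plain : X ⊆ plain)
  (Z B : Fin p → VSet n) (Z⊆ : ∀ i → Z i ⊆ plain) (B⊆ : ∀ i → B i ⊆ plain)
  (Z-conn : ∀ i → Conn Γ (Z i)) (B-conn : ∀ i → Conn Γ (B i))
  (Z-disj : ∀ i j {v} → v ∈ Z i → v ∈ Z j → i ≡ j) (B-disj : ∀ i j {v} → v ∈ B i → v ∈ B j → i ≡ j)
  (B-free : ∀ i {v} → v ∈ B i → v ∉ X)
  (s : Fin p → Fin n) (s∈ : ∀ i → s i ∈ Z i) (r : Fin p → Fin n) (r∈ : ∀ i → r i ∈ X)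
  (join : ∀ i → s i ∈ X ⊎ Edge Γ (r i) (s i)) (r-inj : ∀ i j → s i ∉ X → s j ∉ X → r i ≡ r j → i ≡ j)
  (meets : ∀ i → ∃ λ w → w ∈ Z i × w ∈ B i)
  (exit : ∀ i (S : VSet n) → ⟪ S ⟫ < q → ∃ λ a → ∃ λ v → a ∈ B i × v ∈ R × v ∉ S × Edge M₂ a v)
  (2q≤p : 2 * q ≤ p) where

  private
    Second : Fin p → VSet n
    Second i = ⟦ (λ v → (v ∈? B i) ⊎-dec ((v ≟ r i) ×-dec ¬? (s i ∈? X))) ⟧

    second-inj : ∀ i j {v} → v ∈ B i ⊎ (v ≡ r i × s i ∉ X) → v ∈ B j ⊎ (v ≡ r j × s j ∉ X) → i ≡ j
    second-inj i j (inj₁ a) (inj₁ b) = B-disj i j a b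
    second-inj i j (inj₁ a) (inj₂ (e , _)) = ⊥-elim (B-free i a (subst (_∈ X) (sym e) (r∈ j)))
    second-inj i j (inj₂ (e , _)) (inj₁ b) = ⊥-elim (B-free j b (subst (_∈ X) (sym e) (r∈ i)))
    second-inj i j (inj₂ (e , ¬a)) (inj₂ (e′ , ¬b)) = r-inj i j ¬a ¬b (trans (sym e) e′)

    Blocked : VSet n → (Fin p → VSet n) → VSet p
    Blocked S A = ⟦ (λ i → any? λ v → (v ∈? S) ×-dec (v ∈? A i)) ⟧

    free : (S : VSet n) → ⟪ S ⟫ < q → ∃ λ i → i ∉ Blocked S Z × i ∉ Blocked S Second
    free S small with any? (λ i → ¬? (i ∈? Blocked S Z) ×-dec ¬? (i ∈? Blocked S Second))
    ... | yes i = i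
    ... | no none = ⊥-elim (<⇒≱ small (*-cancelˡ-≤ 2 (begin
      2 * q                                    ≤⟨ 2q≤p ⟩
      p                                        ≡⟨ sym ∣full∣ ⟩
      ⟪ full ⟫                                 ≤⟨ ∣∣-∪ full (Blocked S Z) (Blocked S Second) (λ {i} _ → case i (i ∈? Blocked S Z) (i ∈? Blocked S Second)) ⟩
      ⟪ Blocked S Z ⟫ + ⟪ Blocked S Second ⟫   ≤⟨ ∣∣-injective (Blocked S Z) S Z ∈⁻ (λ {i} {j} _ _ → Z-disj i j) ⊕
                                                  ∣∣-injective (Blocked S Second) S Second ∈⁻ (λ {i} {j} _ _ a b → second-inj i j (∈⁻ a) (∈⁻ b)) ⟩
      ⟪ S ⟫ + ⟪ S ⟫                            ≡⟨ cong (⟪ S ⟫ +_) (sym (+-identityʳ _)) ⟩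
      2 * ⟪ S ⟫                                ∎)))
      where
      open ≤-Reasoning
      case : ∀ i → Dec (i ∈ Blocked S Z) → Dec (i ∈ Blocked S Second) → i ∈ Blocked S Z ⊎ i ∈ Blocked S Second
      case i (yes a) _ = inj₁ a
      case i (no _) (yes b) = inj₂ b
      case i (no a) (no b) = ⊥-elim (none (i , a , b))

  unblocked : ¬ Separation M₂ (R ∪ plain) X R q
  unblocked sep = leave (free (P ∩ Q) small)
    where
    open Separation sep

    Good : Fin n → Set
    Good v = v ∈ P × v ∉ Q

    good : ∀ {v} → v ∈ P → v ∉ P ∩ Q → Good v
    good a h = a , λ b → h (∈⁺ (a , b))

    spread : ∀ {a b} → a ∈ plain → b ∈ plain → b ∉ P ∩ Q → Edge Γ a b → Good a → Good b
    spread a∈ b∈ b∉ e (a , a′) = good (∈-stable λ ¬b → [ ¬b , (λ b → no-edge a a′ b ¬b (plain-edge a∈ b∈ e)) ]′ (cover (∈⁺ (inj₂ b∈)))) b∉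

    module _ (i : Fin p) (Z-free : i ∉ Blocked (P ∩ Q) Z) (S-free : i ∉ Blocked (P ∩ Q) Second) where
      Z∉ : ∀ {v} → v ∈ Z i → v ∉ P ∩ Q
      Z∉ a b = Z-free (∈⁺ (_ , b , a))

      B∉ : ∀ {v} → v ∈ B i → v ∉ P ∩ Q
      B∉ a b = S-free (∈⁺ (_ , b , ∈⁺ (inj₁ a)))

      good-start : Good (s i)
      good-start = case (s i ∈? X) (join i)
        where
        case : Dec (s i ∈ X) → s i ∈ X ⊎ Edge Γ (r i) (s i) → Good (s i)
        case (yes a) _ = good (X⊆P a) (Z∉ (s∈ i))
        case (no ¬a) (inj₁ a) = ⊥-elim (¬a a)
        case (no ¬a) (inj₂ e) = spread (X⊆plain (r∈ i)) (Z⊆ i (s∈ i)) (Z∉ (s∈ i)) e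
          (good (X⊆P (r∈ i)) (λ b → S-free (∈⁺ (_ , b , ∈⁺ (inj₂ (refl , ¬a))))))

      good-bag : ∀ {v} → v ∈ B i → Good v
      good-bag v∈ = let (m , m∈Z , m∈B) = meets i in
        path-invariant Good (λ a b e → spread (B⊆ i a) (B⊆ i b) (B∉ b) e) (B-conn i m∈B v∈)
          (path-invariant Good (λ a b e → spread (Z⊆ i a) (Z⊆ i b) (Z∉ b) e) (Z-conn i (s∈ i) m∈Z) good-start)

    leave : (∃ λ i → i ∉ Blocked (P ∩ Q) Z × i ∉ Blocked (P ∩ Q) Second) → ⊥
    leave (i , zf , sf) =
      let (a , v , a∈ , v∈ , v∉ , e) = exit i (P ∩ Q) small
          (g , g′) = good-bag i zf sf a∈
      in no-edge g g′ (T⊆Q v∈) (λ b → v∉ (∈⁺ (b , T⊆Q v∈))) e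

module Rooting {Γ : Graph n} {U : VSet n} {K : ℕ} (conn : Connectivity Γ U K) {c : ℕ} (μ : Minor Γ U) (dense : Dense c μ)
  (X : VSet n) (X⊆U : X ⊆ U) (2q≤K : 2 * ⟪ X ⟫ ≤ K) (8q≤c : 8 * ⟪ X ⟫ ≤ c) where
  open Minor μ
  open Dense dense

  private
    q = ⟪ X ⟫
    q+q≡2q : q + q ≡ 2 * q
    q+q≡2q = cong (q +_) (sym (+-identityʳ q))

    Hit : VSet n
    Hit = ⟦ (λ v → (v ∈? alive) ×-dec any? λ x → (x ∈? X) ×-dec (x ∈? bag v)) ⟧

    D₀ : VSet n
    D₀ = alive ∖ Hit

    ∣Hit∣ : ⟪ Hit ⟫ ≤ q
    ∣Hit∣ = ∣∣-injective Hit X bag (λ p → proj₂ (∈⁻ p)) (λ p p′ s s′ → bag-disj (proj₁ (∈⁻ p)) (proj₁ (∈⁻ p′)) s s′)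

    D₀⊆ : D₀ ⊆ alive
    D₀⊆ p = proj₁ (∈⁻ p)

    D₀-free : ∀ {v x} → v ∈ D₀ → x ∈ X → x ∉ bag v
    D₀-free {x = x} p x∈ b = proj₂ (∈⁻ p) (∈⁺ (D₀⊆ p , x , x∈ , b))

    D₀-big : q + q ≤ ⟪ D₀ ⟫
    D₀-big = arith q c ⟪ alive ⟫ ⟪ D₀ ⟫ ⟪ Hit ⟫ 8q≤c size-≥ (∣∖∣ alive Hit) ∣Hit∣
      where
      arith : ∀ q c a d h → 8 * q ≤ c → 16 * c ≤ a → a ≤ d + h → h ≤ q → q + q ≤ d
      arith q c a d h p r s t = linear (15 * c + 5 * q) (p ⊕ r ⊕ s ⊕ t) (solve (q ∷ c ∷ a ∷ d ∷ h ∷ []))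

    -- Because one separator vertex may spoil two fans, `2q` of them are wanted. The starts are `X`
    -- together with a private neighbour outside `X` for each of its vertices, available as degrees
    -- are at least `K ≥ 2q`.
    module Neighbours (xs : Choice {k = q} (λ _ → X) ∅) (ys : Choice (λ i → N Γ (pick xs i) ∩ U) X) where
      x y : Fin q → Fin n
      x = pick xs
      y = pick ys

      X′ : VSet n
      X′ = X ∪ ⟦ (λ v → any? λ i → v ≟ y i) ⟧

      start : Fin (q + q) → Fin n
      start i = [ x , y ]′ (splitAt q i)

      start∈ : ∀ i → start i ∈ X′
      start∈ i with splitAt q i
      ... | inj₁ j = ∈⁺ (inj₁ (pick∈ xs j))
      ... | inj₂ j = ∈⁺ (inj₂ (∈⁺ (j , refl)))

      start-inj : ∀ {i j} → start i ≡ start j → i ≡ j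
      start-inj {i} {j} with splitAt q i in eqi | splitAt q j in eqj
      ... | inj₁ a | inj₁ b = λ e → trans (sym (splitAt⁻¹-↑ˡ eqi)) (trans (cong (_↑ˡ q) (pick-injective xs e)) (splitAt⁻¹-↑ˡ eqj))
      ... | inj₁ a | inj₂ b = λ e → ⊥-elim (pick∉ ys b (subst (_∈ X) e (pick∈ xs a)))
      ... | inj₂ a | inj₁ b = λ e → ⊥-elim (pick∉ ys a (subst (_∈ X) (sym e) (pick∈ xs b)))
      ... | inj₂ a | inj₂ b = λ e → trans (sym (splitAt⁻¹-↑ʳ eqi)) (trans (cong (q ↑ʳ_) (pick-injective ys e)) (splitAt⁻¹-↑ʳ eqj))

      X′⊆U : X′ ⊆ U
      X′⊆U p = [ X⊆U , fromY ]′ (∈⁻ p)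
        where
        fromY : ∀ {v} → v ∈ ⟦ (λ v → any? λ i → v ≟ y i) ⟧ → v ∈ U
        fromY s = let (i , e) = ∈⁻ s in subst (_∈ U) (sym e) (proj₂ (∈⁻ (pick∈ ys i)))

      fan : ∃ λ (sr : Fin (q + q) → Fin n) → (∀ i → sr i ∈ X′) × (∀ {i j} → sr i ≡ sr j → i ≡ j) × Fan Γ U D₀ bag (q + q) sr
      fan with menger Γ U X′ D₀ (q + q) X′⊆U (λ p → bag⊆ (D₀⊆ p) (self (D₀⊆ p)))
      ... | inj₂ s = ⊥-elim (no-separation conn (≤-trans (≤-reflexive q+q≡2q) 2q≤K) (∣∣-injection X′ start start∈ start-inj) D₀-big s)
      ... | inj₁ L = src , src∈X , src-injective L , record
              { Z = Z ; τ = tgt ; Z⊆ = Z⊆ ; Z-conn = Z-conn ; src∈ = src∈Z ; τ∈ = tgt∈T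
              ; meets = λ i → tgt i , tgt∈Z i , self (D₀⊆ (tgt∈T i)) ; Z-disj = λ i j → Z-disj ; τ-inj = λ i j → tgt-injective L }
        where open Linkage L

      module Fans (sr : Fin (q + q) → Fin n) (sr∈ : ∀ i → sr i ∈ X′) (sr-inj : ∀ {i j} → sr i ≡ sr j → i ≡ j)
        (F : Fan Γ U D₀ bag (q + q) sr) (touched : ∀ {i w z} → w ∈ D₀ → z ∈ Fan.Z F i → z ∈ bag w → ∃ λ j → Fan.τ F j ≡ w) where
        open Fan F

        Used R₀ : VSet n
        Used = ⟦ (λ v → any? λ j → v ≟ τ j) ⟧
        R₀ = D₀ ∖ Used

        R₀⊆ : R₀ ⊆ alive
        R₀⊆ p = D₀⊆ (proj₁ (∈⁻ p))

        -- Lost are at most `q` bags that meet `X` and the `2q` bags in which fans end.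
        many₀ : ⟪ alive ⟫ ≤ ⟪ R₀ ⟫ + 3 * q
        many₀ = arith ⟪ alive ⟫ ⟪ D₀ ⟫ ⟪ R₀ ⟫ ⟪ Hit ⟫ ⟪ Used ⟫ q (∣∖∣ alive Hit) (∣∖∣ D₀ Used) ∣Hit∣ (∣∣-image Used τ (λ p → ∈⁻ p))
          where
          arith : ∀ a d r h u q → a ≤ d + h → d ≤ r + u → h ≤ q → u ≤ q + q → a ≤ r + 3 * q
          arith a d r h u q s t v w = linear 0 (s ⊕ t ⊕ v ⊕ w) (solve (a ∷ d ∷ r ∷ h ∷ u ∷ q ∷ []))

        open Quotient μ R₀ R₀⊆

        X⊆plain : X ⊆ plain
        X⊆plain p = ∈⁺ (X⊆U p , λ (r , r∈ , b) → D₀-free (proj₁ (∈⁻ r∈)) p b)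

        Z⊆plain : ∀ i → Z i ⊆ plain
        Z⊆plain i p = ∈⁺ (Z⊆ i p , λ (r , r∈ , b) → let (d , u) = ∈⁻ r∈ ; (j , e) = touched d p b in u (∈⁺ (j , sym e)))

        bag⊆plain : ∀ i → bag (τ i) ⊆ plain
        bag⊆plain i p = ∈⁺ (bag⊆ (D₀⊆ (τ∈ i)) p , λ (r , r∈ , b) → let (d , u) = ∈⁻ r∈ in u (∈⁺ (i , bag-disj (D₀⊆ d) (D₀⊆ (τ∈ i)) b p)))

        base : ∀ i → ∃ λ r → r ∈ X × (sr i ∈ X ⊎ (∃ λ j → r ≡ x j × sr i ≡ y j))
        base i = case (∈⁻ (sr∈ i))
          where
          case : sr i ∈ X ⊎ sr i ∈ ⟦ (λ v → any? λ i → v ≟ y i) ⟧ → ∃ λ r → r ∈ X × (sr i ∈ X ⊎ (∃ λ j → r ≡ x j × sr i ≡ y j))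
          case (inj₁ p) = sr i , p , inj₁ p
          case (inj₂ p) = let (j , e) = ∈⁻ p in x j , pick∈ xs j , inj₂ (j , refl , e)

        join : ∀ i → sr i ∈ X ⊎ Edge Γ (proj₁ (base i)) (sr i)
        join i = case (proj₂ (proj₂ (base i)))
          where
          case : sr i ∈ X ⊎ (∃ λ j → proj₁ (base i) ≡ x j × sr i ≡ y j) → sr i ∈ X ⊎ Edge Γ (proj₁ (base i)) (sr i)
          case (inj₁ p) = inj₁ p
          case (inj₂ (j , e , e′)) = inj₂ (subst (λ v → Edge Γ v (sr i)) (sym e) (subst (Edge Γ (x j)) (sym e′) (∈⁻ (proj₁ (∈⁻ (pick∈ ys j))))))

        base-inj : ∀ i j → sr i ∉ X → sr j ∉ X → proj₁ (base i) ≡ proj₁ (base j) → i ≡ j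
        base-inj i j ¬a ¬b eq = case (proj₂ (proj₂ (base i))) (proj₂ (proj₂ (base j)))
          where
          case : sr i ∈ X ⊎ (∃ λ k → proj₁ (base i) ≡ x k × sr i ≡ y k) → sr j ∈ X ⊎ (∃ λ k → proj₁ (base j) ≡ x k × sr j ≡ y k) → i ≡ j
          case (inj₁ a) _ = ⊥-elim (¬a a)
          case _ (inj₁ b) = ⊥-elim (¬b b)
          case (inj₂ (k , e , f)) (inj₂ (l , e′ , f′)) =
            sr-inj (trans f (trans (cong y (pick-injective xs (trans (sym e) (trans eq e′)))) (sym f′)))

        -- Of at least `16c` neighbours of `τ i` in `M`, at most `3q` are outside `R₀` and fewer
        -- than `q` in `S`, while `8q ≤ c`.
        exit : ∀ i (S : VSet n) → ⟪ S ⟫ < q → ∃ λ a → ∃ λ v → a ∈ bag (τ i) × v ∈ R₀ × v ∉ S × Edge M₂ a v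
        exit i S small = step₁ (∣∣>0⇒∃ A (arith q c ⟪ N M (τ i) ∩ alive ⟫ ⟪ A ⟫ ⟪ (alive ∖ R₀) ∪ S ⟫ ⟪ alive ∖ R₀ ⟫ ⟪ S ⟫ ⟪ alive ⟫ ⟪ R₀ ⟫
            8q≤c (deg-≥ (D₀⊆ (τ∈ i))) (∣∖∣ _ ((alive ∖ R₀) ∪ S)) (∣∣-∪ _ (alive ∖ R₀) S ∈⁻)
            (∣∣-disj alive (alive ∖ R₀) R₀ (λ p → proj₁ (∈⁻ p)) R₀⊆ (λ p r → proj₂ (∈⁻ p) r)) many₀ small))
          where
          A : VSet n
          A = (N M (τ i) ∩ alive) ∖ ((alive ∖ R₀) ∪ S)
          arith : ∀ q c d e u o s a r → 8 * q ≤ c → 16 * c ≤ d → d ≤ e + u → u ≤ o + s → o + r ≤ a → a ≤ r + 3 * q → s < q → 0 < e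
          arith q c d e u o s a r h₁ h₂ h₃ h₄ h₅ h₆ h₇ = linear (15 * c + 4 * q) (h₁ ⊕ h₂ ⊕ h₃ ⊕ h₄ ⊕ h₅ ⊕ h₆ ⊕ h₇) (solve (q ∷ c ∷ d ∷ e ∷ u ∷ o ∷ s ∷ a ∷ r ∷ []))
          step₂ : ∀ {v} → Edge M (τ i) v → v ∈ alive → v ∈ R₀ → v ∉ S → ∃ λ a → ∃ λ v → a ∈ bag (τ i) × v ∈ R₀ × v ∉ S × Edge M₂ a v
          step₂ {v} e va r s = let (a , b , a∈ , b∈ , f) = M-edge (D₀⊆ (τ∈ i)) va e in a , v , a∈ , r , s , mixed-edge (bag⊆plain i a∈) r b∈ f
          step₁ : (∃ λ v → v ∈ A) → ∃ λ a → ∃ λ v → a ∈ bag (τ i) × v ∈ R₀ × v ∉ S × Edge M₂ a v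
          step₁ (v , v∈) = let (nv , v∉) = ∈⁻ v∈ ; (e , va) = ∈⁻ nv in
            step₂ (∈⁻ e) va (∈-stable λ ¬r → v∉ (∈⁺ (inj₁ (∈⁺ (va , ¬r))))) (λ s → v∉ (∈⁺ (inj₂ s)))

        unseparated : ¬ Separation M₂ (R₀ ∪ plain) X R₀ q
        unseparated = Unblocked.unblocked Γ M₂ plain R₀ X (q + q) q plain-edge X⊆plain Z (λ i → bag (τ i)) Z⊆plain bag⊆plain Z-conn
          (λ i → bag-conn (D₀⊆ (τ∈ i))) Z-disj (λ i j p p′ → τ-inj i j (bag-disj (D₀⊆ (τ∈ i)) (D₀⊆ (τ∈ j)) p p′)) (λ i p x∈ → D₀-free (τ∈ i) x∈ p)
          sr src∈ (λ i → proj₁ (base i)) (λ i → proj₁ (proj₂ (base i))) join base-inj meets exit (≤-reflexive (sym q+q≡2q))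

        absorb-linkage : Linkage M₂ (R₀ ∪ plain) X R₀ q → Rooted X μ
        absorb-linkage L = record
          { ν = Absorb.absorb X q L ; alive⊆ = R₀⊆ ; M⊑ = λ e → e ; many = many₀
          ; term = Linkage.src L ; root = Linkage.tgt L ; root∈ = Linkage.tgt∈T L ; root-inj = tgt-injective L
          ; term∈X = Linkage.src∈X L ; term∈bag = Absorb.absorbed X q L X⊆plain ; term-onto = src-onto L ≤-refl }

        rooted-via-fan : Rooted X μ
        rooted-via-fan = [ absorb-linkage , (λ sep → ⊥-elim (unseparated sep)) ]′
          (menger M₂ (R₀ ∪ plain) X R₀ q (λ p → ∈⁺ (inj₂ (X⊆plain p))) (λ p → ∈⁺ (inj₁ p)))

  rooted : Rooted X μ
  rooted = choose-neighbours (enumerate X ≤-refl)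
    where
    tighten : (xs : Choice {k = q} (λ _ → X) ∅) (ys : Choice (λ i → N Γ (pick xs i) ∩ U) X) →
      (∃ λ (sr : Fin (q + q) → Fin n) → (∀ i → sr i ∈ Neighbours.X′ xs ys) × (∀ {i j} → sr i ≡ sr j → i ≡ j) × Fan Γ U D₀ bag (q + q) sr) → Rooted X μ
    tighten xs ys (sr , sr∈ , sr-inj , F) = let (F′ , touched) = tight-fan (λ p p′ → bag-disj (D₀⊆ p) (D₀⊆ p′)) F in
      Neighbours.Fans.rooted-via-fan xs ys sr sr∈ sr-inj F′ touched
    choose-neighbours : Choice {k = q} (λ _ → X) ∅ → Rooted X μ
    choose-neighbours xs = let ys = choose (λ i → N Γ (pick xs i) ∩ U) X (λ i → ≤-trans (≤-reflexive q+q≡2q) (≤-trans 2q≤K (min-degree conn (X⊆U (pick∈ xs i))))) in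
      tighten xs ys (Neighbours.fan xs ys)

-- Clique minors in dense graphs

*-^ : ∀ s a b → (a * b) ^ s ≡ a ^ s * b ^ s
*-^ zero    a b = refl
*-^ (suc s) a b = trans (cong (a * b *_) (*-^ s a b)) (shuffle a b (a ^ s) (b ^ s))
  where
  shuffle : ∀ a b x y → a * b * (x * y) ≡ a * x * (b * y)
  shuffle a b x y = solve (a ∷ b ∷ x ∷ y ∷ [])

power-halves : ∀ p q s x r .{{_ : NonZero p}} → p * 2 ≤ q → q ^ s * x ≤ p ^ s * r → 2 ^ s * x ≤ r
power-halves p q s x r 2p≤q le = *-cancelˡ-≤ (p ^ s) {{m^n≢0 p s}} (begin
  p ^ s * (2 ^ s * x)     ≡⟨ sym (*-assoc (p ^ s) (2 ^ s) x) ⟩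
  p ^ s * 2 ^ s * x       ≡⟨ cong (_* x) (sym (*-^ s p 2)) ⟩
  (p * 2) ^ s * x         ≤⟨ *-monoˡ-≤ x (^-monoˡ-≤ s 2p≤q) ⟩
  q ^ s * x               ≤⟨ le ⟩
  p ^ s * r               ∎)
  where open ≤-Reasoning

-- `(3/4)³ = 27/64 < 1/2`: three greedy steps halve the missed part.
cube-halves : ∀ s x r → 4 ^ (3 * s) * x ≤ 3 ^ (3 * s) * r → 2 ^ s * x ≤ r
cube-halves s x r le = power-halves (3 ^ 3) (4 ^ 3) s x r (m≤m+n 54 10)
  (subst₂ (λ a b → a * x ≤ b * r) (sym (^-*-assoc 4 3 s)) (sym (^-*-assoc 3 3 s)) le)

missed : (D : VSet n) (T : VSet k) (hit : Fin n → VSet k) → VSet k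
missed D T hit = ⟦ (λ t → (t ∈? T) ×-dec ¬? (any? λ v → (v ∈? D) ×-dec (t ∈? hit v))) ⟧

-- Double counting of the pairs `(v , t)` with `t` missed by `v`: there are at most `b ⟪ T ⟫`, so
-- some `v` misses no more than the average.
average : (A : VSet n) (T : VSet k) (hit : Fin n → VSet k) (b : ℕ) → 0 < ⟪ A ⟫ →
  (∀ {t} → t ∈ T → ⟪ ⟦ (λ v → (v ∈? A) ×-dec ¬? (t ∈? hit v)) ⟧ ⟫ ≤ b) → ∃ λ v → v ∈ A × ⟪ T ∖ hit v ⟫ * ⟪ A ⟫ ≤ b * ⟪ T ⟫
average {n} {k} A T hit b 0<A h with any? (λ v → (v ∈? A) ×-dec (⟪ T ∖ hit v ⟫ * ⟪ A ⟫ ≤? b * ⟪ T ⟫))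
... | yes p = p
... | no none = ⊥-elim (<⇒≱ 0<A (*-cancelʳ-≤′ ⟪ A ⟫ (b * ⟪ T ⟫) total))
  where
  open ≤-Reasoning
  Miss : Fin n → VSet k
  Miss v = ⟦ (λ t → (v ∈? A) ×-dec (t ∈? T) ×-dec ¬? (t ∈? hit v)) ⟧
  Missᵀ : Fin k → VSet n
  Missᵀ t = ⟦ (λ v → (v ∈? A) ×-dec (t ∈? T) ×-dec ¬? (t ∈? hit v)) ⟧

  row-≥ : ∀ v → suc (b * ⟪ T ⟫) * [ A v ] ≤ ⟪ A ⟫ * ⟪ Miss v ⟫
  row-≥ v = case (v ∈? A)
    where
    case : Dec (v ∈ A) → suc (b * ⟪ T ⟫) * [ A v ] ≤ ⟪ A ⟫ * ⟪ Miss v ⟫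
    case (no ¬p) = ≤-trans (≤-reflexive (trans (cong (suc (b * ⟪ T ⟫) *_) (∉-[] ¬p)) (*-zeroʳ (suc (b * ⟪ T ⟫))))) z≤n
    case (yes p) = begin
      suc (b * ⟪ T ⟫) * [ A v ]  ≡⟨ trans (cong (suc (b * ⟪ T ⟫) *_) (∈-[] p)) (*-identityʳ _) ⟩
      suc (b * ⟪ T ⟫)            ≤⟨ ≰⇒> (λ le → none (v , p , le)) ⟩
      ⟪ T ∖ hit v ⟫ * ⟪ A ⟫      ≡⟨ *-comm ⟪ T ∖ hit v ⟫ ⟪ A ⟫ ⟩
      ⟪ A ⟫ * ⟪ T ∖ hit v ⟫      ≤⟨ ⟪ A ⟫ ⊗ ∣∣-mono (λ q → ∈⁺ (p , ∈⁻ q)) ⟩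
      ⟪ A ⟫ * ⟪ Miss v ⟫         ∎

  col-≤ : ∀ t → ⟪ Missᵀ t ⟫ ≤ b * [ T t ]
  col-≤ t = case (t ∈? T)
    where
    case : Dec (t ∈ T) → ⟪ Missᵀ t ⟫ ≤ b * [ T t ]
    case (yes p) = ≤-trans (∣∣-mono (λ q → let (a , _ , c) = ∈⁻ q in ∈⁺ (a , c))) (≤-trans (h p) (≤-reflexive (sym (trans (cong (b *_) (∈-[] p)) (*-identityʳ b)))))
    case (no ¬p) = ≤-trans (≮⇒≥ {0} λ lt → let (v , q) = ∣∣>0⇒∃ (Missᵀ t) lt in ¬p (proj₁ (proj₂ (∈⁻ q)))) z≤n

  transpose : ∑ (λ v → ⟪ Miss v ⟫) ≤ ∑ (λ t → ⟪ Missᵀ t ⟫)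
  transpose = begin
    ∑ (λ v → ⟪ Miss v ⟫)                ≡⟨ ∑-cong (λ v → ∣∣-∑ (Miss v)) ⟩
    ∑ (λ v → ∑ (λ t → [ Miss v t ]))    ≤⟨ ∑-mono (λ v → ∑-mono λ t → []-mono {S = Miss v} {T = Missᵀ t} (λ p → ∈⁺ (∈⁻ p))) ⟩
    ∑ (λ v → ∑ (λ t → [ Missᵀ t v ]))   ≡⟨ ∑-swap (λ v t → [ Missᵀ t v ]) ⟩
    ∑ (λ t → ∑ (λ v → [ Missᵀ t v ]))   ≡⟨ ∑-cong (λ t → sym (∣∣-∑ (Missᵀ t))) ⟩
    ∑ (λ t → ⟪ Missᵀ t ⟫)               ∎

  total : suc (b * ⟪ T ⟫) * ⟪ A ⟫ ≤ (b * ⟪ T ⟫) * ⟪ A ⟫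
  total = begin
    suc (b * ⟪ T ⟫) * ⟪ A ⟫             ≡⟨ cong (suc (b * ⟪ T ⟫) *_) (∣∣-∑ A) ⟩
    suc (b * ⟪ T ⟫) * ∑ (λ v → [ A v ]) ≡⟨ sym (∑-* (suc (b * ⟪ T ⟫)) (λ v → [ A v ])) ⟩
    ∑ (λ v → suc (b * ⟪ T ⟫) * [ A v ]) ≤⟨ ∑-mono row-≥ ⟩
    ∑ (λ v → ⟪ A ⟫ * ⟪ Miss v ⟫)        ≡⟨ ∑-* ⟪ A ⟫ (λ v → ⟪ Miss v ⟫) ⟩
    ⟪ A ⟫ * ∑ (λ v → ⟪ Miss v ⟫)        ≤⟨ ⟪ A ⟫ ⊗ ≤-trans transpose (∑-mono col-≤) ⟩
    ⟪ A ⟫ * ∑ (λ t → b * [ T t ])       ≡⟨ cong (⟪ A ⟫ *_) (trans (∑-* b (λ t → [ T t ])) (cong (b *_) (sym (∣∣-∑ T)))) ⟩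
    ⟪ A ⟫ * (b * ⟪ T ⟫)                 ≡⟨ *-comm ⟪ A ⟫ (b * ⟪ T ⟫) ⟩
    (b * ⟪ T ⟫) * ⟪ A ⟫                 ∎

  *-cancelʳ-≤′ : ∀ a x → suc x * a ≤ x * a → a ≤ 0
  *-cancelʳ-≤′ a x le = +-cancelʳ-≤ (x * a) a 0 le

-- A vertex found by `average` multiplies the missed part by at most `a / d`; the powers state this
-- without division.
cover-greedily : (A : VSet n) (T : VSet k) (hit : Fin n → VSet k) (a d : ℕ) → 0 < ⟪ A ⟫ →
  (∀ {t} → t ∈ T → d * ⟪ ⟦ (λ v → (v ∈? A) ×-dec ¬? (t ∈? hit v)) ⟧ ⟫ ≤ a * ⟪ A ⟫) →
  ∀ j → ∃ λ D → D ⊆ A × ⟪ D ⟫ ≤ j × d ^ j * ⟪ missed D T hit ⟫ ≤ a ^ j * ⟪ T ⟫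
cover-greedily A T hit a d 0<A h zero = ∅ , (λ { (mem ()) }) , ≮⇒≥ (λ lt → case (∣∣>0⇒∃ ∅ lt)) ,
    +-mono-≤ (∣∣-mono (λ p → proj₁ (∈⁻ p))) z≤n
  where
  case : ¬ ∃ λ v → v ∈ ∅
  case (_ , mem ())
cover-greedily {n} {k} A T hit a d 0<A h (suc j) with cover-greedily A T hit a d 0<A h j
... | D , D⊆ , ∣D∣ , le = next (max-missing)
  where
  T′ = missed D T hit
  missing : Fin k → VSet n
  missing t = ⟦ (λ v → (v ∈? A) ×-dec ¬? (t ∈? hit v)) ⟧

  -- `average` takes an integer bound, but `a ⟪ A ⟫ / d` need not be one. The largest count that
  -- actually occurs serves instead.
  max-missing : ∃ λ b → (∀ {t} → t ∈ T′ → ⟪ missing t ⟫ ≤ b) × d * b ≤ a * ⟪ A ⟫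
  max-missing = go ⟪ A ⟫ (λ _ → ∣∣-mono (λ p → proj₁ (∈⁻ p)))
    where
    go : ∀ b → (∀ {t} → t ∈ T′ → ⟪ missing t ⟫ ≤ b) → ∃ λ b → (∀ {t} → t ∈ T′ → ⟪ missing t ⟫ ≤ b) × d * b ≤ a * ⟪ A ⟫
    go zero    f = 0 , f , ≤-trans (≤-reflexive (*-zeroʳ d)) z≤n
    go (suc b) f with any? (λ t → (t ∈? T′) ×-dec (suc b ≤? ⟪ missing t ⟫))
    ... | yes (t , t∈ , big) = suc b , f , ≤-trans (d ⊗ big) (h (proj₁ (∈⁻ t∈)))
    ... | no none = go b λ {t} t∈ → s≤s⁻¹ (≰⇒> λ le → none (t , t∈ , le))

  next : (∃ λ b → (∀ {t} → t ∈ T′ → ⟪ missing t ⟫ ≤ b) × d * b ≤ a * ⟪ A ⟫) → ∃ λ D → D ⊆ A × ⟪ D ⟫ ≤ suc j × d ^ suc j * ⟪ missed D T hit ⟫ ≤ a ^ suc j * ⟪ T ⟫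
  next (b , f , db≤) with average A T′ hit b 0<A f
  ... | v , v∈ , few = D ∪ ⁅ v ⁆ , (λ p → [ D⊆ , (λ q → subst (_∈ A) (sym (∈⁻ q)) v∈) ]′ (∈⁻ p)) ,
        ≤-trans (∣∣-∪ _ D ⁅ v ⁆ ∈⁻) (≤-trans (∣D∣ ⊕ ∣⁅⁆∣ v) (≤-reflexive (+-comm j 1))) ,
        *-cancelʳ-≤ (d ^ suc j * ⟪ T″ ⟫) (a ^ suc j * ⟪ T ⟫) ⟪ A ⟫ {{>-nonZero 0<A}} (begin
          d ^ suc j * ⟪ T″ ⟫ * ⟪ A ⟫           ≡⟨ *-assoc (d ^ suc j) ⟪ T″ ⟫ ⟪ A ⟫ ⟩
          d ^ suc j * (⟪ T″ ⟫ * ⟪ A ⟫)         ≤⟨ (d ^ suc j) ⊗ ≤-trans (*-monoˡ-≤ ⟪ A ⟫ (∣∣-mono shrink)) few ⟩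
          d ^ suc j * (b * ⟪ T′ ⟫)             ≡⟨ shuffle d (d ^ j) b ⟪ T′ ⟫ ⟩
          d * b * (d ^ j * ⟪ T′ ⟫)             ≤⟨ *-mono-≤ db≤ le ⟩
          a * ⟪ A ⟫ * (a ^ j * ⟪ T ⟫)          ≡⟨ shuffle′ a ⟪ A ⟫ (a ^ j) ⟪ T ⟫ ⟩
          a ^ suc j * ⟪ T ⟫ * ⟪ A ⟫            ∎)
    where
    open ≤-Reasoning
    T″ = missed (D ∪ ⁅ v ⁆) T hit
    shrink : T″ ⊆ (T′ ∖ hit v)
    shrink p = let (t , no-hit) = ∈⁻ p in ∈⁺ (∈⁺ (t , λ (w , w∈ , q) → no-hit (w , ∈⁺ (inj₁ w∈) , q)) , λ q → no-hit (v , ∈⁺ (inj₂ (∈⁺ refl)) , q))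
    shuffle : ∀ d e b t → d * e * (b * t) ≡ d * b * (e * t)
    shuffle d e b t = solve (d ∷ e ∷ b ∷ t ∷ [])
    shuffle′ : ∀ a x e t → a * x * (e * t) ≡ a * e * t * x
    shuffle′ a x e t = solve (a ∷ x ∷ e ∷ t ∷ [])

Nbrs : Graph n → VSet n → VSet n
Nbrs M D = ⟦ (λ v → any? λ u → (u ∈? D) ×-dec edge? M u v) ⟧

-- `blob-dom` is what lets a later blob reach this one with few vertices.
record Blobs (M : Graph n) (R F : VSet n) (s₀ w k : ℕ) : Set where
  field
    blob      : Fin k → VSet n
    blob⊆     : ∀ i → blob i ⊆ (R ∖ F)
    blob-size : ∀ i → ⟪ blob i ⟫ ≤ w
    blob-disj : ∀ i j {v} → v ∈ blob i → v ∈ blob j → i ≡ j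
    blob-adj  : ∀ i j → i ≢ j → ∃ λ u → ∃ λ v → u ∈ blob i × v ∈ blob j × Edge M u v
    blob-dom  : ∀ i → 2 ^ s₀ * ⟪ R ∖ Nbrs M (blob i) ⟫ ≤ ⟪ R ⟫

module _ (M : Graph n) (R F : VSet n) (e s₁ K : ℕ) (K≤ : K ≤ 2 ^ (e * s₁)) where
  private
    s₀ = e + 2
    w  = 3 * s₀ + s₁

  module _ (avail : ∀ (F′ : VSet n) → ⟪ F′ ⟫ ≤ ⟪ F ⟫ + K * w → 0 < ⟪ R ∖ F′ ⟫ × ⟪ R ⟫ ≤ 4 * ⟪ R ∖ F′ ⟫ × (∀ {u} → u ∈ R → ⟪ R ∖ F′ ⟫ ≤ 4 * ⟪ N M u ∩ (R ∖ F′) ⟫)) where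

    module _ (k : ℕ) (k<K : k < K) (β : Blobs M R F s₀ w k) where
      open Blobs β

      private
        F′ : VSet n
        F′ = F ∪ ⋃ blob

        ∣F′∣ : ⟪ F′ ⟫ ≤ ⟪ F ⟫ + K * w
        ∣F′∣ = ≤-trans (∣∣-∪ F′ F (⋃ blob) ∈⁻) (+-monoʳ-≤ ⟪ F ⟫ (begin
          ⟪ ⋃ blob ⟫             ≤⟨ ∣⋃∣ (⋃ blob) blob ∈⁻ ⟩
          ∑ (λ i → ⟪ blob i ⟫)   ≤⟨ ∑-mono blob-size ⟩
          ∑ {k} (λ _ → w)        ≡⟨ ∑-const w ⟩
          k * w                  ≤⟨ *-monoˡ-≤ w (<⇒≤ k<K) ⟩
          K * w                  ∎))
          where open ≤-Reasoning

        A : VSet n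
        A = R ∖ F′

        0<A = proj₁ (avail F′ ∣F′∣)
        R≤4A = proj₁ (proj₂ (avail F′ ∣F′∣))
        A≤4N : ∀ {u} → u ∈ R → ⟪ A ⟫ ≤ 4 * ⟪ N M u ∩ A ⟫
        A≤4N = proj₂ (proj₂ (avail F′ ∣F′∣))

        dominate : ∃ λ D → D ⊆ A × ⟪ D ⟫ ≤ 3 * s₀ × 4 ^ (3 * s₀) * ⟪ missed D R (N M) ⟫ ≤ 3 ^ (3 * s₀) * ⟪ R ⟫
        dominate = cover-greedily A R (N M) 3 4 0<A miss (3 * s₀)
          where
          arith : ∀ a h x → x + h ≤ a → a ≤ 4 * h → 4 * x ≤ 3 * a
          arith a h x p q = linear 0 (4 ⊗ p ⊕ q) (solve (a ∷ h ∷ x ∷ []))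
          miss : ∀ {u} → u ∈ R → 4 * ⟪ ⟦ (λ v → (v ∈? A) ×-dec ¬? (u ∈? N M v)) ⟧ ⟫ ≤ 3 * ⟪ A ⟫
          miss {u} u∈ = arith ⟪ A ⟫ ⟪ N M u ∩ A ⟫ _ (∣∣-disj A ⟦ (λ v → (v ∈? A) ×-dec ¬? (u ∈? N M v)) ⟧ (N M u ∩ A) (λ p → proj₁ (∈⁻ p)) (λ p → proj₂ (∈⁻ p))
            (λ p q → proj₂ (∈⁻ p) (∈⁺ (edge-sym (∈⁻ (proj₁ (∈⁻ q))))))) (A≤4N u∈)

        reach : Fin n → VSet k
        reach v = ⟦ (λ i → v ∈? Nbrs M (blob i)) ⟧

        hitters : ∃ λ H → H ⊆ A × ⟪ H ⟫ ≤ s₁ × (2 ^ e) ^ s₁ * ⟪ missed H full reach ⟫ ≤ 1 ^ s₁ * ⟪ full {k} ⟫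
        hitters = cover-greedily A full reach 1 (2 ^ e) 0<A (λ {i} _ → miss i) s₁
          where
          arith : ∀ p x y r a → x ≤ y → p * 4 * y ≤ r → r ≤ 4 * a → 4 * (p * x) ≤ 4 * (1 * a)
          arith p x y r a h₁ h₂ h₃ = linear 0 ((p * 4) ⊗ h₁ ⊕ h₂ ⊕ h₃) (solve (p ∷ x ∷ y ∷ r ∷ a ∷ []))
          miss : ∀ i → 2 ^ e * ⟪ ⟦ (λ v → (v ∈? A) ×-dec ¬? (i ∈? reach v)) ⟧ ⟫ ≤ 1 * ⟪ A ⟫
          miss i = *-cancelˡ-≤ 4 (arith (2 ^ e) _ ⟪ R ∖ Nbrs M (blob i) ⟫ ⟪ R ⟫ ⟪ A ⟫
            (∣∣-mono {A = ⟦ (λ v → (v ∈? A) ×-dec ¬? (i ∈? reach v)) ⟧} (λ p → let (a , b) = ∈⁻ p in ∈⁺ (proj₁ (∈⁻ a) , λ q → b (∈⁺ q))))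
            (≤-trans (≤-reflexive (cong (_* ⟪ R ∖ Nbrs M (blob i) ⟫) (sym (^-distribˡ-+-* 2 e 2)))) (blob-dom i)) R≤4A)

        -- Fewer than `2^(e s₁)` blobs exist, so the fraction `2^(-e s₁)` of them left untouched is
        -- less than one blob.
        none-missed : ∀ x → (2 ^ e) ^ s₁ * x ≤ 1 ^ s₁ * k → x ≤ 0
        none-missed zero le = z≤n
        none-missed (suc x) le = ⊥-elim (<⇒≱ k<K (≤-trans K≤ (begin
          2 ^ (e * s₁)             ≡⟨ sym (^-*-assoc 2 e s₁) ⟩
          (2 ^ e) ^ s₁             ≤⟨ m≤m*n _ (suc x) ⟩
          (2 ^ e) ^ s₁ * suc x     ≤⟨ le ⟩
          1 ^ s₁ * k               ≡⟨ trans (cong (_* k) (^-zeroˡ s₁)) (*-identityˡ k) ⟩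
          k                        ∎)))
          where open ≤-Reasoning

        D = proj₁ dominate
        H = proj₁ hitters

        new : VSet n
        new = D ∪ H

        new⊆A : new ⊆ A
        new⊆A p = [ proj₁ (proj₂ dominate) , proj₁ (proj₂ hitters) ]′ (∈⁻ p)

        new-adj : ∀ i → ∃ λ u → ∃ λ v → u ∈ new × v ∈ blob i × Edge M u v
        new-adj i = case (any? λ v → (v ∈? H) ×-dec (i ∈? reach v))
          where
          case : Dec (∃ λ v → v ∈ H × i ∈ reach v) → ∃ λ u → ∃ λ v → u ∈ new × v ∈ blob i × Edge M u v
          case (yes (v , v∈ , r)) = let (u , u∈ , f) = ∈⁻ (∈⁻ r) in v , u , ∈⁺ (inj₂ v∈) , u∈ , edge-sym f
          case (no ¬h) = ⊥-elim (∣∣≡0⇒∉ (none-missed _ (≤-trans (proj₂ (proj₂ (proj₂ hitters))) (≤-reflexive (cong (1 ^ s₁ *_) ∣full∣)))) (∈⁺ (mem refl , ¬h)))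

        undominated : (R ∖ Nbrs M new) ⊆ missed D R (N M)
        undominated p = let (r , h) = ∈⁻ p in ∈⁺ (r , λ (v , v∈ , q) → h (∈⁺ (v , ∈⁺ (inj₁ v∈) , ∈⁻ q)))

        new-dom : 2 ^ s₀ * ⟪ R ∖ Nbrs M new ⟫ ≤ ⟪ R ⟫
        new-dom = ≤-trans ((2 ^ s₀) ⊗ ∣∣-mono undominated) (cube-halves s₀ ⟪ missed D R (N M) ⟫ ⟪ R ⟫ (proj₂ (proj₂ (proj₂ dominate))))

      extend : Blobs M R F s₀ w (suc k)
      extend = record { blob = b ; blob⊆ = b⊆ ; blob-size = bs ; blob-disj = bd ; blob-adj = ba ; blob-dom = bdom }
        where
        b : Fin (suc k) → VSet n
        b zero    = new
        b (suc i) = blob i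
        b⊆ : ∀ i → b i ⊆ (R ∖ F)
        b⊆ zero    p = let (r , f) = ∈⁻ (new⊆A p) in ∈⁺ (r , λ q → f (∈⁺ (inj₁ q)))
        b⊆ (suc i) p = blob⊆ i p
        bs : ∀ i → ⟪ b i ⟫ ≤ w
        bs zero    = ≤-trans (∣∣-∪ new D H ∈⁻) (proj₁ (proj₂ (proj₂ dominate)) ⊕ proj₁ (proj₂ (proj₂ hitters)))
        bs (suc i) = blob-size i
        fresh : ∀ i {v} → v ∈ new → v ∉ blob i
        fresh i p q = proj₂ (∈⁻ (new⊆A p)) (∈⁺ (inj₂ (∈⁺ (i , q))))
        bd : ∀ i j {v} → v ∈ b i → v ∈ b j → i ≡ j
        bd zero    zero    p q = refl
        bd zero    (suc j) p q = ⊥-elim (fresh j p q)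
        bd (suc i) zero    p q = ⊥-elim (fresh i q p)
        bd (suc i) (suc j) p q = cong suc (blob-disj i j p q)
        ba : ∀ i j → i ≢ j → ∃ λ u → ∃ λ v → u ∈ b i × v ∈ b j × Edge M u v
        ba zero    zero    ne = ⊥-elim (ne refl)
        ba zero    (suc j) ne = new-adj j
        ba (suc i) zero    ne = let (u , v , p , q , f) = new-adj i in v , u , q , p , edge-sym f
        ba (suc i) (suc j) ne = blob-adj i j (λ q → ne (cong suc q))
        bdom : ∀ i → 2 ^ s₀ * ⟪ R ∖ Nbrs M (b i) ⟫ ≤ ⟪ R ⟫
        bdom zero    = new-dom
        bdom (suc i) = blob-dom i

    blobs : ∀ k → k ≤ K → Blobs M R F s₀ w k
    blobs zero    _   = record { blob = λ () ; blob⊆ = λ () ; blob-size = λ () ; blob-disj = λ () ; blob-adj = λ () ; blob-dom = λ () }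
    blobs (suc k) k<K = extend k k<K (blobs k (<⇒≤ k<K))

-- Each vertex of a label class is joined to a fixed one of the class through a private common neighbour.
module Join (M : Graph n) (R : VSet n) (Lab : Fin m → VSet n) (Lab⊆ : ∀ γ → Lab γ ⊆ R) (Lab-disj : ∀ {γ δ v} → v ∈ Lab γ → v ∈ Lab δ → γ ≡ δ)
  (common : ∀ {u v} → u ∈ R → v ∈ R → 2 * ⟪ ⋃ Lab ⟫ ≤ ⟪ N M u ∩ (N M v ∩ R) ⟫) where

  private
    -- The representative of a class. The default `w` only makes the function total; it is not
    -- returned once the class has an element.
    hub : Fin m → Fin n → Fin n
    hub γ w with any? (λ u → u ∈? Lab γ)
    ... | yes (u , _) = u
    ... | no _        = w

    hub∈ : ∀ {γ w} → w ∈ Lab γ → hub γ w ∈ Lab γ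
    hub∈ {γ} {w} p with any? (λ u → u ∈? Lab γ)
    ... | yes (_ , q) = q
    ... | no _        = p

    hub-const : ∀ {γ w w′} → w ∈ Lab γ → hub γ w ≡ hub γ w′
    hub-const {γ} {w} p with any? (λ u → u ∈? Lab γ)
    ... | yes _ = refl
    ... | no ¬q = ⊥-elim (¬q (w , p))

  module Connectors (cs : Choice {k = ⟪ ⋃ Lab ⟫} (λ _ → ⋃ Lab) ∅) where
    core : Fin ⟪ ⋃ Lab ⟫ → Fin n
    core = pick cs

    γ : Fin ⟪ ⋃ Lab ⟫ → Fin m
    γ i = proj₁ (∈⁻ (pick∈ cs i))

    core∈ : ∀ i → core i ∈ Lab (γ i)
    core∈ i = proj₂ (∈⁻ (pick∈ cs i))

    h : Fin ⟪ ⋃ Lab ⟫ → Fin n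
    h i = hub (γ i) (core i)

    module Connected (ds : Choice (λ i → N M (core i) ∩ (N M (h i) ∩ R)) (⋃ Lab)) where
      conn : Fin ⟪ ⋃ Lab ⟫ → Fin n
      conn = pick ds

      B : Fin m → VSet n
      B δ = ⟦ (λ v → any? λ i → (γ i ≟ δ) ×-dec ((v ≟ core i) ⊎-dec (v ≟ conn i))) ⟧

      conn∈R : ∀ i → conn i ∈ R
      conn∈R i = proj₂ (∈⁻ (proj₂ (∈⁻ (pick∈ ds i))))

      B⊆ : ∀ δ → B δ ⊆ R
      B⊆ δ p = let (i , _ , q) = ∈⁻ p in [ (λ e → subst (_∈ R) (sym e) (Lab⊆ (γ i) (core∈ i))) , (λ e → subst (_∈ R) (sym e) (conn∈R i)) ]′ q

      Lab⊆B : ∀ δ → Lab δ ⊆ B δ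
      Lab⊆B δ {v} p = case (injection-onto (⋃ Lab) core (pick∈ cs) (pick-injective cs) ≤-refl (∈⁺ (δ , p)))
        where
        case : (∃ λ i → core i ≡ v) → v ∈ B δ
        case (i , refl) = ∈⁺ (i , Lab-disj (core∈ i) p , inj₁ refl)

      B-disj : ∀ {δ ε v} → v ∈ B δ → v ∈ B ε → δ ≡ ε
      B-disj p q = let (i , e , a) = ∈⁻ p ; (j , f , b) = ∈⁻ q in trans (sym e) (trans (cong γ (same i j a b)) f)
        where
        same : ∀ i j {v} → v ≡ core i ⊎ v ≡ conn i → v ≡ core j ⊎ v ≡ conn j → i ≡ j
        same i j (inj₁ a) (inj₁ b) = pick-injective cs (trans (sym a) b)
        same i j (inj₁ a) (inj₂ b) = ⊥-elim (pick∉ ds j (subst (_∈ ⋃ Lab) (trans (sym a) b) (pick∈ cs i)))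
        same i j (inj₂ a) (inj₁ b) = ⊥-elim (pick∉ ds i (subst (_∈ ⋃ Lab) (trans (sym b) a) (pick∈ cs j)))
        same i j (inj₂ a) (inj₂ b) = pick-injective ds (trans (sym a) b)

      B-conn : ∀ δ → Conn M (B δ)
      B-conn δ p q = let (i , e , a) = ∈⁻ p ; (j , f , b) = ∈⁻ q in
        path-++ (to-hub i e a) (subst (λ x → Path M (B δ) x _) (sym (same-hub i j (trans e (sym f)))) (path-sym (to-hub j f b)))
        where
        same-hub : ∀ i j → γ i ≡ γ j → h i ≡ h j
        same-hub i j e = trans (hub-const (core∈ i)) (cong (λ δ → hub δ (core j)) e)
        to-hub : ∀ i {v} → γ i ≡ δ → v ≡ core i ⊎ v ≡ conn i → Path M (B δ) v (h i)
        to-hub i refl (inj₂ refl) = cons (∈⁺ (i , refl , inj₂ refl)) (edge-sym (∈⁻ (proj₁ (∈⁻ (proj₂ (∈⁻ (pick∈ ds i))))))) [ Lab⊆B (γ i) (hub∈ (core∈ i)) ]ₚ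
        to-hub i refl (inj₁ refl) = cons (∈⁺ (i , refl , inj₁ refl)) (∈⁻ (proj₁ (∈⁻ (pick∈ ds i)))) (to-hub i refl (inj₂ refl))

  record Joined : Set where
    field
      B      : Fin m → VSet n
      B⊆     : ∀ δ → B δ ⊆ R
      Lab⊆B  : ∀ δ → Lab δ ⊆ B δ
      B-disj : ∀ {δ ε v} → v ∈ B δ → v ∈ B ε → δ ≡ ε
      B-conn : ∀ δ → Conn M (B δ)

  joined : Joined
  joined = go (enumerate (⋃ Lab) ≤-refl)
    where
    go : Choice {k = ⟪ ⋃ Lab ⟫} (λ _ → ⋃ Lab) ∅ → Joined
    go cs = record { Connectors.Connected cs ds }
      where
      ds = choose _ (⋃ Lab) λ i → ≤-trans (≤-reflexive (cong (⟪ ⋃ Lab ⟫ +_) (sym (+-identityʳ _))))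
        (common (Lab⊆ _ (Connectors.core∈ cs i)) (Lab⊆ _ (hub∈ (Connectors.core∈ cs i))))

module Weave {n m : ℕ} {Γ : Graph n} {U : VSet n} (ν : Minor Γ U) (q : ℕ) (term root : Fin q → Fin n)
  (root∈ : ∀ i → root i ∈ Minor.alive ν) (root-inj : ∀ {i j} → root i ≡ root j → i ≡ j) (term∈bag : ∀ i → term i ∈ Minor.bag ν (root i))
  (c A e s₁ : ℕ) (A≤ : A ≤ 2 ^ (e * s₁)) (1≤c : 1 ≤ c) (budget : 8 * (q + A * (3 * (e + 2) + s₁)) ≤ c)
  (degree : ∀ {u} → u ∈ Minor.alive ν → 16 * c ≤ deg (Minor.M ν) (Minor.alive ν) u + 3 * q)
  (size-≤ : ⟪ Minor.alive ν ⟫ ≤ 31 * c) (size-≥ : 16 * c ≤ ⟪ Minor.alive ν ⟫ + 3 * q)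
  (colour : Fin q → Fin m) (slot : Fin A → Fin m) where
  open Minor ν

  private
    w p : ℕ
    w = 3 * (e + 2) + s₁
    p = q + A * w

    q≤p : q ≤ p
    q≤p = m≤m+n q (A * w)

    F : VSet n
    F = ⟦ (λ v → any? λ i → v ≟ root i) ⟧

    ∣F∣≤q : ⟪ F ⟫ ≤ q
    ∣F∣≤q = ∣∣-image F root ∈⁻

    -- At most `p ≤ c/8` vertices are ever used, so a vertex keeps at least `16c - 3q - p ≥ 31c/2`
    -- neighbours among at most `31c`; the required quarter is generous.
    available : ∀ (F′ : VSet n) → ⟪ F′ ⟫ ≤ ⟪ F ⟫ + A * w →
      0 < ⟪ alive ∖ F′ ⟫ × ⟪ alive ⟫ ≤ 4 * ⟪ alive ∖ F′ ⟫ × (∀ {u} → u ∈ alive → ⟪ alive ∖ F′ ⟫ ≤ 4 * ⟪ N M u ∩ (alive ∖ F′) ⟫)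
    available F′ le = lower c p q ⟪ alive ⟫ ⟪ alive ∖ F′ ⟫ ⟪ F′ ⟫ 1≤c budget q≤p size-≥ (∣∖∣ alive F′) F′≤p ,
        quarter c p q ⟪ alive ⟫ ⟪ alive ∖ F′ ⟫ ⟪ F′ ⟫ budget q≤p size-≥ (∣∖∣ alive F′) F′≤p ,
        λ {u} u∈ → nbrs c p q ⟪ alive ⟫ ⟪ alive ∖ F′ ⟫ ⟪ F′ ⟫ (deg M alive u) ⟪ N M u ∩ (alive ∖ F′) ⟫ budget q≤p size-≤ (∣∣-mono (λ x → proj₁ (∈⁻ x)))
          (degree u∈) (∣∣-∪ (N M u ∩ alive) (N M u ∩ (alive ∖ F′)) F′ (λ {x} h → let (a , b) = ∈⁻ h in split a b (x ∈? F′))) F′≤p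
      where
      F′≤p : ⟪ F′ ⟫ ≤ p
      F′≤p = ≤-trans le (+-monoˡ-≤ (A * w) ∣F∣≤q)
      split : ∀ {u x} → x ∈ N M u → x ∈ alive → Dec (x ∈ F′) → x ∈ N M u ∩ (alive ∖ F′) ⊎ x ∈ F′
      split a b (yes f) = inj₂ f
      split a b (no ¬f) = inj₁ (∈⁺ (a , ∈⁺ (b , ¬f)))
      lower : ∀ c p q r a f → 1 ≤ c → 8 * p ≤ c → q ≤ p → 16 * c ≤ r + 3 * q → r ≤ a + f → f ≤ p → 0 < a
      lower c p q r a f h₁ h₂ h₃ h₄ h₅ h₆ = linear (14 * c + 4 * p) (h₁ ⊕ h₂ ⊕ 3 ⊗ h₃ ⊕ h₄ ⊕ h₅ ⊕ h₆) (solve (c ∷ p ∷ q ∷ r ∷ a ∷ f ∷ []))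
      quarter : ∀ c p q r a f → 8 * p ≤ c → q ≤ p → 16 * c ≤ r + 3 * q → r ≤ a + f → f ≤ p → r ≤ 4 * a
      quarter c p q r a f h₂ h₃ h₄ h₅ h₆ = linear (46 * c + 3 * p) (2 ⊗ h₂ ⊕ 9 ⊗ h₃ ⊕ 3 ⊗ h₄ ⊕ 4 ⊗ h₅ ⊕ 4 ⊗ h₆) (solve (c ∷ p ∷ q ∷ r ∷ a ∷ f ∷ []))
      nbrs : ∀ c p q r a f d h → 8 * p ≤ c → q ≤ p → r ≤ 31 * c → a ≤ r → 16 * c ≤ d + 3 * q → d ≤ h + f → f ≤ p → a ≤ 4 * h
      nbrs c p q r a f d h h₁ h₂ h₃ h₄ h₅ h₆ h₇ = linear (31 * c) (2 ⊗ h₁ ⊕ 12 ⊗ h₂ ⊕ h₃ ⊕ h₄ ⊕ 4 ⊗ h₅ ⊕ 4 ⊗ h₆ ⊕ 4 ⊗ h₇) (solve (c ∷ p ∷ q ∷ r ∷ a ∷ f ∷ d ∷ h ∷ []))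

    module Labelled (β : Blobs M alive F (e + 2) w A) where
      open Blobs β

      -- `slot` need not be injective, so a label may own several blobs as well as several roots.
      Lab : Fin m → VSet n
      Lab γ = ⟦ (λ v → (any? λ i → (colour i ≟ γ) ×-dec (v ≟ root i)) ⊎-dec (any? λ j → (slot j ≟ γ) ×-dec (v ∈? blob j))) ⟧

      Lab⊆ : ∀ γ → Lab γ ⊆ alive
      Lab⊆ γ x = case (∈⁻ x)
        where
        case : ∀ {v} → (∃ λ i → colour i ≡ γ × v ≡ root i) ⊎ (∃ λ j → slot j ≡ γ × v ∈ blob j) → v ∈ alive
        case (inj₁ (i , _ , refl)) = root∈ i
        case (inj₂ (j , _ , b)) = proj₁ (∈⁻ (blob⊆ j b))

      Lab-disj : ∀ {γ δ v} → v ∈ Lab γ → v ∈ Lab δ → γ ≡ δ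
      Lab-disj {γ} {δ} x y = case (∈⁻ x) (∈⁻ y)
        where
        case : ∀ {v} → (∃ λ i → colour i ≡ γ × v ≡ root i) ⊎ (∃ λ j → slot j ≡ γ × v ∈ blob j) →
          (∃ λ i → colour i ≡ δ × v ≡ root i) ⊎ (∃ λ j → slot j ≡ δ × v ∈ blob j) → γ ≡ δ
        case (inj₁ (i , e , f)) (inj₁ (i′ , e′ , f′)) = trans (sym e) (trans (cong colour (root-inj (trans (sym f) f′))) e′)
        case (inj₁ (i , e , f)) (inj₂ (j , _ , b)) = ⊥-elim (proj₂ (∈⁻ (blob⊆ j b)) (∈⁺ (i , f)))
        case (inj₂ (j , _ , b)) (inj₁ (i , e , f)) = ⊥-elim (proj₂ (∈⁻ (blob⊆ j b)) (∈⁺ (i , f)))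
        case (inj₂ (j , e , b)) (inj₂ (j′ , e′ , b′)) = trans (sym e) (trans (cong slot (blob-disj j j′ b b′)) e′)

      ∣Lab∣ : ⟪ ⋃ Lab ⟫ ≤ p
      ∣Lab∣ = begin
        ⟪ ⋃ Lab ⟫                      ≤⟨ ∣∣-∪ (⋃ Lab) F (⋃ blob) (λ x → let (γ , y) = ∈⁻ x in case (∈⁻ y)) ⟩
        ⟪ F ⟫ + ⟪ ⋃ blob ⟫             ≤⟨ ∣F∣≤q ⊕ ≤-trans (∣⋃∣ (⋃ blob) blob ∈⁻) (∑-mono blob-size) ⟩
        q + ∑ {A} (λ _ → w)            ≡⟨ cong (q +_) (∑-const w) ⟩
        p                              ∎
        where
        open ≤-Reasoning
        case : ∀ {γ v} → (∃ λ i → colour i ≡ γ × v ≡ root i) ⊎ (∃ λ j → slot j ≡ γ × v ∈ blob j) → v ∈ F ⊎ v ∈ ⋃ blob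
        case (inj₁ (i , _ , f)) = inj₁ (∈⁺ (i , f))
        case (inj₂ (j , _ , b)) = inj₂ (∈⁺ (j , b))

      -- Two degrees of at least `16c - 3q` among at most `31c` vertices overlap in `c - 6q ≥ 2p`,
      -- by `8p ≤ c` and `q ≤ p`.
      common : ∀ {u v} → u ∈ alive → v ∈ alive → 2 * ⟪ ⋃ Lab ⟫ ≤ ⟪ N M u ∩ (N M v ∩ alive) ⟫
      common {u} {v} u∈ v∈ = ≤-trans (2 ⊗ ∣Lab∣) (arith c p q ⟪ alive ⟫ (deg M alive u) (deg M alive v) ⟪ N M u ∩ (N M v ∩ alive) ⟫ budget q≤p (degree u∈) (degree v∈) size-≤
        (≤-trans (∣∣-∪-∩ alive (N M u ∩ alive) (N M v ∩ alive) (λ x → proj₂ (∈⁻ x)) (λ x → proj₂ (∈⁻ x)))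
          (+-monoʳ-≤ ⟪ alive ⟫ (∣∣-mono {A = (N M u ∩ alive) ∩ (N M v ∩ alive)} (λ x → let (a , b) = ∈⁻ x in ∈⁺ (proj₁ (∈⁻ a) , b))))))
        where
        arith : ∀ c p q r d d′ k → 8 * p ≤ c → q ≤ p → 16 * c ≤ d + 3 * q → 16 * c ≤ d′ + 3 * q → r ≤ 31 * c → d + d′ ≤ r + k → 2 * p ≤ k
        arith c p q r d d′ k h₁ h₂ h₃ h₄ h₅ h₆ = linear 0 (h₁ ⊕ 6 ⊗ h₂ ⊕ h₃ ⊕ h₄ ⊕ h₅ ⊕ h₆) (solve (c ∷ p ∷ q ∷ r ∷ d ∷ d′ ∷ k ∷ []))

  record Web : Set where
    field
      B      : Fin m → VSet n
      B⊆     : ∀ γ → B γ ⊆ U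
      B-disj : ∀ {γ δ v} → v ∈ B γ → v ∈ B δ → γ ≡ δ
      B-conn : ∀ γ → Conn Γ (B γ)
      term∈  : ∀ i → term i ∈ B (colour i)
      adjacent : ∀ i j → i ≢ j → ∃ λ u → ∃ λ v → u ∈ B (slot i) × v ∈ B (slot j) × Edge Γ u v

  web : Web
  web = go (blobs M alive F e s₁ A A≤ available A ≤-refl)
    where
    go : Blobs M alive F (e + 2) w A → Web
    go β = finish (Join.joined M alive Lab Lab⊆ Lab-disj common)
      where
      open Labelled β
      open Blobs β
      finish : Join.Joined M alive Lab Lab⊆ Lab-disj common → Web
      finish J = record
        { B = λ γ → lift ν (J.B γ)
        ; B⊆ = λ γ x → let (v , v∈ , b) = ∈⁻ x in bag⊆ (J.B⊆ γ v∈) b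
        ; B-disj = λ {γ} {δ} x y → let (v , v∈ , b) = ∈⁻ x ; (v′ , v′∈ , b′) = ∈⁻ y in
            J.B-disj v∈ (subst (_∈ J.B δ) (sym (bag-disj (J.B⊆ γ v∈) (J.B⊆ δ v′∈) b b′)) v′∈)
        ; B-conn = λ γ → lift-conn ν (J.B⊆ γ) (J.B-conn γ)
        ; term∈ = λ i → ∈⁺ (root i , J.Lab⊆B (colour i) (∈⁺ (inj₁ (i , refl , refl))) , term∈bag i)
        ; adjacent = λ i j ne → let (u , v , u∈ , v∈ , f) = blob-adj i j ne
                                    (a , b , a∈ , b∈ , g) = M-edge (proj₁ (∈⁻ (blob⊆ i u∈))) (proj₁ (∈⁻ (blob⊆ j v∈))) f
                                in a , b , ∈⁺ (u , J.Lab⊆B (slot i) (∈⁺ (inj₂ (i , refl , u∈))) , a∈) , ∈⁺ (v , J.Lab⊆B (slot j) (∈⁺ (inj₂ (j , refl , v∈))) , b∈) , g }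
        where module J = Join.Joined J

record Woven {n m : ℕ} (Γ : Graph n) (U X : VSet n) (colour : Fin n → Fin m) {A : ℕ} (slot : Fin A → Fin m) : Set where
  field
    B        : Fin m → VSet n
    B⊆       : ∀ γ → B γ ⊆ U
    B-disj   : ∀ {γ δ v} → v ∈ B γ → v ∈ B δ → γ ≡ δ
    B-conn   : ∀ γ → Conn Γ (B γ)
    term∈    : ∀ {x} → x ∈ X → x ∈ B (colour x)
    adjacent : ∀ i j → i ≢ j → ∃ λ u → ∃ λ v → u ∈ B (slot i) × v ∈ B (slot j) × Edge Γ u v

-- Serves twice: inside each piece, and with `A = 0` as a pure linkage theorem, where any colouring
-- of few vertices extends to disjoint connected sets.
weave : {Γ : Graph n} {U : VSet n} {K : ℕ} → Connectivity Γ U K → (c A e s₁ : ℕ) → 1 ≤ c → 64 * c ≤ K → A ≤ 2 ^ (e * s₁) →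
  (X : VSet n) → X ⊆ U → 8 * (⟪ X ⟫ + A * (3 * (e + 2) + s₁)) ≤ c → (colour : Fin n → Fin m) (slot : Fin A → Fin m) → Woven Γ U X colour slot
weave {n} {m} {Γ} {U} {K} conn c A e s₁ 1≤c 64c≤K A≤ X X⊆U budget colour slot =
  via-rooting (dense-minor c 1≤c Γ U (≤-<-trans (≤-trans 1≤c (≤-trans (m≤m+n c (63 * c)) 64c≤K)) (large conn)) (e₂≥ Γ U (64 * c) (λ v∈ → ≤-trans 64c≤K (min-degree conn v∈))))
  where
  q = ⟪ X ⟫
  8q≤c : 8 * q ≤ c
  8q≤c = ≤-trans (8 ⊗ m≤m+n q _) budget
  2q≤K : 2 * q ≤ K
  2q≤K = ≤-trans (*-monoˡ-≤ q {2} {8} (s≤s (s≤s z≤n))) (≤-trans 8q≤c (≤-trans (m≤m+n c (63 * c)) 64c≤K))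

  collect : (μ : Minor Γ U) → Dense c μ → Rooted X μ → Woven Γ U X colour slot
  collect μ dense ρ = finish web
    where
    open Rooted ρ
    open Dense dense
    open Minor

    missing : ⟪ alive μ ∖ alive ν ⟫ ≤ 3 * q
    missing = +-cancelʳ-≤ ⟪ alive ν ⟫ _ _ (≤-trans (∣∣-disj (alive μ) (alive μ ∖ alive ν) (alive ν) (λ x → proj₁ (∈⁻ x)) alive⊆ (λ x y → proj₂ (∈⁻ x) y))
      (≤-trans many (≤-reflexive (+-comm ⟪ alive ν ⟫ (3 * q)))))

    degree : ∀ {u} → u ∈ alive ν → 16 * c ≤ deg (M ν) (alive ν) u + 3 * q
    degree {u} u∈ = ≤-trans (deg-≥ (alive⊆ u∈)) (≤-trans (∣∣-∪ (N (M μ) u ∩ alive μ) (N (M ν) u ∩ alive ν) (alive μ ∖ alive ν)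
        (λ {x} h → let (a , b) = ∈⁻ h in split (∈⁻ a) b (x ∈? alive ν))) (+-monoʳ-≤ _ missing))
      where
      split : ∀ {x} → Edge (M μ) u x → x ∈ alive μ → Dec (x ∈ alive ν) → x ∈ N (M ν) u ∩ alive ν ⊎ x ∈ alive μ ∖ alive ν
      split f a (yes b) = inj₁ (∈⁺ (∈⁺ (M⊑ f) , b))
      split f a (no ¬b) = inj₂ (∈⁺ (a , ¬b))

    open Weave ν q term root root∈ root-inj term∈bag c A e s₁ A≤ 1≤c budget degree (≤-trans (∣∣-mono alive⊆) size-≤) (≤-trans size-≥ many) (λ i → colour (term i)) slot

    finish : Web → Woven Γ U X colour slot
    finish W = record { Web W hiding (term∈) ; term∈ = λ x∈ → let (i , eq) = term-onto x∈ in subst (λ x → x ∈ Web.B W (colour x)) eq (Web.term∈ W i) }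

  via-rooting : (∃ λ (μ : Minor Γ U) → Dense c μ) → Woven Γ U X colour slot
  via-rooting (μ , dense) = collect μ dense (Rooting.rooted conn μ dense X X⊆U 2q≤K 8q≤c)

-- Combining the dense parts

connectivity-mono : {Γ Δ : Graph n} {U : VSet n} {K : ℕ} → Γ ⊑ Δ → Connectivity Γ U K → Connectivity Δ U K
connectivity-mono {Γ = Γ} {Δ} {U} h conn = record { large = large conn ; boundary = λ A⊆ a∈ b∈ b∉ b∉∂ →
  ≤-trans (boundary conn A⊆ a∈ b∈ b∉ (λ p → b∉∂ (grow p))) (∣∣-mono grow) }
  where
  grow : ∀ {A} → ∂ Γ U A ⊆ ∂ Δ U A
  grow p = let (u , ¬a , a , a∈ , e) = ∈⁻ p in ∈⁺ (u , ¬a , a , a∈ , h e)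

-- G with every V i made complete, so that a connection can be shortened until it meets V i in at most two vertices.
module Cliques (G : Graph n) (V : Fin k → VSet n) where
  private
    Adj : Fin n → Fin n → Set
    Adj u v = u ≢ v × (Edge G u v ⊎ ∃ λ i → u ∈ V i × v ∈ V i)

  G* : Graph n
  G* = graph {R = Adj} (λ u v → ¬? (u ≟ v) ×-dec (edge? G u v ⊎-dec any? λ i → (u ∈? V i) ×-dec (v ∈? V i)))
    (λ (ne , r) → (λ e → ne (sym e)) , [ (λ e → inj₁ (edge-sym e)) , (λ (i , a , b) → inj₂ (i , b , a)) ]′ r) (λ (ne , _) → ne refl)

  G⊑G* : G ⊑ G*
  G⊑G* e = graph⁺ (edge-≢ e , inj₁ e)

  clique : ∀ {i u v} → u ∈ V i → v ∈ V i → u ≢ v → Edge G* u v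
  clique p q ne = graph⁺ (ne , inj₂ (_ , p , q))

  G*-edge : ∀ {u v} → Edge G* u v → Edge G u v ⊎ ∃ λ i → u ∈ V i × v ∈ V i
  G*-edge e = proj₂ (graph⁻ e)

len : {Γ : Graph n} {S : VSet n} {u v : Fin n} → Path Γ S u v → ℕ
len [ _ ]ₚ       = 0
len (cons _ _ p) = suc (len p)

-- After its last vertex in `W` the path avoids `W`; hence a track that has left `V i` never returns
-- to it.
last-visit : {Γ : Graph n} {B : VSet n} (W : VSet n) {u v : Fin n} (p : Path Γ B u v) →
  (∃ λ (q : Path Γ (B ∖ W) u v) → len q ≤ len p) ⊎
  (∃ λ w → w ∈ W × w ∈ B × (w ≡ v ⊎ ∃ λ w′ → Edge Γ w w′ × ∃ λ (q : Path Γ (B ∖ W) w′ v) → len q < len p))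
last-visit W {u} [ p ]ₚ with u ∈? W
... | yes q = inj₂ (u , q , p , inj₁ refl)
... | no ¬q = inj₁ ([ ∈⁺ (p , ¬q) ]ₚ , z≤n)
last-visit W {u} (cons p e q) with last-visit W q
... | inj₂ (w , a , b , inj₁ c) = inj₂ (w , a , b , inj₁ c)
... | inj₂ (w , a , b , inj₂ (w′ , f , r , lt)) = inj₂ (w , a , b , inj₂ (w′ , f , r , m≤n⇒m≤1+n lt))
... | inj₁ (r , le) with u ∈? W
...   | yes x = inj₂ (u , x , p , inj₂ (_ , e , r , s≤s le))
...   | no ¬x = inj₁ (cons (∈⁺ (p , ¬x)) e r , s≤s le)

module Thin (Δ : Graph n) (V : Fin k → VSet n) (V-disj : ∀ {i j v} → v ∈ V i → v ∈ V j → i ≡ j)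
  (clique : ∀ {i u v} → u ∈ V i → v ∈ V i → u ≢ v → Edge Δ u v) where

  record Track (B : VSet n) (u v : Fin n) : Set where
    field
      S      : VSet n
      S⊆     : S ⊆ B
      S-conn : Conn Δ S
      start∈ : u ∈ S
      end∈   : v ∈ S
      few    : ∀ i → ⟪ S ∩ V i ⟫ ≤ 2

  private
    pair : (a b : Fin n) (T : VSet n) → (∀ {x} → x ∈ T → x ≡ a ⊎ x ≡ b) → ⟪ T ⟫ ≤ 2
    pair a b T h = ≤-trans (∣∣-∪ T ⁅ a ⁆ ⁅ b ⁆ (λ p → [ (λ e → inj₁ (∈⁺ e)) , (λ e → inj₂ (∈⁺ e)) ]′ (h p))) (∣⁅⁆∣ a ⊕ ∣⁅⁆∣ b)

    singleton : ∀ {B u} → u ∈ B → Track B u u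
    singleton {B} {u} p = record { S = ⁅ u ⁆ ; S⊆ = λ q → subst (_∈ B) (sym (∈⁻ q)) p ; S-conn = conn-⁅⁆ ; start∈ = ∈⁺ refl ; end∈ = ∈⁺ refl
      ; few = λ i → pair u u _ (λ q → inj₁ (∈⁻ (proj₁ (∈⁻ q)))) }

    -- Inside V i the path jumps directly from its first vertex u to its last one w.
    jump : ∀ {B u w v i} → u ∈ B → w ∈ B → u ∈ V i → w ∈ V i → w ≡ v ⊎ (∃ λ w′ → Edge Δ w w′ × Track (B ∖ V i) w′ v) → Track B u v
    jump {B} {u} {w} {v} {i} u∈ w∈ u∈V w∈V = go
      where
      link : u ≡ w ⊎ Edge Δ u w
      link with u ≟ w
      ... | yes e = inj₁ e
      ... | no ne = inj₂ (clique u∈V w∈V ne)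
      go : w ≡ v ⊎ (∃ λ w′ → Edge Δ w w′ × Track (B ∖ V i) w′ v) → Track B u v
      go (inj₁ refl) = record { S = ⁅ u ⁆ ∪ ⁅ w ⁆ ; S⊆ = λ p → [ (λ q → subst (_∈ B) (sym (∈⁻ q)) u∈) , (λ q → subst (_∈ B) (sym (∈⁻ q)) w∈) ]′ (∈⁻ p)
        ; S-conn = conn-∪ conn-⁅⁆ conn-⁅⁆ (∈⁺ refl) (∈⁺ refl) link ; start∈ = ∈⁺ (inj₁ (∈⁺ refl)) ; end∈ = ∈⁺ (inj₂ (∈⁺ refl))
        ; few = λ j → pair u w _ (λ p → [ (λ q → inj₁ (∈⁻ q)) , (λ q → inj₂ (∈⁻ q)) ]′ (∈⁻ (proj₁ (∈⁻ p)))) }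
      go (inj₂ (w′ , e , T)) = record { S = ⁅ u ⁆ ∪ (⁅ w ⁆ ∪ S)
        ; S⊆ = λ p → [ (λ q → subst (_∈ B) (sym (∈⁻ q)) u∈) , (λ q → [ (λ r → subst (_∈ B) (sym (∈⁻ r)) w∈) , (λ r → proj₁ (∈⁻ (S⊆ r))) ]′ (∈⁻ q)) ]′ (∈⁻ p)
        ; S-conn = conn-∪ conn-⁅⁆ (conn-∪ conn-⁅⁆ S-conn (∈⁺ refl) start∈ (inj₂ e)) (∈⁺ refl) (∈⁺ (inj₁ (∈⁺ refl))) link
        ; start∈ = ∈⁺ (inj₁ (∈⁺ refl)) ; end∈ = ∈⁺ (inj₂ (∈⁺ (inj₂ end∈))) ; few = few′ }
        where
        open Track T
        few′ : ∀ j → ⟪ (⁅ u ⁆ ∪ (⁅ w ⁆ ∪ S)) ∩ V j ⟫ ≤ 2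
        few′ j = case (j ≟ i)
          where
          case : Dec (j ≡ i) → ⟪ (⁅ u ⁆ ∪ (⁅ w ⁆ ∪ S)) ∩ V j ⟫ ≤ 2
          case (yes refl) = pair u w _ (λ p → let (a , b) = ∈⁻ p in [ (λ q → inj₁ (∈⁻ q)) , (λ q → [ (λ r → inj₂ (∈⁻ r)) , (λ r → ⊥-elim (proj₂ (∈⁻ (S⊆ r)) b)) ]′ (∈⁻ q)) ]′ (∈⁻ a))
          case (no ne) = ≤-trans (∣∣-mono {A = (⁅ u ⁆ ∪ (⁅ w ⁆ ∪ S)) ∩ V j} (λ p → let (a , b) = ∈⁻ p in
              [ (λ q → ⊥-elim (ne (V-disj b (subst (_∈ V i) (sym (∈⁻ q)) u∈V)))) , (λ q → [ (λ r → ⊥-elim (ne (V-disj b (subst (_∈ V i) (sym (∈⁻ r)) w∈V)))) , (λ r → ∈⁺ (r , b)) ]′ (∈⁻ q)) ]′ (∈⁻ a))) (few j)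

    advance : ∀ {B u u′ v} → u ∈ B → (∀ i → u ∉ V i) → Edge Δ u u′ → Track B u′ v → Track B u v
    advance {B} {u} u∈ out e T = record { S = ⁅ u ⁆ ∪ S ; S⊆ = λ p → [ (λ q → subst (_∈ B) (sym (∈⁻ q)) u∈) , S⊆ ]′ (∈⁻ p)
      ; S-conn = conn-∪ conn-⁅⁆ S-conn (∈⁺ refl) start∈ (inj₂ e) ; start∈ = ∈⁺ (inj₁ (∈⁺ refl)) ; end∈ = ∈⁺ (inj₂ end∈)
      ; few = λ i → ≤-trans (∣∣-mono {A = (⁅ u ⁆ ∪ S) ∩ V i} (λ p → let (a , b) = ∈⁻ p in [ (λ q → ⊥-elim (out i (subst (_∈ V i) (∈⁻ q) b))) , (λ q → ∈⁺ (q , b)) ]′ (∈⁻ a))) (few i) }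
      where open Track T

    thin′ : ∀ f {B u v} (p : Path Δ B u v) → len p ≤ f → Track B u v
    thin′ f {B} {u} {v} p le = case p le (any? λ i → u ∈? V i)
      where
      case : (p : Path Δ B u v) → len p ≤ f → Dec (∃ λ i → u ∈ V i) → Track B u v
      case [ p ]ₚ le (no _) = singleton p
      case (cons p e q) le (no out) = forward f le
        where
        forward : ∀ f → suc (len q) ≤ f → Track B u v
        forward (suc f) (s≤s le) = advance p (λ i x → out (i , x)) e (thin′ f q le)
      case p le (yes (i , u∈V)) = visit f le (last-visit (V i) p)
        where
        visit : ∀ f → len p ≤ f → _ → Track B u v
        visit f le (inj₁ (q , _)) = ⊥-elim (proj₂ (∈⁻ (path-start q)) u∈V)
        visit f le (inj₂ (w , w∈V , w∈B , inj₁ e)) = jump (path-start p) w∈B u∈V w∈V (inj₁ e)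
        visit zero le (inj₂ (w , w∈V , w∈B , inj₂ (w′ , e , q , lt))) = ⊥-elim (<⇒≱ lt (≤-trans le z≤n))
        visit (suc f) le (inj₂ (w , w∈V , w∈B , inj₂ (w′ , e , q , lt))) = jump (path-start p) w∈B u∈V w∈V (inj₂ (w′ , e , thin′ f q (s≤s⁻¹ (≤-trans lt le))))

  thin : ∀ {B u v} → Path Δ B u v → Track B u v
  thin p = thin′ _ p ≤-refl

-- Replacing the clique edges of S j inside V i by the connected sets M i j.
module Assemble (G : Graph n) (V : Fin k → VSet n) (V-disj : ∀ {i j v} → v ∈ V i → v ∈ V j → i ≡ j)
  (S : Fin J → VSet n) (S-disj : ∀ {i j v} → v ∈ S i → v ∈ S j → i ≡ j) (S-conn : ∀ j → Conn (Cliques.G* G V) (S j))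
  (hub : Fin J → Fin n) (hub∈ : ∀ j → hub j ∈ S j)
  (M : Fin k → Fin J → VSet n) (M⊆ : ∀ i j → M i j ⊆ V i) (M-disj : ∀ i {j j′ v} → v ∈ M i j → v ∈ M i j′ → j ≡ j′)
  (M-conn : ∀ i j → Conn G (M i j)) (S∩V⊆M : ∀ i j {v} → v ∈ S j → v ∈ V i → v ∈ M i j)
  (touch : ∀ j j′ → j ≢ j′ → ∃ λ i → (∃ λ s → s ∈ S j × s ∈ V i) × (∃ λ s → s ∈ S j′ × s ∈ V i) × ∃ λ u → ∃ λ v → u ∈ M i j × v ∈ M i j′ × Edge G u v) where
  open Cliques G V

  private
    branch : Fin J → VSet n
    branch j = ⟦ (λ v → ((v ∈? S j) ×-dec ¬? (any? λ i → v ∈? V i)) ⊎-dec (any? λ i → (v ∈? M i j) ×-dec any? λ s → (s ∈? S j) ×-dec (s ∈? V i))) ⟧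

    M⊆branch : ∀ {i j s} → s ∈ S j → s ∈ V i → M i j ⊆ branch j
    M⊆branch s∈ s∈V p = ∈⁺ (inj₂ (_ , p , _ , s∈ , s∈V))

    S⊆branch : ∀ {j} → S j ⊆ branch j
    S⊆branch {j} {v} p = case (any? λ i → v ∈? V i)
      where
      case : Dec (∃ λ i → v ∈ V i) → v ∈ branch j
      case (yes (i , q)) = M⊆branch p q (S∩V⊆M i j p q)
      case (no ¬q) = ∈⁺ (inj₁ (p , ¬q))

    local : ∀ {i j s u v} → s ∈ S j → s ∈ V i → u ∈ M i j → v ∈ M i j → Path G (branch j) u v
    local {i} {j} s∈ s∈V p q = path-mono (λ e → e) (M⊆branch s∈ s∈V) (M-conn i j p q)

    expand : ∀ {j u v} → Path G* (S j) u v → Path G (branch j) u v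
    expand [ p ]ₚ = [ S⊆branch p ]ₚ
    expand {j} (cons {v = x} p e q) = case (G*-edge e)
      where
      case : Edge G _ x ⊎ (∃ λ i → _ ∈ V i × x ∈ V i) → Path G (branch j) _ _
      case (inj₁ f) = cons (S⊆branch p) f (expand q)
      case (inj₂ (i , a , b)) = path-++ (local p a (S∩V⊆M i j p a) (S∩V⊆M i j (path-start q) b)) (expand q)

    to-hub : ∀ {j v} → v ∈ branch j → Path G (branch j) v (hub j)
    to-hub {j} {v} p = case (∈⁻ p)
      where
      case : (v ∈ S j × ¬ (∃ λ i → v ∈ V i)) ⊎ (∃ λ i → v ∈ M i j × ∃ λ s → s ∈ S j × s ∈ V i) → Path G (branch j) v (hub j)
      case (inj₁ (s , _)) = expand (S-conn j s (hub∈ j))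
      case (inj₂ (i , m , s , s∈ , s∈V)) = path-++ (local s∈ s∈V m (S∩V⊆M i j s∈ s∈V)) (expand (S-conn j s∈ (hub∈ j)))

    branch-disj : ∀ {j j′ v} → v ∈ branch j → v ∈ branch j′ → j ≡ j′
    branch-disj {j} {j′} {v} p q = case (∈⁻ p) (∈⁻ q)
      where
      case : (v ∈ S j × ¬ (∃ λ i → v ∈ V i)) ⊎ (∃ λ i → v ∈ M i j × ∃ λ s → s ∈ S j × s ∈ V i) →
        (v ∈ S j′ × ¬ (∃ λ i → v ∈ V i)) ⊎ (∃ λ i → v ∈ M i j′ × ∃ λ s → s ∈ S j′ × s ∈ V i) → j ≡ j′
      case (inj₁ (a , _)) (inj₁ (b , _)) = S-disj a b
      case (inj₁ (_ , out)) (inj₂ (i , b , _)) = ⊥-elim (out (i , M⊆ i j′ b))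
      case (inj₂ (i , a , _)) (inj₁ (_ , out)) = ⊥-elim (out (i , M⊆ i j a))
      case (inj₂ (i , a , _)) (inj₂ (i′ , b , _)) = M-disj i a (subst (λ i → v ∈ M i j′) (V-disj (M⊆ i′ j′ b) (M⊆ i j a)) b)

  assemble : HasKMinor G J
  assemble = branch , (λ j → hub j , mem⁻ (S⊆branch (hub∈ j))) , disjoint ,
    (λ j u v p q → walk (conn-hub to-hub (mem p) (mem q))) ,
    λ i j ne → let (_ , (_ , s∈ , s∈V) , (_ , s′∈ , s′∈V) , u , v , u∈ , v∈ , e) = touch i j ne in
      u , v , mem⁻ (M⊆branch s∈ s∈V u∈) , mem⁻ (M⊆branch s′∈ s′∈V v∈) , edge⁻ e
    where
    disjoint : ∀ i j → ¬ i ≡ j → ∀ v → branch i v ≡ true → branch j v ≡ false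
    disjoint i j ne v p with branch j v in eq
    ... | false = refl
    ... | true  = ⊥-elim (ne (branch-disj (mem p) (mem eq)))

-- The class containing v, or j₀ if there is none.
which : (S : Fin J → VSet n) → Fin J → Fin n → Fin J
which S j₀ v with any? (λ j → v ∈? S j)
... | yes (j , _) = j
... | no _        = j₀

which-unique : (S : Fin J → VSet n) (j₀ : Fin J) → (∀ {i j v} → v ∈ S i → v ∈ S j → i ≡ j) → ∀ {j v} → v ∈ S j → which S j₀ v ≡ j
which-unique S j₀ disj {j} {v} p with any? (λ j → v ∈? S j)
... | yes (i , q) = disj q p
... | no ¬q       = ⊥-elim (¬q (j , p))

↑ˡ≢↑ʳ : ∀ {g h} (x : Fin g) (y : Fin h) → x ↑ˡ h ≢ g ↑ʳ y
↑ˡ≢↑ʳ {g} {h} x y e with () ← trans (sym (splitAt-↑ˡ g x h)) (trans (cong (splitAt g) e) (splitAt-↑ʳ g h y))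

-- Colours are pairs (group, position); the pair of groups (a , b) is served by V (combine a b).
module Core {n : ℕ} (G : Graph n) (m g K c e s₁ : ℕ) (1≤c : 1 ≤ c) (64c≤K : 64 * c ≤ K) (slots : g + g ≤ 2 ^ (e * s₁))
  (budget : 8 * (m * g * ((m + m) * 2) + (g + g) * (3 * (e + 2) + s₁)) ≤ c) (G-conn : Connectivity G full K)
  (V : Fin (m * m) → VSet n) (V-disj : ∀ {i j v} → v ∈ V i → v ∈ V j → i ≡ j)
  (Γ : Fin (m * m) → Graph n) (Γ⊑G : ∀ i → Γ i ⊑ G) (V-conn : ∀ i → Connectivity (Γ i) (V i) K)
  (j₀ : Fin (m * g)) (κ₀ : Fin (m + m)) where

  open Cliques G V

  private
    group : Fin (m * g) → Fin m
    group j = proj₁ (remQuot g j)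

    position : Fin (m * g) → Fin g
    position j = proj₂ (remQuot {m} g j)

    -- The `2m` pieces in which the colour `j` must be present: its group stands in the first
    -- coordinate for the first `m` indices and in the second for the rest.
    place : Fin (m * g) → Fin (m + m) → Fin (m * m)
    place j κ = [ combine (group j) , (λ b → combine b (group j)) ]′ (splitAt m κ)

    place′ : Fin (m * g * (m + m)) → Fin (m * m)
    place′ t = place (proj₁ (remQuot (m + m) t)) (proj₂ (remQuot {m * g} (m + m) t))

    small : m * g * ((m + m) * 2) ≤ c
    small = ≤-trans (m≤m+n _ ((g + g) * (3 * (e + 2) + s₁))) (≤-trans (m≤m+n _ _) budget)

    T≤ : m * g * (m + m) ≤ c
    T≤ = ≤-trans (≤-trans (m≤m*n (m * g * (m + m)) 2) (≤-reflexive (*-assoc (m * g) (m + m) 2))) small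

    c≤K : c ≤ K
    c≤K = ≤-trans (m≤m+n c (63 * c)) 64c≤K

    module Terminals (zs : Choice (λ t → V (place′ t)) ∅) where
      z : Fin (m * g) → Fin (m + m) → Fin n
      z j κ = pick zs (combine j κ)

      z∈V : ∀ j κ → z j κ ∈ V (place j κ)
      z∈V j κ = subst (λ x → z j κ ∈ V (place (proj₁ x) (proj₂ x))) (remQuot-combine j κ) (pick∈ zs (combine j κ))

      T : Fin (m * g) → VSet n
      T j = ⟦ (λ v → any? λ κ → v ≟ z j κ) ⟧

      z∈T : ∀ j κ → z j κ ∈ T j
      z∈T j κ = ∈⁺ (κ , refl)

      T-disj : ∀ {i j v} → v ∈ T i → v ∈ T j → i ≡ j
      T-disj {i} {j} p q = let (κ , a) = ∈⁻ p ; (λ′ , b) = ∈⁻ q in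
        cong proj₁ (trans (sym (remQuot-combine i κ)) (trans (cong (remQuot (m + m)) (pick-injective zs (trans (sym a) b))) (remQuot-combine j λ′)))

      ∣T∣ : ⟪ ⋃ T ⟫ ≤ m * g * (m + m)
      ∣T∣ = ≤-trans (∣⋃∣ (⋃ T) T ∈⁻) (≤-trans (∑-mono (λ j → ∣∣-image (T j) (z j) ∈⁻)) (≤-reflexive (∑-const {m * g} (m + m))))

      budget′ : 8 * (⟪ ⋃ T ⟫ + 0) ≤ c
      budget′ = ≤-trans (8 ⊗ ≤-trans (≤-reflexive (+-identityʳ _)) (≤-trans ∣T∣ (≤-trans (≤-trans (m≤m*n (m * g * (m + m)) 2) (≤-reflexive (*-assoc (m * g) (m + m) 2)))
        (m≤m+n _ ((g + g) * (3 * (e + 2) + s₁)))))) budget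

      module Routes (W : Woven G* full (⋃ T) (which T j₀) {0} (λ ())) where
        private module W = Woven W

        z∈B : ∀ j κ → z j κ ∈ W.B j
        z∈B j κ = subst (λ x → z j κ ∈ W.B x) (which-unique T j₀ T-disj (z∈T j κ)) (W.term∈ (∈⁺ (j , z∈T j κ)))

        open Thin G* V V-disj clique

        track : ∀ j κ → Track (W.B j) (z j κ₀) (z j κ)
        track j κ = thin (W.B-conn j (z∈B j κ₀) (z∈B j κ))

        module Tracks (tr : ∀ j κ → Track (W.B j) (z j κ₀) (z j κ)) where
          S : Fin (m * g) → VSet n
          S j = ⋃ (λ κ → Track.S (tr j κ))

          S-disj : ∀ {i j v} → v ∈ S i → v ∈ S j → i ≡ j
          S-disj {i} {j} p q = let (κ , a) = ∈⁻ p ; (λ′ , b) = ∈⁻ q in W.B-disj (Track.S⊆ (tr i κ) a) (Track.S⊆ (tr j λ′) b)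

          S-conn : ∀ j → Conn G* (S j)
          S-conn j = conn-hub {S = S j} λ p → let (κ , a) = ∈⁻ p in
            path-mono (λ f → f) (λ q → ∈⁺ (κ , q)) (Track.S-conn (tr j κ) a (Track.start∈ (tr j κ)))

          z∈S : ∀ j κ → z j κ ∈ S j
          z∈S j κ = ∈⁺ (κ , Track.end∈ (tr j κ))

          few : ∀ i j → ⟪ S j ∩ V i ⟫ ≤ (m + m) * 2
          few i j = ≤-trans (∣⋃∣ (S j ∩ V i) (λ κ → Track.S (tr j κ) ∩ V i) (λ p → let (a , b) = ∈⁻ p ; (κ , q) = ∈⁻ a in κ , ∈⁺ (q , b)))
            (≤-trans (∑-mono (λ κ → Track.few (tr j κ) i)) (≤-reflexive (∑-const {m + m} 2)))

          -- All colours that cross `V i` are prescribed there, also those of other groups, since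
          -- their clique edges inside `V i` need replacing too.
          X : Fin (m * m) → VSet n
          X i = ⋃ S ∩ V i

          ∣X∣ : ∀ i → ⟪ X i ⟫ ≤ m * g * ((m + m) * 2)
          ∣X∣ i = ≤-trans (∣⋃∣ (X i) (λ j → S j ∩ V i) (λ p → let (a , b) = ∈⁻ p ; (j , q) = ∈⁻ a in j , ∈⁺ (q , b)))
            (≤-trans (∑-mono (few i)) (≤-reflexive (∑-const {m * g} ((m + m) * 2))))

          slot : Fin (m * m) → Fin (g + g) → Fin (m * g)
          slot i s = [ combine (proj₁ (remQuot {m} m i)) , combine (proj₂ (remQuot {m} m i)) ]′ (splitAt g s)

          Webs : Set
          Webs = ∀ i → Woven (Γ i) (V i) (X i) (which S j₀) (slot i)

          webs : Webs
          webs i = weave (V-conn i) c (g + g) e s₁ 1≤c 64c≤K slots (X i) (λ p → proj₂ (∈⁻ p)) (≤-trans (8 ⊗ +-monoˡ-≤ _ (∣X∣ i)) budget) (which S j₀) (slot i)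

          module Final (ws : Webs) where
            M : Fin (m * m) → Fin (m * g) → VSet n
            M i = Woven.B (ws i)

            S∩V⊆M : ∀ i j {v} → v ∈ S j → v ∈ V i → v ∈ M i j
            S∩V⊆M i j {v} p q = subst (λ x → v ∈ M i x) (which-unique S j₀ S-disj p) (Woven.term∈ (ws i) (∈⁺ (∈⁺ (j , p) , q)))

            slot-left : ∀ a b x → slot (combine a b) (x ↑ˡ g) ≡ combine a x
            slot-left a b x = trans (cong [ _ , _ ]′ (splitAt-↑ˡ g x g)) (cong (λ r → combine (proj₁ r) x) (remQuot-combine {m} {m} a b))

            slot-right : ∀ a b x → slot (combine a b) (g ↑ʳ x) ≡ combine b x
            slot-right a b x = trans (cong [ _ , _ ]′ (splitAt-↑ʳ g g x)) (cong (λ r → combine (proj₂ r) x) (remQuot-combine {m} {m} a b))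

            place-left : ∀ j b → place j (b ↑ˡ m) ≡ combine (group j) b
            place-left j b = cong [ _ , _ ]′ (splitAt-↑ˡ m b m)

            place-right : ∀ j b → place j (m ↑ʳ b) ≡ combine b (group j)
            place-right j b = cong [ _ , _ ]′ (splitAt-↑ʳ m m b)

            -- A left and a right slot always differ. Hence two colours of one group become adjacent
            -- as well, in the piece of the diagonal pair, where both halves of the slots name the
            -- same colours.
            touch : ∀ j j′ → j ≢ j′ → ∃ λ i → (∃ λ s → s ∈ S j × s ∈ V i) × (∃ λ s → s ∈ S j′ × s ∈ V i) × ∃ λ u → ∃ λ v → u ∈ M i j × v ∈ M i j′ × Edge G u v
            touch j j′ _ =
              let i = combine (group j) (group j′)
                  (u , v , u∈ , v∈ , f) = Woven.adjacent (ws i) (position j ↑ˡ g) (g ↑ʳ position j′) (↑ˡ≢↑ʳ (position j) (position j′))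
              in i , (z j (group j′ ↑ˡ m) , z∈S j _ , subst (λ x → z j (group j′ ↑ˡ m) ∈ V x) (place-left j (group j′)) (z∈V j _))
                   , (z j′ (m ↑ʳ group j) , z∈S j′ _ , subst (λ x → z j′ (m ↑ʳ group j) ∈ V x) (place-right j′ (group j)) (z∈V j′ _))
                   , u , v , subst (λ x → u ∈ M i x) (trans (slot-left (group j) (group j′) (position j)) (combine-remQuot {m} g j)) u∈
                   , subst (λ x → v ∈ M i x) (trans (slot-right (group j) (group j′) (position j′)) (combine-remQuot {m} g j′)) v∈ , Γ⊑G i f

            minor : HasKMinor G (m * g)
            minor = Assemble.assemble G V V-disj S S-disj S-conn (λ j → z j κ₀) (λ j → z∈S j κ₀) M (λ i → Woven.B⊆ (ws i)) (λ i → Woven.B-disj (ws i))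
              (λ i j p q → path-mono (Γ⊑G i) (λ r → r) (Woven.B-conn (ws i) j p q)) S∩V⊆M touch

  minor : HasKMinor G (m * g)
  minor = route (choose-distinct (λ t → V (place′ t)) (λ t → ≤-trans T≤ (≤-trans c≤K (<⇒≤ (large (V-conn (place′ t)))))))
    where
    route : Choice (λ t → V (place′ t)) ∅ → HasKMinor G (m * g)
    -- Linking the terminals is the case of no slots, applied to all of `G*`, which inherits the
    -- connectivity of `G`.
    route zs = through (weave (connectivity-mono G⊑G* G-conn) c 0 e s₁ 1≤c 64c≤K z≤n (⋃ T) (λ _ → mem refl) budget′ (which T j₀) (λ ()))
      where
      open Terminals zs
      through : Woven G* full (⋃ T) (which T j₀) {0} (λ ()) → HasKMinor G (m * g)
      through W = Tracks.Final.minor track (Tracks.webs track)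
        where open Routes W

-- Logarithmic estimates

-- The mean value bound for `x^(k+1)` between `b` and `b + 1`.
bernoulli : ∀ b k → suc b ^ suc k ≤ b ^ suc k + suc k * suc b ^ k
bernoulli b zero    = ≤-reflexive (lemma b)
  where
  lemma : ∀ b → suc b * 1 ≡ b * 1 + 1 * 1
  lemma b = solve (b ∷ [])
bernoulli b (suc k) = arith b k (suc b ^ k) (b ^ suc k) (bernoulli b k) (^-monoˡ-≤ (suc k) (n≤1+n b))
  where
  arith : ∀ b k x y → suc b * x ≤ y + suc k * x → y ≤ suc b * x → suc b * (suc b * x) ≤ b * y + suc (suc k) * (suc b * x)
  arith b k x y p q = linear 0 (suc b ⊗ p ⊕ q) (solve (b ∷ k ∷ x ∷ y ∷ []))

-- An integer substitute for `b^k / k! ≤ e^b`. In the double induction the two terms of `bernoulli`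
-- give the two halves of the next power of two.
power-factorial : ∀ b k → b ^ k ≤ 2 ^ (b + k) * k !
power-factorial b       zero    = ≤-trans (m^n>0 2 (b + 0)) (≤-reflexive (sym (*-identityʳ _)))
power-factorial zero    (suc k) = z≤n
power-factorial (suc b) (suc k) = begin
  suc b ^ suc k                                                        ≤⟨ bernoulli b k ⟩
  b ^ suc k + suc k * suc b ^ k                                        ≤⟨ power-factorial b (suc k) ⊕ suc k ⊗ power-factorial (suc b) k ⟩
  2 ^ (b + suc k) * suc k ! + suc k * (2 ^ (suc b + k) * k !)          ≡⟨ cong (λ x → x * suc k ! + suc k * (2 ^ (suc b + k) * k !)) (cong (2 ^_) (+-suc b k)) ⟩
  2 ^ (suc b + k) * (suc k * k !) + suc k * (2 ^ (suc b + k) * k !)    ≡⟨ arith (2 ^ (suc b + k)) (suc k) (k !) ⟩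
  2 * 2 ^ (suc b + k) * (suc k * k !)                                  ≡⟨ cong (λ x → 2 ^ suc x * suc k !) (sym (+-suc b k)) ⟩
  2 ^ (suc b + suc k) * suc k !                                        ∎
  where
  open ≤-Reasoning
  arith : ∀ p s f → p * (s * f) + s * (p * f) ≡ 2 * p * (s * f)
  arith p s f = solve (p ∷ s ∷ f ∷ [])

-- The terms of the exponential series decay geometrically: a^k / k! ≤ 16^a / 2^k.
term-≤ : ∀ a k → 2 ^ k * a ^ k ≤ 2 ^ (4 * a) * k !
term-≤ a k = *-cancelˡ-≤ (2 ^ k) {{m^n≢0 2 k}} (begin
  2 ^ k * (2 ^ k * a ^ k)           ≡⟨ trans (sym (*-assoc (2 ^ k) (2 ^ k) (a ^ k))) (cong (_* a ^ k) (sym (*-^ k 2 2))) ⟩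
  4 ^ k * a ^ k                     ≡⟨ sym (*-^ k 4 a) ⟩
  (4 * a) ^ k                       ≤⟨ power-factorial (4 * a) k ⟩
  2 ^ (4 * a + k) * k !             ≡⟨ cong (_* k !) (^-distribˡ-+-* 2 (4 * a) k) ⟩
  2 ^ (4 * a) * 2 ^ k * k !         ≡⟨ shuffle (2 ^ (4 * a)) (2 ^ k) (k !) ⟩
  2 ^ k * (2 ^ (4 * a) * k !)       ∎)
  where
  open ≤-Reasoning
  shuffle : ∀ x y z → x * y * z ≡ y * (x * z)
  shuffle x y z = solve (x ∷ y ∷ z ∷ [])

-- The geometric sum `Σ_{k≤N} a^k / k! ≤ 16^a (2 - 2^(-N))`, multiplied out; the subtracted term
-- carries the induction.
expSum-≤ : ∀ a N → 2 ^ N * expSum a N + 2 ^ (4 * a) * N ! ≤ 2 ^ (4 * a) * (N ! * 2 ^ suc N)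
expSum-≤ a zero    = arith (2 ^ (4 * a)) (m^n>0 2 (4 * a))
  where
  arith : ∀ x → 1 ≤ x → 1 * 1 + x * 1 ≤ x * (1 * (2 * 1))
  arith x p = linear 0 p (solve (x ∷ []))
expSum-≤ a (suc N) = arith (2 ^ N) (expSum a N) (2 ^ (4 * a)) (N !) (suc N) (a ^ suc N) (expSum-≤ a N) (term-≤ a (suc N))
  where
  arith : ∀ p E X f s y → p * E + X * f ≤ X * (f * (2 * p)) → 2 * p * y ≤ X * (s * f) → 2 * p * (s * E + y) + X * (s * f) ≤ X * (s * f * (2 * (2 * p)))
  arith p E X f s y h₁ h₂ = linear 0 ((2 * s) ⊗ h₁ ⊕ h₂) (solve (p ∷ E ∷ X ∷ f ∷ s ∷ y ∷ []))

≤exp⇒≤ : ∀ x a → x ≤exp a → x ≤ 2 ^ suc (4 * a)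
≤exp⇒≤ x a (N , h) = *-cancelˡ-≤ (2 ^ N * N !) {{>-nonZero (*-mono-≤ {1} {2 ^ N} {1} {N !} (m^n>0 2 N) (1≤n! N))}} (begin
  2 ^ N * N ! * x                                   ≡⟨ shuffle (2 ^ N) (N !) x ⟩
  2 ^ N * (x * N !)                                 ≤⟨ (2 ^ N) ⊗ h ⟩
  2 ^ N * expSum a N                                ≤⟨ m≤m+n _ _ ⟩
  2 ^ N * expSum a N + 2 ^ (4 * a) * N !            ≤⟨ expSum-≤ a N ⟩
  2 ^ (4 * a) * (N ! * (2 * 2 ^ N))                 ≡⟨ shuffle′ (2 ^ (4 * a)) (N !) (2 ^ N) ⟩
  2 ^ N * N ! * (2 * 2 ^ (4 * a))                   ∎)
  where
  open ≤-Reasoning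
  shuffle : ∀ p f x → p * f * x ≡ p * (x * f)
  shuffle p f x = solve (p ∷ f ∷ x ∷ [])
  shuffle′ : ∀ X f p → X * (f * (2 * p)) ≡ p * f * (2 * X)
  shuffle′ X f p = solve (X ∷ f ∷ p ∷ [])

≤exp0 : ∀ x → x ≤exp 0 → x ≤ 1
≤exp0 x (N , h) = *-cancelʳ-≤ x 1 (N !) {{>-nonZero (1≤n! N)}} (≤-trans h (≤-reflexive (trans (expSum0 N) (sym (+-identityʳ _)))))
  where
  expSum0 : ∀ N → expSum 0 N ≡ N !
  expSum0 zero    = refl
  expSum0 (suc N) = trans (+-identityʳ _) (cong (suc N *_) (expSum0 N))

^-cancelˡ-≤ : ∀ {a b} → 2 ^ a ≤ 2 ^ b → a ≤ b
^-cancelˡ-≤ {a} {b} h = ≮⇒≥ λ lt → <⇒≱ (^-monoʳ-< 2 (s≤s (s≤s z≤n)) lt) h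

^4 : ∀ x → x ^ 4 ≡ x * x * (x * x)
^4 x = lemma x
  where
  lemma : ∀ x → x * (x * (x * (x * 1))) ≡ x * x * (x * x)
  lemma x = solve (x ∷ [])

-- p / q ≥ C t (log t)^{1/4} gives p ≥ D t m q when C = 2 D and log₂ t ≥ m⁴.
GeCtLog⇒≤ : ∀ D t m p q → 2 ^ (m ^ 4) ≤ t → GeCtLog (2 * D) t p q → D * (t * m) * q ≤ p
GeCtLog⇒≤ D t m p q lo h = ≮⇒≥ λ lt → <⇒≱ (too-big p) (begin
  (2 * suc p) ^ 4                                ≤⟨ ^-monoˡ-≤ 4 (2 ⊗ lt) ⟩
  (2 * (D * (t * m) * q)) ^ 4                    ≡⟨ cong (_^ 4) (arrange D t m q) ⟩
  (m * (2 * D * t * q)) ^ 4                      ≡⟨ trans (*-^ 4 m (2 * D * t * q)) (cong (m ^ 4 *_) (trans (*-^ 4 (2 * D * t) q) (cong (_* q ^ 4) (*-^ 4 (2 * D) t)))) ⟩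
  m ^ 4 * ((2 * D) ^ 4 * t ^ 4 * q ^ 4)          ≤⟨ ^-cancelˡ-≤ exponent ⟩
  suc (4 * p ^ 4)                                ∎)
  where
  open ≤-Reasoning
  X = (2 * D) ^ 4 * t ^ 4 * q ^ 4
  exponent : 2 ^ (m ^ 4 * X) ≤ 2 ^ suc (4 * p ^ 4)
  exponent = begin
    2 ^ (m ^ 4 * X)         ≡⟨ sym (^-*-assoc 2 (m ^ 4) X) ⟩
    (2 ^ (m ^ 4)) ^ X       ≤⟨ ^-monoˡ-≤ X lo ⟩
    t ^ X                   ≤⟨ ≤exp⇒≤ (t ^ X) (p ^ 4) h ⟩
    2 ^ suc (4 * p ^ 4)     ∎
  arrange : ∀ D t m q → 2 * (D * (t * m) * q) ≡ m * (2 * D * t * q)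
  arrange D t m q = solve (D ∷ t ∷ m ∷ q ∷ [])
  -- The factor `2⁴` from `C = 2 D` beats the `4` that base 2 costs in `≤exp⇒≤`.
  too-big : ∀ p → suc (4 * p ^ 4) < (2 * suc p) ^ 4
  too-big p = subst₂ (λ a b → suc (4 * a) < b) (sym (^4 p)) (sym (^4 (2 * suc p))) (linear (12 * (p * p * (p * p)) + 64 * (p * p * p) + 96 * (p * p) + 64 * p + 14) (z≤n {0}) (solve (p ∷ [])))

n<2^n : ∀ n → n < 2 ^ n
n<2^n zero    = s≤s z≤n
n<2^n (suc n) = ≤-trans (+-mono-≤ (m^n>0 2 n) (n<2^n n)) (≤-reflexive (cong (2 ^ n +_) (sym (+-identityʳ _))))

first-success : (P : ℕ → Set) → (∀ f → Dec (P f)) → ∀ f → P f → P 0 ⊎ ∃ λ f → P (suc f) × ¬ P f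
first-success P P? zero    p = inj₁ p
first-success P P? (suc f) p with P? f
... | yes q = first-success P P? f q
... | no ¬q = inj₂ (f , p , ¬q)

-- A scale m of order (log t)^{1/4}.
scale : ∀ t → 2 ≤ t → ∀ r → GeHalfSqrtLog r t → ∃ λ m → 1 ≤ m × 2 ^ (m ^ 4) ≤ t × t ≤ 2 ^ (272 * m ^ 4) × m * m ≤ r
scale t 2≤t r h = settle (first-success Big (λ f → t ≤? 2 ^ (272 * suc f ^ 4)) t big-t)
  where
  open ≤-Reasoning
  t≤t⁴ : ∀ t → t ≤ t ^ 4
  t≤t⁴ zero    = z≤n
  t≤t⁴ (suc t) = m≤m*n (suc t) (suc t ^ 3) {{m^n≢0 (suc t) 3}}

  1≤r : 1 ≤ r
  1≤r = positive r h
    where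
    positive : ∀ r → GeHalfSqrtLog r t → 1 ≤ r
    positive zero    h = ⊥-elim (<⇒≱ 2≤t (≤exp0 t h))
    positive (suc r) h = s≤s z≤n

  t≤ : t ≤ 2 ^ suc (4 * (4 * r * r))
  t≤ = ≤exp⇒≤ t (4 * r * r) h

  square-≤ : ∀ a b → a * a ≤ b * b → a ≤ b
  square-≤ a b p = ≮⇒≥ λ lt → <⇒≱ (*-mono-< lt lt) p

  -- As `r ≥ 1`, the exponent `16r² + 1` is at most `17r²`; this is where `17` comes from.
  finish : ∀ m → 17 * m ^ 4 ≤ suc (4 * (4 * r * r)) → m * m ≤ r
  finish m p = square-≤ (m * m) r (*-cancelˡ-≤ 17 (begin
    17 * (m * m * (m * m))       ≡⟨ cong (17 *_) (sym (^4 m)) ⟩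
    17 * m ^ 4                   ≤⟨ p ⟩
    suc (4 * (4 * r * r))        ≤⟨ +-monoˡ-≤ (4 * (4 * r * r)) (*-mono-≤ 1≤r 1≤r) ⟩
    r * r + 4 * (4 * r * r)      ≡⟨ seventeen r ⟩
    17 * (r * r)                 ∎))
    where
    seventeen : ∀ r → r * r + 4 * (4 * r * r) ≡ 17 * (r * r)
    seventeen r = solve (r ∷ [])

  -- `suc f ≤ 2f` and `272 = 17 · 2⁴`: if `f` is too small a scale, then `t` exceeds
  -- `2^(17 (suc f)⁴)`, so the next scale has both lower bounds.
  double : ∀ f → 1 ≤ f → 17 * suc f ^ 4 ≤ 272 * f ^ 4
  double f 1≤f = begin
    17 * suc f ^ 4         ≤⟨ 17 ⊗ ^-monoˡ-≤ 4 (≤-trans (+-monoˡ-≤ f 1≤f) (≤-reflexive (cong (f +_) (sym (+-identityʳ f))))) ⟩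
    17 * (2 * f) ^ 4       ≡⟨ cong (17 *_) (*-^ 4 2 f) ⟩
    17 * (16 * f ^ 4)      ≡⟨ sym (*-assoc 17 16 (f ^ 4)) ⟩
    272 * f ^ 4            ∎

  Big : ℕ → Set
  Big f = t ≤ 2 ^ (272 * suc f ^ 4)

  big-t : Big t
  big-t = ≤-trans (<⇒≤ (n<2^n t)) (^-monoʳ-≤ 2 (≤-trans (n≤1+n t) (≤-trans (t≤t⁴ (suc t)) (m≤n*m (suc t ^ 4) 272))))

  settle : Big 0 ⊎ (∃ λ f → Big (suc f) × ¬ Big f) → ∃ λ m → 1 ≤ m × 2 ^ (m ^ 4) ≤ t × t ≤ 2 ^ (272 * m ^ 4) × m * m ≤ r
  settle (inj₁ hi) = 1 , s≤s z≤n , 2≤t , hi , 1≤r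
  settle (inj₂ (f , hi , lo)) = suc (suc f) , s≤s z≤n , ≤-trans (^-monoʳ-≤ 2 (≤-trans (m≤n*m (suc (suc f) ^ 4) 17) (double (suc f) (s≤s z≤n)))) (<⇒≤ (≰⇒> lo)) , hi ,
    finish (suc (suc f)) (≤-trans (double (suc f) (s≤s z≤n)) (^-cancelˡ-≤ (≤-trans (<⇒≤ (≰⇒> lo)) t≤)))

split-size : ∀ t m → 1 ≤ m → m ≤ t → ∃ λ g → t ≤ m * g × m * g ≤ 2 * t
split-size t m@(suc _) _ m≤t = suc (t / m) , upper (t % m) (t / m) (m≡m%n+[m/n]*n t m) (<⇒≤ (m%n<n t m)) , lower (t % m) (t / m) (m≡m%n+[m/n]*n t m)
  where
  upper : ∀ a b → t ≡ a + b * m → a ≤ m → t ≤ m * suc b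
  upper a b e h = ≤-trans (≤-reflexive e) (≤-trans (+-monoˡ-≤ (b * m) h) (≤-reflexive (*-comm (suc b) m)))
  lower : ∀ a b → t ≡ a + b * m → m * suc b ≤ 2 * t
  lower a b e = ≤-trans (≤-reflexive (*-comm m (suc b))) (≤-trans (+-mono-≤ m≤t (≤-trans (m≤n+m (b * m) a) (≤-reflexive (sym e)))) (≤-reflexive (cong (t +_) (sym (+-identityʳ t)))))

-- With `e = s₁ = 17m²` the exponent is `289m⁴`, and its excess `17m⁴` over `272m⁴` absorbs the
-- factor `4`.
slots-≤ : ∀ m t g → 1 ≤ m → t ≤ 2 ^ (272 * m ^ 4) → m * g ≤ 2 * t → g + g ≤ 2 ^ (17 * (m * m) * (17 * (m * m)))
slots-≤ m t g 1≤m t≤ mg≤ = begin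
  g + g                                        ≤⟨ g≤ ⊕ g≤ ⟩
  2 * t + 2 * t                                ≡⟨ four t ⟩
  4 * t                                        ≤⟨ 4 ⊗ t≤ ⟩
  2 ^ 2 * 2 ^ (272 * m ^ 4)                    ≡⟨ sym (^-distribˡ-+-* 2 2 (272 * m ^ 4)) ⟩
  2 ^ (2 + 272 * m ^ 4)                        ≤⟨ ^-monoʳ-≤ 2 (subst (λ x → 2 + 272 * x ≤ 17 * (m * m) * (17 * (m * m))) (sym (^4 m)) (exponent (m * m) (*-mono-≤ 1≤m 1≤m))) ⟩
  2 ^ (17 * (m * m) * (17 * (m * m)))          ∎
  where
  open ≤-Reasoning
  g≤ : g ≤ 2 * t
  g≤ = ≤-trans (m≤n*m g m {{>-nonZero 1≤m}}) mg≤
  four : ∀ t → 2 * t + 2 * t ≡ 4 * t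
  four t = solve (t ∷ [])
  exponent : ∀ x → 1 ≤ x → 2 + 272 * (x * x) ≤ 17 * x * (17 * x)
  exponent x h = linear 15 (17 ⊗ *-mono-≤ h h) (solve (x ∷ []))

-- Terminals contribute `4`, blobs `136 + 12` multiples of `m · m g`; with the factor `8` and
-- `m g ≤ 2t` this is `8 · 152 · 2 = 2432`.
budget-≤ : ∀ m t g → 1 ≤ m → m * g ≤ 2 * t → 8 * (m * g * ((m + m) * 2) + (g + g) * (3 * (17 * (m * m) + 2) + 17 * (m * m))) ≤ 2432 * (t * m)
budget-≤ m t g 1≤m mg≤ = begin
  8 * (m * g * ((m + m) * 2) + (g + g) * (3 * (17 * (m * m) + 2) + 17 * (m * m)))  ≡⟨ expand m g ⟩
  8 * (4 * m * (m * g) + 136 * m * (m * g) + 12 * g * 1)                           ≤⟨ 8 ⊗ +-monoʳ-≤ (4 * m * (m * g) + 136 * m * (m * g)) ((12 * g) ⊗ *-mono-≤ 1≤m 1≤m) ⟩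
  8 * (4 * m * (m * g) + 136 * m * (m * g) + 12 * g * (m * m))                     ≡⟨ gather m g ⟩
  1216 * m * (m * g)                                                               ≤⟨ (1216 * m) ⊗ mg≤ ⟩
  1216 * m * (2 * t)                                                               ≡⟨ final m t ⟩
  2432 * (t * m)                                                                   ∎
  where
  open ≤-Reasoning
  expand : ∀ m g → 8 * (m * g * ((m + m) * 2) + (g + g) * (3 * (17 * (m * m) + 2) + 17 * (m * m))) ≡ 8 * (4 * m * (m * g) + 136 * m * (m * g) + 12 * g * 1)
  expand m g = solve (m ∷ g ∷ [])
  gather : ∀ m g → 8 * (4 * m * (m * g) + 136 * m * (m * g) + 12 * g * (m * m)) ≡ 1216 * m * (m * g)
  gather m g = solve (m ∷ g ∷ [])
  final : ∀ m t → 1216 * m * (2 * t) ≡ 2432 * (t * m)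
  final m t = solve (m ∷ t ∷ [])

-- Passing from the definitions of the statement, and conclusion

minor-≤ : {G : Graph n} {s t : ℕ} → s ≤ t → HasKMinor G t → HasKMinor G s
minor-≤ s≤t (B , nonempty , disjoint , connected , adjacent) = (λ i → B (ι i)) , (λ i → nonempty (ι i)) ,
  (λ i j ne → disjoint (ι i) (ι j) (λ e → ne (ι-inj e))) , (λ i → connected (ι i)) , λ i j ne → adjacent (ι i) (ι j) (λ e → ne (ι-inj e))
  where
  ι = λ i → inject≤ i s≤t
  ι-inj : ∀ {i j} → ι i ≡ ι j → i ≡ j
  ι-inj e = inject≤-injective s≤t s≤t _ _ e

trivial-clique : {G : Graph n} → Fin n → HasKMinor G 1
trivial-clique {G = G} v = (λ _ → ⁅ v ⁆) , (λ _ → v , mem⁻ {S = ⁅ v ⁆} (∈⁺ refl)) , (λ { zero zero ne → ⊥-elim (ne refl) }) ,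
  (λ _ u w p q → walk (conn-⁅⁆ (mem p) (mem q))) , λ { zero zero ne → ⊥-elim (ne refl) }

-- If the boundary of `A` were small, its removal would leave a walk from `a` to `b`; but a walk
-- avoiding the boundary never leaves `A`.
kconnected : {G : Graph n} {k K : ℕ} → KConnected G k → K ≤ k → Connectivity G full K
kconnected {n} {G} {k} {K} (k<n , conn) K≤k = record
  { large = ≤-trans (s≤s K≤k) (≤-trans k<n (≤-reflexive (sym ∣full∣)))
  ; boundary = λ {A} {a} {b} _ a∈ b∈ b∉ b∉∂ → ≮⇒≥ λ lt → b∉ (reach A (conn (∂ G full A) (≤-trans (s≤s (≤-reflexive (sym (∣∣≡card _)))) (≤-trans lt K≤k)) a b
      (outside (λ p → proj₁ (proj₂ (∈⁻ p)) a∈)) (outside b∉∂)) a∈) }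
  where
  outside : ∀ {S : VSet n} {v} → v ∉ S → not (S v) ≡ true
  outside {S} {v} h with S v in eq
  ... | true  = ⊥-elim (h (mem eq))
  ... | false = refl
  inside : ∀ {S : VSet n} {v} → not (S v) ≡ true → v ∉ S
  inside h (mem p) rewrite p with () ← h
  reach : ∀ A {u v} → Walk G (λ v → not (∂ G full A v)) u v → u ∈ A → v ∈ A
  reach A (here _) p = p
  reach A (step {u} {v} _ e w) p = reach A w (∈-stable λ ¬q → inside (walk-start w) (∈⁺ (mem refl , ¬q , u , p , edge e)))
    where
    walk-start : ∀ {u v} → Walk G (λ v → not (∂ G full A v)) u v → not (∂ G full A u) ≡ true
    walk-start (here p)     = p
    walk-start (step p _ _) = p

module _ {G : Graph n} (H : Subgraph G) where

  subgraph : Graph n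
  subgraph = record { adj = es H ; sym = es-sym H ; irrefl = loopless }
    where
    loopless : ∀ i → es H i i ≡ false
    loopless i with es H i i in eq
    ... | false = refl
    ... | true with () ← trans (sym (es-adj H i i eq)) (irrefl G i)

  subgraph⊑ : subgraph ⊑ G
  subgraph⊑ (edge e) = edge (es-adj H _ _ e)

  -- Each edge is counted once on the left, as a pair with `j` below `i`; the second orientation is
  -- given away.
  ∣E∣ₛ≤e₂ : ∣E∣ₛ H ≤ e₂ subgraph (vs H)
  ∣E∣ₛ≤e₂ = begin
    ∣E∣ₛ H                                                   ≡⟨ sum-map-allFin (λ i → _) ⟩
    ∑ (λ i → _)                                              ≡⟨ ∑-cong (λ i → sum-map-allFin (λ j → [ lower i j ])) ⟩
    ∑ (λ i → ∑ (λ j → [ lower i j ]))                        ≤⟨ ∑-mono (λ i → ∑-mono λ j → []-mono {S = lower i} {T = E subgraph (vs H) i} (inE i j)) ⟩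
    ∑ (λ i → ∑ (λ j → [ E subgraph (vs H) i j ]))            ≡⟨ ∑-cong (λ i → sym (∣∣-∑ (E subgraph (vs H) i))) ⟩
    e₂ subgraph (vs H)                                       ∎
    where
    open ≤-Reasoning
    lower : Fin n → VSet n
    lower i j = does (toℕ j <? toℕ i) ∧ es H i j
    ∧-right : ∀ a {b} → a ∧ b ≡ true → b ≡ true
    ∧-right true  e = e
    ∧-right false ()
    inE : ∀ i j → j ∈ lower i → j ∈ E subgraph (vs H) i
    inE i j (mem p) = let e = ∧-right (does (toℕ j <? toℕ i)) p in
      ∈⁺ (mem (es-vs H i j e) , mem (es-vs H j i (trans (es-sym H j i) e)) , edge e)

module Main (c₀ : ℕ) (2432≤c₀ : 2432 ≤ c₀) where

  clique-minor : ∀ t → 2 ≤ t → (G : Graph n) (r : ℕ) → (∃ λ k → KConnected G k × GeCtLog (2 * (4 * (64 * c₀))) t k 1) → GeHalfSqrtLog r t →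
    (H : Fin r → Subgraph G) → (∀ i j → ¬ i ≡ j → ∀ v → vs (H i) v ≡ true → vs (H j) v ≡ false) → (∀ i → 1 ≤ ∣V∣ₛ (H i)) →
    (∀ i → GeCtLog (2 * (4 * (64 * c₀))) t (∣E∣ₛ (H i)) (∣V∣ₛ (H i))) → HasKMinor G t
  clique-minor {n} t 2≤t G r (k , G-conn , k≥) r≥ H H-disj H≥1 H-dense = at-scale (scale t 2≤t r r≥)
    where
    at-scale : (∃ λ m → 1 ≤ m × 2 ^ (m ^ 4) ≤ t × t ≤ 2 ^ (272 * m ^ 4) × m * m ≤ r) → HasKMinor G t
    at-scale (m , 1≤m , lo , hi , mm≤r) = with-groups (split-size t m 1≤m (≤-trans m≤2^m⁴ lo))
      where
      m≤2^m⁴ : m ≤ 2 ^ (m ^ 4)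
      m≤2^m⁴ = ≤-trans (m≤m*n m (m ^ 3) {{m^n≢0 m 3 {{>-nonZero 1≤m}}}}) (<⇒≤ (n<2^n (m ^ 4)))

      c K : ℕ
      c = c₀ * (t * m)
      K = 64 * c

      1≤c : 1 ≤ c
      1≤c = *-mono-≤ (≤-trans (s≤s z≤n) 2432≤c₀) (*-mono-≤ (≤-trans (s≤s z≤n) 2≤t) 1≤m)

      bound : ∀ p q → GeCtLog (2 * (4 * (64 * c₀))) t p q → 4 * K * q ≤ p
      bound p q h = ≤-trans (≤-reflexive (arrange c₀ (t * m) q)) (GeCtLog⇒≤ (4 * (64 * c₀)) t m p q lo h)
        where
        arrange : ∀ c x q → 4 * (64 * (c * x)) * q ≡ 4 * (64 * c) * x * q
        arrange c x q = solve (c ∷ x ∷ q ∷ [])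

      ι : Fin (m * m) → Fin r
      ι i = inject≤ i mm≤r

      dense-part : ∀ i → ∃ λ V → V ⊆ vs (H (ι i)) × Connectivity (subgraph (H (ι i))) V K
      dense-part i = mader (subgraph (H (ι i))) K (vs (H (ι i))) (≤-trans 1≤c (m≤m+n c (63 * c)))
        (≤-trans (H≥1 (ι i)) (≤-reflexive (sym (∣∣≡card _))))
        (≤-trans (≤-reflexive (cong (4 * K *_) (∣∣≡card _))) (≤-trans (bound _ _ (H-dense (ι i))) (∣E∣ₛ≤e₂ (H (ι i)))))

      module Parts (parts : ∀ i → ∃ λ V → V ⊆ vs (H (ι i)) × Connectivity (subgraph (H (ι i))) V K) where
        V : Fin (m * m) → VSet n
        V i = proj₁ (parts i)

        V-disj : ∀ {i j v} → v ∈ V i → v ∈ V j → i ≡ j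
        V-disj {i} {j} {v} p q = case (ι i ≟ ι j)
          where
          case : Dec (ι i ≡ ι j) → i ≡ j
          case (yes e) = inject≤-injective mm≤r mm≤r i j e
          case (no ne) with () ← trans (sym (mem⁻ (proj₁ (proj₂ (parts j)) q))) (H-disj (ι i) (ι j) ne v (mem⁻ (proj₁ (proj₂ (parts i)) p)))

        minor : ∀ g → t ≤ m * g → m * g ≤ 2 * t → HasKMinor G t
        minor g t≤mg mg≤2t = minor-≤ t≤mg (Core.minor G m g K c (17 * (m * m)) (17 * (m * m)) 1≤c ≤-refl (slots-≤ m t g 1≤m hi mg≤2t)
          (≤-trans (budget-≤ m t g 1≤m mg≤2t) (*-monoˡ-≤ (t * m) 2432≤c₀))
          (kconnected G-conn (≤-trans K≤4K (bound k 1 k≥)))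
          V V-disj (λ i → subgraph (H (ι i))) (λ i → subgraph⊑ (H (ι i))) (λ i → proj₂ (proj₂ (parts i)))
          (fromℕ< (≤-trans (≤-trans (s≤s z≤n) 2≤t) t≤mg)) (fromℕ< (≤-trans 1≤m (m≤m+n m m))))
          where
          K≤4K : K ≤ 4 * K * 1
          K≤4K = ≤-trans (m≤m+n K (3 * K)) (≤-reflexive (sym (*-identityʳ (4 * K))))

      with-groups : (∃ λ g → t ≤ m * g × m * g ≤ 2 * t) → HasKMinor G t
      with-groups (g , a , b) = Parts.minor dense-part g a b

theorem2p6 : Σ ℕ λ C → 1 < C ×
    (∀ (t : ℕ) → 1 ≤ t → ∀ (n : ℕ) (G : Graph n) (r : ℕ) →
    (Σ ℕ λ k → KConnected G k × GeCtLog C t k 1) →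
    GeHalfSqrtLog r t →
    (H : Fin r → Subgraph G) →
    (∀ i j → ¬ i ≡ j → ∀ v → vs (H i) v ≡ true → vs (H j) v ≡ false) →
    (∀ i → 1 ≤ ∣V∣ₛ (H i)) →
    (∀ i → GeCtLog C t (∣E∣ₛ (H i)) (∣V∣ₛ (H i))) →
    HasKMinor G t)
-- The factors of `C`: `2` for comparing with base 2, `4` for `mader`, `64` for `dense-minor`, and
-- `2432` for the vertex budget of a piece.
theorem2p6 = 2 * (4 * (64 * 2432)) , s≤s (s≤s z≤n) , λ where
  -- At `t = 1` the logarithm vanishes, so `r` may be `0` and no scale `m` is available; any vertex
  -- is the minor.
  (suc zero)    _ n G r (k , (k<n , _) , _) _ _ _ _ _ → trivial-clique (fromℕ< k<n)
  (suc (suc t)) _ n G r → Main.clique-minor 2432 ≤-refl (suc (suc t)) (s≤s (s≤s z≤n)) G r
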